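{- Let $k\geqslant 4$ be a fixed integer and consider the random $K_k$-removal algorithm on the vertex set $[n]$. Let $M$ be the number of steps it takes the process to terminate and let $E(M)$ be the edge set of the resulting $K_k$-free graph $G(M)$. Then, with high probability (i.e. with probability tending to $1$ as $n\to\infty$), $$|E(M)|\leqslant n^{2-\frac{1}{k(k-1)-2}+o(1)}.$$
   Context: The random $K_k$-removal algorithm: start with $G(0)$ the complete graph on vertex set $[n]=\{1,\dots,n\}$. Given $G(i)$, the graph $G(i+1)$ is obtained by choosing one copy of $K_k$ uniformly at random among all copies of $K_k$ in $G(i)$ and deleting all of its edges. The algorithm stops at the hitting time $M=\min\{i: G(i)\text{ is }K_k\text{ -free}\}$. $E(i)$ denotes the edge set of $G(i)$. Asymptotics are as $n\to\infty$. -}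

module Defs where

open import Data.Nat as ℕ using (ℕ; zero; suc; _*_; _∸_; _^_; _≤ᵇ_)
open import Data.Bool using (Bool; true; false; _∧_; not; if_then_else_)
open import Data.List using (List; []; _∷_; map; _++_; foldr; length)
open import Data.Bool.ListAction using (any; all)
open import Data.Fin using (Fin; _≟_)
open import Data.Fin.Base using ()
open import Data.List.Base using ()
open import Data.Product using (_×_; _,_; proj₁; proj₂)
open import Relation.Nullary.Decidable using (⌊_⌋)
open import Data.Integer using (+_)
open import Data.Rational using (ℚ; 0ℚ; 1ℚ; _+_; _/_)
import Data.Rational as ℚ

combinations : {A : Set} → ℕ → List A → List (List A)
combinations zero    _        = [] ∷ []
combinations (suc k) []       = []
combinations (suc k) (x ∷ xs) = map (x ∷_) (combinations k xs) ++ combinations (suc k) xs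

pairs : {A : Set} → List A → List (A × A)
pairs []       = []
pairs (x ∷ xs) = map (x ,_) xs ++ pairs xs

allVertices : (n : ℕ) → List (Fin n)
allVertices n = Data.List.allFin n
  where import Data.List

-- a (simple) graph on [n], given by its adjacency (only pairs i ≠ j matter)
Graph : ℕ → Set
Graph n = Fin n → Fin n → Bool

completeGraph : (n : ℕ) → Graph n
completeGraph n i j = not ⌊ i ≟ j ⌋

edgeCount : {n : ℕ} → Graph n → ℕ
edgeCount {n} G = length (Data.List.filterᵇ (λ p → G (proj₁ p) (proj₂ p)) (pairs (allVertices n)))
  where import Data.List

isClique : {n : ℕ} → Graph n → List (Fin n) → Bool
isClique G S = all (λ p → G (proj₁ p) (proj₂ p)) (pairs S)

cliques : {n : ℕ} → ℕ → Graph n → List (List (Fin n))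
cliques {n} k G = Data.List.filterᵇ (isClique G) (combinations k (allVertices n))
  where import Data.List

memᵇ : {n : ℕ} → Fin n → List (Fin n) → Bool
memᵇ i S = any (λ j → ⌊ i ≟ j ⌋) S

removeClique : {n : ℕ} → Graph n → List (Fin n) → Graph n
removeClique G S i j = G i j ∧ not (memᵇ i S ∧ memᵇ j S)

sumℚ : List ℚ → ℚ
sumℚ = foldr _+_ 0ℚ

-- Probability that the final graph G(M) of the random K_k-removal process
-- started from G satisfies P, using `fuel` as a step bound
-- (fuel ≥ |E(G)| suffices since each step deletes at least one edge when k ≥ 2).
probFinal : {n : ℕ} → (k : ℕ) → ℕ → Graph n → (Graph n → Bool) → ℚ
probFinal k zero G P = if P G then 1ℚ else 0ℚ
probFinal k (suc fuel) G P with cliques k G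
... | []     = if P G then 1ℚ else 0ℚ
... | c ∷ cs =
  (+ 1 / suc (length cs)) ℚ.* sumℚ (map (λ S → probFinal k fuel (removeClique G S) P) (c ∷ cs))

-- Probability that the random K_k-removal process on [n] (started from K_n)
-- terminates in a graph G(M) with property P.  Fuel n*n ≥ |E(K_n)|.
probRemoval : (k n : ℕ) → (Graph n → Bool) → ℚ
probRemoval k n P = probFinal k (n * n) (completeGraph n) P

-- For ε = a/b: the event  |E(G)| ≤ n^{2 - 1/D + a/b}  with D = k(k-1)-2,
-- written in integers as |E(G)|^{D*b} ≤ n^{(2D-1)*b + a*D}.
smallEdgeSet : (k n a b : ℕ) → Graph n → Bool
smallEdgeSet k n a b G =
  let D = k * (k ∸ 1) ∸ 2 in
  (edgeCount G ^ (D * b)) ≤ᵇ (n ^ ((2 * D ∸ 1) * b ℕ.+ a * D))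

-- The process is a random greedy matching in the hypergraph whose vertices are the surviving edges and whose hyperedges
-- are the surviving copies of K_k: it is r-uniform with r = k(k-1)/2, and two vertices share at most L = n^(k-3)
-- hyperedges.  Let A be the number of vertices, Q the number of hyperedges, d e the degree of e and m = rQ/A the average
-- degree.  As long as every d e is within ηm of m, the average m drops by a controlled factor in each step, so that m^q
-- stays above a constant times A^((r-1)q + 1); in particular Q > 0.  The deviations x e = d e - m are governed by the
-- moment Φ = Σ (x e)^q, q = 2b.  To first order, E[Δ x e] is proportional to -((r-1) m (x e) + Σ x f), with the sum over
-- the neighbours f of e counted with multiplicity.  Since (x e)^(q-1) (x f) + (x f)^(q-1) (x e) ≥ -((x e)^q + (x f)^q), the
-- contraction pays for the pull of the neighbours, Φ gains at most a factor 1 + r/A and a bounded noise in each step, and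
-- Ψ = A (Φ + S₀) is a supermartingale for a suitable constant S₀.  For a suitable threshold Th it starts below δ Th, and it
-- is at least Th as soon as some |x e| ≥ ηm while A is large, so the process gets stuck with large A with probability at
-- most δ.
module Submission where

open import Data.Bool using (Bool; true; false; _∧_; _∨_; not; if_then_else_)
open import Data.Bool.ListAction using (any; all)
open import Data.Empty using (⊥; ⊥-elim)
open import Data.Fin as Fin using (Fin)
import Data.Fin.Properties as Finₚ
open import Data.Integer as ℤ using (+_)
import Data.Integer.Properties as ℤₚ
open import Data.Integer.Tactic.RingSolver using () renaming (solve-∀ to ℤ-solve-∀)
open import Data.List using (List; []; _∷_; _++_; map; filterᵇ; length)
open import Data.List.Membership.Propositional using (_∈_; _∉_)
open import Data.List.Membership.Propositional.Properties using (∈-++⁻; ∈-map⁻; ∈-allFin)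
import Data.List.Properties as Listₚ
open import Data.List.Relation.Binary.Sublist.Propositional using (_⊆_; []; _∷_; _∷ʳ_)
open import Data.List.Relation.Unary.All as All using ([]; _∷_)
open import Data.List.Relation.Unary.AllPairs using (AllPairs; []; _∷_)
import Data.List.Relation.Unary.AllPairs.Properties as AllPairsₚ
open import Data.List.Relation.Unary.Any using (here; there)
open import Data.List.Relation.Unary.Unique.Propositional using (Unique)
import Data.List.Relation.Unary.Unique.Propositional.Properties as Uniqueₚ
open import Data.Nat as ℕ using (ℕ; zero; suc; z≤n; s≤s)
open import Data.Nat.DivMod using (m≡m%n+[m/n]*n; m%n<n; m/n*n≤m)
import Data.Nat.Properties as ℕₚ
open import Data.Nat.Tactic.RingSolver using () renaming (solve-∀ to ℕ-solve-∀)
open import Data.Product using (Σ; _×_; _,_; proj₁; proj₂)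
open import Data.Rational as ℚ
  using (ℚ; 0ℚ; 1ℚ; _+_; _*_; _-_; -_; _/_; _≤_; _<_; ∣_∣; NonNegative; positive; nonNegative)
import Data.Rational.Properties as ℚₚ
open import Data.Rational.Properties
  using (≤-refl; ≤-trans; ≤-reflexive; <⇒≤; <-≤-trans; +-mono-≤; +-monoˡ-≤; +-monoʳ-≤; +-comm; +-identityˡ; +-identityʳ;
    *-comm; *-assoc; *-identityˡ; *-identityʳ; *-zeroˡ; *-zeroʳ; neg-antimono-≤; 0≤∣p∣; 0≤p⇒∣p∣≡p; ∣p*q∣≡∣p∣*∣q∣)
import Data.Rational.Unnormalised as ℚᵘ
import Data.Rational.Unnormalised.Properties as ℚᵘₚ
open import Data.Sum using (_⊎_; inj₁; inj₂)
open import Defs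
open import Relation.Binary.PropositionalEquality
  using (_≡_; _≢_; refl; sym; trans; cong; cong₂; subst; subst₂)
open import Relation.Nullary using (yes; no)
open import Relation.Nullary.Decidable using (⌊_⌋; dec⇒maybe; from-yes)
open import Tactic.RingSolver using (solve-∀)
open import Tactic.RingSolver.Core.AlmostCommutativeRing using (AlmostCommutativeRing; fromCommutativeRing)

-- The exponent comes from comparing mean and noise. With l = k - 3 and edge density p, the average
-- degree is about n^(l+1) p^(r-1). A step changes a surviving degree by at most a constant times
-- n^l, and over the whole process a degree falls by at most n^(l+1), so the accumulated random
-- error has variance about n^(2l+1). The mean exceeds the standard deviation while p^(r-1) >
-- n^(-1/2), that is p > n^(-1/D), since D = k(k-1) - 2 = 2(r-1). No self-correction is exploited:
-- the neighbours may use up the whole contraction. Also η is a constant instead of tending to 0,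
-- and this costs the 1/q in the exponent r - 1 + 1/q of the average degree. The order q = 2b is
-- dictated by the slack n^(a/b). In the event raised to the power Db it becomes n^(aD), while
-- summing over all edges and normalising costs n^6 whatever b is. As D ≥ 8, a further power of n is
-- left for the constants. No separate concentration inequality is involved: the failure probability
-- is bounded by one induction along the process, which amounts to Markov's inequality for the
-- stopped Ψ.

ℚ-ring : AlmostCommutativeRing _ _
ℚ-ring = fromCommutativeRing ℚₚ.+-*-commutativeRing (λ x → dec⇒maybe (0ℚ ℚₚ.≟ x))

-- Ordered arithmetic, powers and the embedding of the naturals

2ℚ : ℚ
2ℚ = + 2 / 1

0≤1 : 0ℚ ≤ 1ℚ
0≤1 = from-yes (0ℚ ℚₚ.≤? 1ℚ)

≤-by : ∀ {p q} t → 0ℚ ≤ t → p + t ≡ q → p ≤ q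
≤-by {p} t 0≤t eq = ≤-trans (≤-reflexive (sym (+-identityʳ p)))
  (≤-trans (+-monoʳ-≤ p 0≤t) (≤-reflexive eq))

0≤+ : ∀ {p q} → 0ℚ ≤ p → 0ℚ ≤ q → 0ℚ ≤ p + q
0≤+ 0≤p 0≤q = ≤-trans (≤-reflexive (sym (+-identityˡ 0ℚ))) (+-mono-≤ 0≤p 0≤q)

*-monoˡ : ∀ {p q r} → 0ℚ ≤ r → p ≤ q → r * p ≤ r * q
*-monoˡ {r = r} 0≤r = ℚₚ.*-monoˡ-≤-nonNeg r {{nonNegative 0≤r}}

*-monoʳ : ∀ {p q r} → 0ℚ ≤ r → p ≤ q → p * r ≤ q * r
*-monoʳ {r = r} 0≤r = ℚₚ.*-monoʳ-≤-nonNeg r {{nonNegative 0≤r}}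

0≤* : ∀ {p q} → 0ℚ ≤ p → 0ℚ ≤ q → 0ℚ ≤ p * q
0≤* {p} 0≤p 0≤q = ≤-trans (≤-reflexive (sym (*-zeroʳ p))) (*-monoˡ 0≤p 0≤q)

0<* : ∀ {p q} → 0ℚ < p → 0ℚ < q → 0ℚ < p * q
0<* {p} {q} 0<p 0<q = ℚₚ.positive⁻¹ (p * q) {{ℚₚ.pos*pos⇒pos p {{positive 0<p}} q {{positive 0<q}}}}

*-mono : ∀ {p q r s} → 0ℚ ≤ r → 0ℚ ≤ q → p ≤ q → r ≤ s → p * r ≤ q * s
*-mono 0≤r 0≤q p≤q r≤s = ≤-trans (*-monoʳ 0≤r p≤q) (*-monoˡ 0≤q r≤s)

p≤q⇒0≤q-p : ∀ {p q} → p ≤ q → 0ℚ ≤ q - p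
p≤q⇒0≤q-p {p} p≤q = ≤-trans (≤-reflexive (sym (ℚₚ.+-inverseʳ p))) (+-monoˡ-≤ (- p) p≤q)

0≤q-p⇒p≤q : ∀ {p q} → 0ℚ ≤ q - p → p ≤ q
0≤q-p⇒p≤q {p} {q} 0≤ = ≤-by (q - p) 0≤ (lem p q)
  where
  lem : ∀ p q → p + (q - p) ≡ q
  lem = solve-∀ ℚ-ring

1-p≤1 : ∀ {p} → 0ℚ ≤ p → 1ℚ - p ≤ 1ℚ
1-p≤1 {p} 0≤p = ≤-by p 0≤p (lem p)
  where
  lem : ∀ p → 1ℚ - p + p ≡ 1ℚ
  lem = solve-∀ ℚ-ring

*-cancelˡ : ∀ {p q r} → 0ℚ < r → r * p ≤ r * q → p ≤ q
*-cancelˡ {r = r} 0<r = ℚₚ.*-cancelˡ-≤-pos r {{positive 0<r}}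

0≤x*x : ∀ x → 0ℚ ≤ x * x
0≤x*x x with ℚₚ.≤-total 0ℚ x
... | inj₁ 0≤x = 0≤* 0≤x 0≤x
... | inj₂ x≤0 = ≤-trans (0≤* 0≤-x 0≤-x) (≤-reflexive (lem x))
  where
  0≤-x : 0ℚ ≤ - x
  0≤-x = neg-antimono-≤ x≤0
  lem : ∀ x → (- x) * (- x) ≡ x * x
  lem = solve-∀ ℚ-ring

x*x≤y*y⇒x≤y : ∀ {x y} → 0ℚ ≤ y → x * x ≤ y * y → x ≤ y
x*x≤y*y⇒x≤y {x} {y} 0≤y le with ℚₚ.≤-total x y
... | inj₁ x≤y = x≤y
... | inj₂ y≤x with ℚₚ._≤?_ x y
...   | yes x≤y = x≤y
...   | no x≰y = ⊥-elim (ℚₚ.<-irrefl refl (<-≤-trans y²<x² le))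
  where
  y<x : y < x
  y<x = ℚₚ.≰⇒> x≰y
  0<x : 0ℚ < x
  0<x = ℚₚ.≤-<-trans 0≤y y<x
  y²<x² : y * y < x * x
  y²<x² = ℚₚ.≤-<-trans (*-monoˡ 0≤y y≤x) (ℚₚ.*-monoˡ-<-pos x {{positive 0<x}} y<x)

p≤∣p∣ : ∀ p → p ≤ ∣ p ∣
p≤∣p∣ p with ℚₚ.≤-total 0ℚ p
... | inj₁ 0≤p = ≤-reflexive (sym (0≤p⇒∣p∣≡p 0≤p))
... | inj₂ p≤0 = ≤-trans p≤0 (0≤∣p∣ p)

∣p∣≤ : ∀ {p q} → p ≤ q → - p ≤ q → ∣ p ∣ ≤ q
∣p∣≤ {p} p≤q -p≤q with ℚₚ.∣p∣≡p∨∣p∣≡-p p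
... | inj₁ eq = ≤-trans (≤-reflexive eq) p≤q
... | inj₂ eq = ≤-trans (≤-reflexive eq) -p≤q

∣p∣*∣p∣≡p*p : ∀ p → ∣ p ∣ * ∣ p ∣ ≡ p * p
∣p∣*∣p∣≡p*p p with ℚₚ.∣p∣≡p∨∣p∣≡-p p
... | inj₁ eq = cong₂ _*_ eq eq
... | inj₂ eq = trans (cong₂ _*_ eq eq) (lem p)
  where
  lem : ∀ x → (- x) * (- x) ≡ x * x
  lem = solve-∀ ℚ-ring

infixr 8 _^_

_^_ : ℚ → ℕ → ℚ
x ^ zero  = 1ℚ
x ^ suc n = x * x ^ n

0≤^ : ∀ {x} n → 0ℚ ≤ x → 0ℚ ≤ x ^ n
0≤^ zero    0≤x = 0≤1
0≤^ (suc n) 0≤x = 0≤* 0≤x (0≤^ n 0≤x)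

0<^ : ∀ {x} n → 0ℚ < x → 0ℚ < x ^ n
0<^ zero    0<x = ℚₚ.positive⁻¹ 1ℚ
0<^ (suc n) 0<x = 0<* 0<x (0<^ n 0<x)

^-mono : ∀ {x y} n → 0ℚ ≤ x → x ≤ y → x ^ n ≤ y ^ n
^-mono zero    0≤x x≤y = ≤-refl
^-mono (suc n) 0≤x x≤y = *-mono (0≤^ n 0≤x) (≤-trans 0≤x x≤y) x≤y (^-mono n 0≤x x≤y)

^-+ : ∀ x m n → x ^ (m ℕ.+ n) ≡ x ^ m * x ^ n
^-+ x zero    n = sym (*-identityˡ (x ^ n))
^-+ x (suc m) n = trans (cong (x *_) (^-+ x m n)) (sym (*-assoc x (x ^ m) (x ^ n)))

^-*-distrib : ∀ x y n → (x * y) ^ n ≡ x ^ n * y ^ n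
^-*-distrib x y zero    = refl
^-*-distrib x y (suc n) = trans (cong (x * y *_) (^-*-distrib x y n)) (lem x y (x ^ n) (y ^ n))
  where
  lem : ∀ a b c d → a * b * (c * d) ≡ a * c * (b * d)
  lem = solve-∀ ℚ-ring

1^ : ∀ n → 1ℚ ^ n ≡ 1ℚ
1^ zero    = refl
1^ (suc n) = trans (*-identityˡ (1ℚ ^ n)) (1^ n)

^-assoc : ∀ x m n → (x ^ m) ^ n ≡ x ^ (m ℕ.* n)
^-assoc x zero    n = 1^ n
^-assoc x (suc m) n = trans (^-*-distrib x (x ^ m) n)
  (trans (cong (x ^ n *_) (^-assoc x m n)) (sym (^-+ x n (m ℕ.* n))))

^-double : ∀ x j → x ^ (j ℕ.+ j) ≡ (x * x) ^ j
^-double x j = trans (^-+ x j j) (sym (^-*-distrib x x j))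

∣^∣ : ∀ x n → ∣ x ^ n ∣ ≡ ∣ x ∣ ^ n
∣^∣ x zero    = refl
∣^∣ x (suc n) = trans (∣p*q∣≡∣p∣*∣q∣ x (x ^ n)) (cong (∣ x ∣ *_) (∣^∣ x n))

-- Defined by recursion, so that `ι (suc n)` is `1ℚ + ι n` by computation and the ring solver can
-- treat `ι n` as an atom.
ι : ℕ → ℚ
ι zero    = 0ℚ
ι (suc n) = 1ℚ + ι n

ι-+ : ∀ m n → ι (m ℕ.+ n) ≡ ι m + ι n
ι-+ zero    n = sym (+-identityˡ (ι n))
ι-+ (suc m) n = trans (cong (λ z → 1ℚ + z) (ι-+ m n)) (sym (ℚₚ.+-assoc 1ℚ (ι m) (ι n)))

ι-* : ∀ m n → ι (m ℕ.* n) ≡ ι m * ι n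
ι-* zero    n = sym (*-zeroˡ (ι n))
ι-* (suc m) n = trans (ι-+ n (m ℕ.* n)) (trans (cong (λ z → ι n + z) (ι-* m n)) (lem (ι m) (ι n)))
  where
  lem : ∀ a b → b + a * b ≡ (1ℚ + a) * b
  lem = solve-∀ ℚ-ring

ι-^ : ∀ m n → ι (m ℕ.^ n) ≡ ι m ^ n
ι-^ m zero    = +-identityʳ 1ℚ
ι-^ m (suc n) = trans (ι-* m (m ℕ.^ n)) (cong (ι m *_) (ι-^ m n))

0≤ι : ∀ n → 0ℚ ≤ ι n
0≤ι zero    = ≤-refl
0≤ι (suc n) = 0≤+ 0≤1 (0≤ι n)

ι-mono : ∀ {m n} → m ℕ.≤ n → ι m ≤ ι n
ι-mono {n = n} z≤n = 0≤ι n
ι-mono (s≤s m≤n)   = +-monoʳ-≤ 1ℚ (ι-mono m≤n)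

0<ι : ∀ {m} → 0 ℕ.< m → 0ℚ < ι m
0<ι 0<m = <-≤-trans (ℚₚ.positive⁻¹ 1ℚ) (≤-trans (≤-reflexive (sym (+-identityʳ 1ℚ))) (ι-mono 0<m))

ι≡/1 : ∀ n → ι n ≡ + n / 1
ι≡/1 zero    = refl
ι≡/1 (suc n) = trans (cong (λ z → 1ℚ + z) (ι≡/1 n)) (ℚₚ.toℚᵘ-injective
  (ℚᵘₚ.≃-trans (ℚₚ.toℚᵘ-homo-+ 1ℚ (+ n / 1))
  (ℚᵘₚ.≃-trans (ℚᵘₚ.+-congʳ (ℚ.toℚᵘ 1ℚ) (ℚₚ.toℚᵘ-fromℚᵘ (ℚᵘ.mkℚᵘ (+ n) 0)))
  (ℚᵘₚ.≃-trans (ℚᵘ.*≡* (lem (+ n))) (ℚᵘₚ.≃-sym (ℚₚ.toℚᵘ-fromℚᵘ (ℚᵘ.mkℚᵘ (+ suc n) 0)))))))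
  where
  lem : ∀ z → (+ 1 ℤ.* + 1 ℤ.+ z ℤ.* + 1) ℤ.* + 1 ≡ (+ 1 ℤ.+ z) ℤ.* (+ 1 ℤ.* + 1)
  lem = ℤ-solve-∀

ι[1+n]*1/[1+n]≡1 : ∀ n → ι (suc n) * (+ 1 / suc n) ≡ 1ℚ
ι[1+n]*1/[1+n]≡1 n = trans (cong (_* (+ 1 / suc n)) (ι≡/1 (suc n))) (ℚₚ.toℚᵘ-injective
  (ℚᵘₚ.≃-trans (ℚₚ.toℚᵘ-homo-* (+ suc n / 1) (+ 1 / suc n))
  (ℚᵘₚ.≃-trans (ℚᵘₚ.*-cong (ℚₚ.toℚᵘ-fromℚᵘ (ℚᵘ.mkℚᵘ (+ suc n) 0))
                           (ℚₚ.toℚᵘ-fromℚᵘ (ℚᵘ.mkℚᵘ (+ 1) n)))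
  (ℚᵘ.*≡* (lem (+ suc n))))))
  where
  lem : ∀ z → z ℤ.* + 1 ℤ.* + 1 ≡ + 1 ℤ.* (+ 1 ℤ.* z)
  lem = ℤ-solve-∀

-- Total, so that an average degree can be formed for every graph; the default at zero gives an
-- edgeless graph the average degree 0.
1/ι : ℕ → ℚ
1/ι zero    = 0ℚ
1/ι (suc n) = + 1 / suc n

ι*1/ι≡1 : ∀ {n} → 0 ℕ.< n → ι n * 1/ι n ≡ 1ℚ
ι*1/ι≡1 {suc n} _ = ι[1+n]*1/[1+n]≡1 n

0≤1/ι : ∀ n → 0ℚ ≤ 1/ι n
0≤1/ι zero    = ≤-refl
0≤1/ι (suc n) = ℚₚ.nonNegative⁻¹ (+ 1 / suc n) {{ℚₚ.normalize-nonNeg 1 (suc n)}}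

0<1/ι : ∀ {n} → 0 ℕ.< n → 0ℚ < 1/ι n
0<1/ι {suc n} _ = ℚₚ.positive⁻¹ (+ 1 / suc n) {{ℚₚ.normalize-pos 1 (suc n)}}

-- Finite sums

∑ : {A : Set} → List A → (A → ℚ) → ℚ
∑ xs f = sumℚ (map f xs)

module _ {A : Set} where

  ∑-cong : ∀ (xs : List A) {f g} → (∀ {x} → x ∈ xs → f x ≡ g x) → ∑ xs f ≡ ∑ xs g
  ∑-cong []       f≡g = refl
  ∑-cong (x ∷ xs) f≡g = cong₂ _+_ (f≡g (here refl)) (∑-cong xs (λ x∈ → f≡g (there x∈)))

  ∑-mono : ∀ (xs : List A) {f g} → (∀ {x} → x ∈ xs → f x ≤ g x) → ∑ xs f ≤ ∑ xs g
  ∑-mono []       f≤g = ≤-refl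
  ∑-mono (x ∷ xs) f≤g = +-mono-≤ (f≤g (here refl)) (∑-mono xs (λ x∈ → f≤g (there x∈)))

  ∑-0 : ∀ (xs : List A) → ∑ xs (λ _ → 0ℚ) ≡ 0ℚ
  ∑-0 []       = refl
  ∑-0 (x ∷ xs) = trans (+-identityˡ _) (∑-0 xs)

  0≤∑ : ∀ (xs : List A) {f} → (∀ {x} → x ∈ xs → 0ℚ ≤ f x) → 0ℚ ≤ ∑ xs f
  0≤∑ xs 0≤f = ≤-trans (≤-reflexive (sym (∑-0 xs))) (∑-mono xs 0≤f)

  ∑-+ : ∀ (xs : List A) f g → ∑ xs (λ x → f x + g x) ≡ ∑ xs f + ∑ xs g
  ∑-+ []       f g = refl
  ∑-+ (x ∷ xs) f g = trans (cong (λ z → f x + g x + z) (∑-+ xs f g)) (lem (f x) (g x) (∑ xs f) (∑ xs g))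
    where
    lem : ∀ a b c d → a + b + (c + d) ≡ a + c + (b + d)
    lem = solve-∀ ℚ-ring

  ∑-*ˡ : ∀ (xs : List A) c f → ∑ xs (λ x → c * f x) ≡ c * ∑ xs f
  ∑-*ˡ []       c f = sym (*-zeroʳ c)
  ∑-*ˡ (x ∷ xs) c f = trans (cong (λ z → c * f x + z) (∑-*ˡ xs c f)) (sym (ℚₚ.*-distribˡ-+ c (f x) (∑ xs f)))

  ∑-*ʳ : ∀ (xs : List A) c f → ∑ xs (λ x → f x * c) ≡ ∑ xs f * c
  ∑-*ʳ xs c f = trans (∑-cong xs (λ {x} _ → *-comm (f x) c)) (trans (∑-*ˡ xs c f) (*-comm c (∑ xs f)))

  ∑-neg : ∀ (xs : List A) f → ∑ xs (λ x → - f x) ≡ - ∑ xs f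
  ∑-neg []       f = refl
  ∑-neg (x ∷ xs) f = trans (cong (λ z → - f x + z) (∑-neg xs f)) (sym (ℚₚ.neg-distrib-+ (f x) (∑ xs f)))

  ∑-- : ∀ (xs : List A) f g → ∑ xs (λ x → f x - g x) ≡ ∑ xs f - ∑ xs g
  ∑-- xs f g = trans (∑-+ xs f (λ x → - g x)) (cong (λ z → ∑ xs f + z) (∑-neg xs g))

  ∑-const : ∀ (xs : List A) c → ∑ xs (λ _ → c) ≡ ι (length xs) * c
  ∑-const []       c = sym (*-zeroˡ c)
  ∑-const (x ∷ xs) c = trans (cong (λ z → c + z) (∑-const xs c)) (lem c (ι (length xs)))
    where
    lem : ∀ a b → a + b * a ≡ (1ℚ + b) * a
    lem = solve-∀ ℚ-ring

  ∑-single-≤ : ∀ (xs : List A) {f y} → (∀ {x} → x ∈ xs → 0ℚ ≤ f x) → y ∈ xs → f y ≤ ∑ xs f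
  ∑-single-≤ (x ∷ xs) {f} 0≤f (here refl) = ≤-by (∑ xs f) (0≤∑ xs (λ x∈ → 0≤f (there x∈))) refl
  ∑-single-≤ (x ∷ xs) {f} {y} 0≤f (there y∈) = ≤-trans (∑-single-≤ xs (λ x∈ → 0≤f (there x∈)) y∈)
    (≤-by (f x) (0≤f (here refl)) (+-comm (∑ xs f) (f x)))

  ∣∑∣≤ : ∀ (xs : List A) f → ∣ ∑ xs f ∣ ≤ ∑ xs (λ x → ∣ f x ∣)
  ∣∑∣≤ []       f = ≤-refl
  ∣∑∣≤ (x ∷ xs) f = ≤-trans (ℚₚ.∣p+q∣≤∣p∣+∣q∣ (f x) (∑ xs f)) (+-monoʳ-≤ ∣ f x ∣ (∣∑∣≤ xs f))

∑-swap : ∀ {A B : Set} (xs : List A) (ys : List B) (f : A → B → ℚ) →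
  ∑ xs (λ x → ∑ ys (f x)) ≡ ∑ ys (λ y → ∑ xs (λ x → f x y))
∑-swap []       ys f = sym (∑-0 ys)
∑-swap (x ∷ xs) ys f = trans (cong (λ z → ∑ ys (f x) + z) (∑-swap xs ys f))
  (sym (∑-+ ys (f x) (λ y → ∑ xs (λ x → f x y))))

∑-*-∑ : ∀ {A B : Set} (xs : List A) (ys : List B) f g →
  ∑ xs f * ∑ ys g ≡ ∑ xs (λ x → ∑ ys (λ y → f x * g y))
∑-*-∑ xs ys f g = trans (sym (∑-*ʳ xs (∑ ys g) f)) (∑-cong xs (λ {x} _ → sym (∑-*ˡ ys (f x) g)))

[_] : Bool → ℚ
[ true  ] = 1ℚ
[ false ] = 0ℚ

0≤[] : ∀ b → 0ℚ ≤ [ b ]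
0≤[] true  = 0≤1
0≤[] false = ≤-refl

[]≤1 : ∀ b → [ b ] ≤ 1ℚ
[]≤1 true  = ≤-refl
[]≤1 false = 0≤1

[]*[]≡[] : ∀ b → [ b ] * [ b ] ≡ [ b ]
[]*[]≡[] true  = refl
[]*[]≡[] false = refl

[not] : ∀ b → [ not b ] ≡ 1ℚ - [ b ]
[not] true  = refl
[not] false = refl

∑-filterᵇ : ∀ {A : Set} (p : A → Bool) xs f → ∑ (filterᵇ p xs) f ≡ ∑ xs (λ x → [ p x ] * f x)
∑-filterᵇ p []       f = refl
∑-filterᵇ p (x ∷ xs) f with p x
... | true  = cong₂ _+_ (sym (*-identityˡ (f x))) (∑-filterᵇ p xs f)
... | false = trans (∑-filterᵇ p xs f)
  (trans (sym (+-identityˡ _)) (cong (λ z → z + ∑ xs (λ x → [ p x ] * f x)) (sym (*-zeroˡ (f x)))))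

∑-1 : ∀ {A : Set} (xs : List A) → ∑ xs (λ _ → 1ℚ) ≡ ι (length xs)
∑-1 xs = trans (∑-const xs 1ℚ) (*-identityʳ (ι (length xs)))

ι-length-filterᵇ : ∀ {A : Set} (p : A → Bool) xs → ι (length (filterᵇ p xs)) ≡ ∑ xs (λ x → [ p x ])
ι-length-filterᵇ p xs = trans (sym (∑-1 (filterᵇ p xs)))
  (trans (∑-filterᵇ p xs (λ _ → 1ℚ)) (∑-cong xs (λ {x} _ → *-identityʳ [ p x ])))

-- Power inequalities and absorption of noise

0≤lit : ∀ p → {{NonNegative p}} → 0ℚ ≤ p
0≤lit p = ℚₚ.nonNegative⁻¹ p

-- Passing from the exponent N to N + 1 multiplies the remainder by `x + ξ` and adds N x^(N-1) ξ².
-- The coefficient N² survives this recursion because N² + N ≤ (N + 1)².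
taylor-∣∣ : ∀ n x ξ →
  ∣ (x + ξ) ^ (2 ℕ.+ n) - x ^ (2 ℕ.+ n) - ι (2 ℕ.+ n) * x ^ (1 ℕ.+ n) * ξ ∣
    ≤ ι (2 ℕ.+ n) * ι (2 ℕ.+ n) * (ξ * ξ) * (∣ x ∣ + ∣ ξ ∣) ^ n
taylor-∣∣ zero x ξ = ≤-trans (≤-reflexive (trans (cong ∣_∣ (lem x ξ)) (0≤p⇒∣p∣≡p (0≤x*x ξ))))
  (≤-by ((+ 3 / 1) * (ξ * ξ)) (0≤* (0≤lit (+ 3 / 1)) (0≤x*x ξ)) (lem′ ξ))
  where
  lem : ∀ x ξ → (x + ξ) * ((x + ξ) * 1ℚ) - x * (x * 1ℚ) - (1ℚ + (1ℚ + 0ℚ)) * (x * 1ℚ) * ξ ≡ ξ * ξ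
  lem = solve-∀ ℚ-ring
  lem′ : ∀ ξ → ξ * ξ + (+ 3 / 1) * (ξ * ξ) ≡ (1ℚ + (1ℚ + 0ℚ)) * (1ℚ + (1ℚ + 0ℚ)) * (ξ * ξ) * 1ℚ
  lem′ = solve-∀ ℚ-ring
taylor-∣∣ (suc n) x ξ = ≤-trans (≤-reflexive (cong ∣_∣ (step (x + ξ) x ξ P x₁ N refl)))
  (≤-trans (ℚₚ.∣p+q∣≤∣p∣+∣q∣ ((x + ξ) * R) (N * x₁ * (ξ * ξ)))
  (≤-trans (+-mono-≤ first second)
    (≤-by ((1ℚ + N) * ((ξ * ξ) * (w * w ^ n))) (0≤* (0≤ι (3 ℕ.+ n)) (0≤* (0≤x*x ξ) (0≤^ (suc n) 0≤w)))
      (fin w (ξ * ξ) N (w ^ n)))))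
  where
  N = ι (2 ℕ.+ n)
  P = (x + ξ) ^ (2 ℕ.+ n)
  x₁ = x ^ (1 ℕ.+ n)
  w = ∣ x ∣ + ∣ ξ ∣
  R = P - x * x₁ - N * x₁ * ξ
  0≤w : 0ℚ ≤ w
  0≤w = 0≤+ (0≤∣p∣ x) (0≤∣p∣ ξ)
  step : ∀ s x ξ P x₁ N → s ≡ x + ξ →
    s * P - x * (x * x₁) - (1ℚ + N) * (x * x₁) * ξ ≡ s * (P - x * x₁ - N * x₁ * ξ) + N * x₁ * (ξ * ξ)
  step s x ξ P x₁ N refl = lem x ξ P x₁ N
    where
    lem : ∀ x ξ P x₁ N → (x + ξ) * P - x * (x * x₁) - (1ℚ + N) * (x * x₁) * ξ
      ≡ (x + ξ) * (P - x * x₁ - N * x₁ * ξ) + N * x₁ * (ξ * ξ)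
    lem = solve-∀ ℚ-ring
  first : ∣ (x + ξ) * R ∣ ≤ w * (N * N * (ξ * ξ) * w ^ n)
  first = ≤-trans (≤-reflexive (∣p*q∣≡∣p∣*∣q∣ (x + ξ) R))
    (*-mono (0≤∣p∣ R) 0≤w (ℚₚ.∣p+q∣≤∣p∣+∣q∣ x ξ) (taylor-∣∣ n x ξ))
  0≤Nξ² : 0ℚ ≤ N * (ξ * ξ)
  0≤Nξ² = 0≤* (0≤ι (2 ℕ.+ n)) (0≤x*x ξ)
  second : ∣ N * x₁ * (ξ * ξ) ∣ ≤ N * (ξ * ξ) * (w * w ^ n)
  second = ≤-trans (≤-reflexive (trans (cong ∣_∣ (lem N x₁ (ξ * ξ)))
      (trans (∣p*q∣≡∣p∣*∣q∣ (N * (ξ * ξ)) x₁)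
        (cong₂ _*_ (0≤p⇒∣p∣≡p 0≤Nξ²) (∣^∣ x (1 ℕ.+ n))))))
    (*-monoˡ 0≤Nξ² (^-mono (suc n) (0≤∣p∣ x) (≤-by ∣ ξ ∣ (0≤∣p∣ ξ) refl)))
    where
    lem : ∀ N x₁ ξ² → N * x₁ * ξ² ≡ N * ξ² * x₁
    lem = solve-∀ ℚ-ring
  fin : ∀ w ξ² N wⁿ → w * (N * N * ξ² * wⁿ) + N * ξ² * (w * wⁿ) + (1ℚ + N) * (ξ² * (w * wⁿ))
    ≡ (1ℚ + N) * (1ℚ + N) * ξ² * (w * wⁿ)
  fin = solve-∀ ℚ-ring

-- The factor `ξ * ξ` is not replaced by `c`: later one copy of `ξ` is bounded by its maximum and
-- the other is summed over all hyperedges.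
taylor : ∀ n x ξ {c} → ∣ ξ ∣ ≤ c →
  (x + ξ) ^ (2 ℕ.+ n) ≤ x ^ (2 ℕ.+ n) + ι (2 ℕ.+ n) * x ^ (1 ℕ.+ n) * ξ
    + ι (2 ℕ.+ n) * ι (2 ℕ.+ n) * (ξ * ξ) * (∣ x ∣ + c) ^ n
taylor n x ξ {c} ∣ξ∣≤c = ≤-trans (≤-reflexive (split P X Y))
  (+-monoʳ-≤ (X + Y) (≤-trans (p≤∣p∣ (P - X - Y)) (≤-trans (taylor-∣∣ n x ξ)
    (*-monoˡ (0≤* (0≤* 0≤N 0≤N) (0≤x*x ξ))
      (^-mono n (0≤+ (0≤∣p∣ x) (0≤∣p∣ ξ)) (+-monoʳ-≤ ∣ x ∣ ∣ξ∣≤c))))))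
  where
  0≤N = 0≤ι (2 ℕ.+ n)
  P = (x + ξ) ^ (2 ℕ.+ n)
  X = x ^ (2 ℕ.+ n)
  Y = ι (2 ℕ.+ n) * x ^ (1 ℕ.+ n) * ξ
  split : ∀ P X Y → P ≡ X + Y + (P - X - Y)
  split = solve-∀ ℚ-ring

0≤2*p⇒0≤p : ∀ {p} → 0ℚ ≤ 2ℚ * p → 0ℚ ≤ p
0≤2*p⇒0≤p {p} le = *-cancelˡ (ℚₚ.positive⁻¹ 2ℚ) le

[x-y]*[x^n-y^n]≥0 : ∀ {x y} n → 0ℚ ≤ x → 0ℚ ≤ y → 0ℚ ≤ (x - y) * (x ^ n - y ^ n)
[x-y]*[x^n-y^n]≥0 {x} {y} n 0≤x 0≤y with ℚₚ.≤-total x y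
... | inj₁ x≤y = ≤-trans (0≤* (p≤q⇒0≤q-p x≤y) (p≤q⇒0≤q-p (^-mono n 0≤x x≤y)))
  (≤-reflexive (lem x y (x ^ n) (y ^ n)))
  where
  lem : ∀ x y a b → (y - x) * (b - a) ≡ (x - y) * (a - b)
  lem = solve-∀ ℚ-ring
... | inj₂ y≤x = 0≤* (p≤q⇒0≤q-p y≤x) (p≤q⇒0≤q-p (^-mono n 0≤y y≤x))

-- Monotonicity of the odd power x ↦ x (x²)^j, applied to x and −z.
odd-power-sum : ∀ j x z → 0ℚ ≤ (x * (x * x) ^ j + z * (z * z) ^ j) * (x + z)
odd-power-sum j x z = 0≤2*p⇒0≤p (≤-trans
  (0≤+ (0≤* (0≤+ (0≤^ j (0≤x*x x)) (0≤^ j (0≤x*x z))) (0≤x*x (x + z)))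
       ([x-y]*[x^n-y^n]≥0 j (0≤x*x x) (0≤x*x z)))
  (≤-reflexive (lem x z ((x * x) ^ j) ((z * z) ^ j))))
  where
  lem : ∀ x z s t → (s + t) * ((x + z) * (x + z)) + (x * x - z * z) * (s - t) ≡ 2ℚ * ((x * s + z * t) * (x + z))
  lem = solve-∀ ℚ-ring

-- With s and t the j-th powers of the two squares, twice the product splits into (s + t)(x - z)²
-- and (x² - z²)(s - t). This avoids a case distinction on the signs of `x` and `z`.
odd-power-difference : ∀ j x z → 0ℚ ≤ (x * (x * x) ^ j - z * (z * z) ^ j) * (x - z)
odd-power-difference j x z = 0≤2*p⇒0≤p (≤-trans
  (0≤+ (0≤* (0≤+ (0≤^ j (0≤x*x x)) (0≤^ j (0≤x*x z))) (0≤x*x (x - z)))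
       ([x-y]*[x^n-y^n]≥0 j (0≤x*x x) (0≤x*x z)))
  (≤-reflexive (lem x z ((x * x) ^ j) ((z * z) ^ j))))
  where
  lem : ∀ x z s t → (s + t) * ((x - z) * (x - z)) + (x * x - z * z) * (s - t) ≡ 2ℚ * ((x * s - z * t) * (x - z))
  lem = solve-∀ ℚ-ring

bernoulli : ∀ n {t} → 0ℚ ≤ t → t ≤ 1ℚ → 1ℚ - ι n * t ≤ (1ℚ - t) ^ n
bernoulli zero    {t} 0≤t t≤1 = ≤-reflexive (lem t)
  where
  lem : ∀ t → 1ℚ - 0ℚ * t ≡ 1ℚ
  lem = solve-∀ ℚ-ring
bernoulli (suc n) {t} 0≤t t≤1 = ≤-trans
  (≤-by (ι n * (t * t)) (0≤* (0≤ι n) (0≤x*x t)) (lem (ι n) t))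
  (*-monoˡ (p≤q⇒0≤q-p t≤1) (bernoulli n 0≤t t≤1))
  where
  lem : ∀ n t → 1ℚ - (1ℚ + n) * t + n * (t * t) ≡ (1ℚ - t) * (1ℚ - n * t)
  lem = solve-∀ ℚ-ring

bernoulli-upper : ∀ n {z} → 0ℚ ≤ z → z ≤ 1ℚ → (1ℚ - z) ^ n ≤ 1ℚ - ι n * z + ι n * ι n * (z * z)
bernoulli-upper zero    {z} 0≤z z≤1 = ≤-reflexive (lem z)
  where
  lem : ∀ z → 1ℚ ≡ 1ℚ - 0ℚ * z + 0ℚ * 0ℚ * (z * z)
  lem = solve-∀ ℚ-ring
bernoulli-upper (suc n) {z} 0≤z z≤1 = ≤-trans (*-monoˡ (p≤q⇒0≤q-p z≤1) (bernoulli-upper n 0≤z z≤1))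
  (≤-by ((1ℚ + ι n) * (z * z) + ι n * ι n * (z * z * z))
    (0≤+ (0≤* (0≤ι (suc n)) (0≤x*x z)) (0≤* (0≤* (0≤ι n) (0≤ι n)) (0≤* (0≤x*x z) 0≤z)))
    (lem (ι n) z))
  where
  lem : ∀ n z → (1ℚ - z) * (1ℚ - n * z + n * n * (z * z)) + ((1ℚ + n) * (z * z) + n * n * (z * z * z))
    ≡ 1ℚ - (1ℚ + n) * z + (1ℚ + n) * (1ℚ + n) * (z * z)
  lem = solve-∀ ℚ-ring

module _ (r q : ℕ) {z t η : ℚ} (0≤z : 0ℚ ≤ z) (z≤1 : z ≤ 1ℚ) (0≤t : 0ℚ ≤ t) (t≤1 : t ≤ 1ℚ)
         (qt≡z : ι q * t ≡ z) (small : ι q * (ι r * ι r * z + ι r * t + ι r * η) ≤ 1ℚ) where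

  private
    R = ι r
    0≤R = 0≤ι r

  -- To first order the product is 1 - R z - t, and the spare t pays for everything else: since z =
  -- q t, the hypothesis `small` says that t is at least z (R² z + R t + R η), which covers the
  -- deviation η and the second-order terms.
  [1-z]^r*[1-t]≤ : (1ℚ - z) ^ r * (1ℚ - t) ≤ 1ℚ - R * (1ℚ + η) * z
  [1-z]^r*[1-t]≤ = ≤-trans (*-monoʳ (p≤q⇒0≤q-p t≤1) (bernoulli-upper r 0≤z z≤1))
    (≤-trans (≤-by (R * R * (z * z) * t) (0≤* (0≤* (0≤* 0≤R 0≤R) (0≤x*x z)) 0≤t) refl)
    (≤-trans (≤-by (t - t * (ι q * (R * R * z + R * t + R * η)))
        (≤-trans (0≤* 0≤t (p≤q⇒0≤q-p small)) (≤-reflexive (lem₁ t (ι q * (R * R * z + R * t + R * η)))))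
        refl)
      (≤-reflexive (trans (cong (λ u → (1ℚ - R * z + R * R * (z * z)) * (1ℚ - t) + R * R * (z * z) * t
          + (t - u)) (trans (lem₂ t (ι q) R z η) (cong (_* (R * R * z + R * t + R * η)) qt≡z)))
        (lem₃ R z t η)))))
    where
    lem₁ : ∀ t u → t * (1ℚ - u) ≡ t - t * u
    lem₁ = solve-∀ ℚ-ring
    lem₂ : ∀ t q R z η → t * (q * (R * R * z + R * t + R * η)) ≡ q * t * (R * R * z + R * t + R * η)
    lem₂ = solve-∀ ℚ-ring
    lem₃ : ∀ R z t η → (1ℚ - R * z + R * R * (z * z)) * (1ℚ - t) + R * R * (z * z) * t
      + (t - z * (R * R * z + R * t + R * η)) ≡ 1ℚ - R * (1ℚ + η) * z
    lem₃ = solve-∀ ℚ-ring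

  -- Bernoulli turns the last factor 1 - z = 1 - q t into at most (1 - t)^q, after which the
  -- previous estimate is raised to the power q. This single extra factor is the origin of the `+ 1`
  -- in the exponent (r-1)q + 1.
  [1-z]^[rq+1]≤ : (1ℚ - z) ^ (r ℕ.* q) * (1ℚ - z) ≤ (1ℚ - R * (1ℚ + η) * z) ^ q
  [1-z]^[rq+1]≤ = ≤-trans (*-monoˡ (0≤^ (r ℕ.* q) 0≤1-z)
      (≤-trans (≤-reflexive (cong (λ u → 1ℚ - u) (sym qt≡z))) (bernoulli q 0≤t t≤1)))
    (≤-trans (≤-reflexive (trans (cong (_* (1ℚ - t) ^ q) (sym (^-assoc (1ℚ - z) r q)))
        (sym (^-*-distrib ((1ℚ - z) ^ r) (1ℚ - t) q))))
      (^-mono q (0≤* (0≤^ r 0≤1-z) (p≤q⇒0≤q-p t≤1)) [1-z]^r*[1-t]≤))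
    where
    0≤1-z = p≤q⇒0≤q-p z≤1

-- The scale is chosen so that y² ≥ scale · L M forces 4 K₁ L ≤ y, K₃ L ≤ y and 4 K₂ 4^j L M ≤ y²,
-- one summand for each. In the opposite case the primed scale times L M bounds each of y², L y and
-- (y + K₃ L)², which leads to the last constant.
noise-scale noise-scale′ noise-constant : ℕ → ℚ → ℚ → ℚ → ℚ
noise-scale j K₁ K₂ K₃ = (+ 16 / 1) * (K₁ * K₁) + K₃ * K₃ + (+ 4 / 1) * (K₂ * (+ 4 / 1) ^ j)
noise-scale′ j K₁ K₂ K₃ = 1ℚ + 2ℚ * noise-scale j K₁ K₂ K₃ + 2ℚ * (K₃ * K₃)
noise-constant j K₁ K₂ K₃ = (K₁ * noise-scale′ j K₁ K₂ K₃ + K₂) * noise-scale′ j K₁ K₂ K₃ ^ j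

module _ (j : ℕ) (K₁ K₂ K₃ : ℚ) (0≤K₁ : 0ℚ ≤ K₁) (0≤K₂ : 0ℚ ≤ K₂) (0≤K₃ : 0ℚ ≤ K₃) where

  private
    4ℚ = + 4 / 1
    0≤4 = 0≤lit 4ℚ
    ¼ = + 1 / 4
    C₁ = noise-scale j K₁ K₂ K₃
    C₅ = noise-scale′ j K₁ K₂ K₃
    t₁ = 0≤* (0≤lit (+ 16 / 1)) (0≤x*x K₁)
    t₂ = 0≤x*x K₃
    t₃ = 0≤* 0≤4 (0≤* 0≤K₂ (0≤^ j 0≤4))
    0≤C₁ : 0ℚ ≤ C₁
    0≤C₁ = 0≤+ (0≤+ t₁ t₂) t₃
    lem₁ : ∀ a b c → a + (b + c) ≡ a + b + c
    lem₁ = solve-∀ ℚ-ring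
    lem₂ : ∀ a b c → b + (a + c) ≡ a + b + c
    lem₂ = solve-∀ ℚ-ring
    lem₃ : ∀ a b c → c + (a + b) ≡ a + b + c
    lem₃ = solve-∀ ℚ-ring
    16K₁²≤C₁ : (+ 16 / 1) * (K₁ * K₁) ≤ C₁
    16K₁²≤C₁ = ≤-by _ (0≤+ t₂ t₃) (lem₁ ((+ 16 / 1) * (K₁ * K₁)) (K₃ * K₃) (4ℚ * (K₂ * 4ℚ ^ j)))
    K₃²≤C₁ : K₃ * K₃ ≤ C₁
    K₃²≤C₁ = ≤-by _ (0≤+ t₁ t₃) (lem₂ ((+ 16 / 1) * (K₁ * K₁)) (K₃ * K₃) (4ℚ * (K₂ * 4ℚ ^ j)))
    4K₂4ʲ≤C₁ : 4ℚ * (K₂ * 4ℚ ^ j) ≤ C₁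
    4K₂4ʲ≤C₁ = ≤-by _ (0≤+ t₁ t₂) (lem₃ ((+ 16 / 1) * (K₁ * K₁)) (K₃ * K₃) (4ℚ * (K₂ * 4ℚ ^ j)))
    lem₄ : ∀ C k → C + (1ℚ + C + 2ℚ * k) ≡ 1ℚ + 2ℚ * C + 2ℚ * k
    lem₄ = solve-∀ ℚ-ring
    C₁≤C₅ : C₁ ≤ C₅
    C₁≤C₅ = ≤-by (1ℚ + C₁ + 2ℚ * (K₃ * K₃)) (0≤+ (0≤+ 0≤1 0≤C₁) (0≤* (0≤lit 2ℚ) t₂)) (lem₄ C₁ (K₃ * K₃))
    0≤C₅ : 0ℚ ≤ C₅
    0≤C₅ = 0≤+ (0≤+ 0≤1 (0≤* (0≤lit 2ℚ) 0≤C₁)) (0≤* (0≤lit 2ℚ) t₂)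

  0≤noise-constant : 0ℚ ≤ noise-constant j K₁ K₂ K₃
  0≤noise-constant = 0≤* (0≤+ (0≤* 0≤K₁ 0≤C₅) 0≤K₂) (0≤^ j 0≤C₅)

  -- Either y² dominates LM, and both terms on the left are absorbed by y^(2j+2), or LM dominates y².
  noise-absorbed : ∀ {L M y} → 0ℚ ≤ L → L ≤ M → 0ℚ ≤ y →
    K₁ * (L * (y * (y * y) ^ j)) + K₂ * (L * M) * ((y + K₃ * L) * (y + K₃ * L)) ^ j
      ≤ ℚ.½ * (y * y * (y * y) ^ j) + noise-constant j K₁ K₂ K₃ * (L * M) ^ (1 ℕ.+ j)
  noise-absorbed {L} {M} {y} 0≤L L≤M 0≤y with ℚₚ.≤-total (C₁ * (L * M)) (y * y)
  ... | inj₁ large = ≤-trans (+-mono-≤ first second)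
        (≤-by (noise-constant j K₁ K₂ K₃ * B ^ (1 ℕ.+ j)) (0≤* 0≤noise-constant (0≤^ (1 ℕ.+ j) 0≤B))
          (cong (_+ noise-constant j K₁ K₂ K₃ * B ^ (1 ℕ.+ j)) (lem₅ (y * y * s))))
    where
    B = L * M
    s = (y * y) ^ j
    c = K₃ * L
    0≤s : 0ℚ ≤ s
    0≤s = 0≤^ j (0≤x*x y)
    0≤B : 0ℚ ≤ B
    0≤B = 0≤* 0≤L (≤-trans 0≤L L≤M)
    L²≤B : L * L ≤ B
    L²≤B = *-monoˡ 0≤L L≤M
    part : ∀ {p} → 0ℚ ≤ p → p ≤ C₁ → p * (L * L) ≤ C₁ * B
    part 0≤p p≤q = *-mono (0≤x*x L) 0≤C₁ p≤q L²≤B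
    4K₁L≤y : 4ℚ * K₁ * L ≤ y
    4K₁L≤y = x*x≤y*y⇒x≤y 0≤y (≤-trans (≤-reflexive (lem K₁ L))
      (≤-trans (part t₁ 16K₁²≤C₁) large))
      where
      lem : ∀ K L → 4ℚ * K * L * (4ℚ * K * L) ≡ (+ 16 / 1) * (K * K) * (L * L)
      lem = solve-∀ ℚ-ring
    c≤y : c ≤ y
    c≤y = x*x≤y*y⇒x≤y 0≤y (≤-trans (≤-reflexive (lem K₃ L))
      (≤-trans (part t₂ K₃²≤C₁) large))
      where
      lem : ∀ K L → K * L * (K * L) ≡ K * K * (L * L)
      lem = solve-∀ ℚ-ring
    first : K₁ * (L * (y * s)) ≤ ¼ * (y * y * s)
    first = ≤-trans (≤-reflexive (lem K₁ L y s))
      (≤-trans (*-monoˡ (0≤* (0≤lit ¼) (0≤* 0≤y 0≤s)) 4K₁L≤y) (≤-reflexive (lem′ y s)))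
      where
      lem : ∀ K L y s → K * (L * (y * s)) ≡ ¼ * (y * s) * (4ℚ * K * L)
      lem = solve-∀ ℚ-ring
      lem′ : ∀ y s → ¼ * (y * s) * y ≡ ¼ * (y * y * s)
      lem′ = solve-∀ ℚ-ring
    0≤c = 0≤* 0≤K₃ 0≤L
    square : (y + c) * (y + c) ≤ 4ℚ * (y * y)
    square = ≤-trans (*-mono (0≤+ 0≤y 0≤c) (0≤+ 0≤y 0≤y) y+c≤ y+c≤) (≤-reflexive (lem y))
      where
      y+c≤ = +-monoʳ-≤ y c≤y
      lem : ∀ y → (y + y) * (y + y) ≡ 4ℚ * (y * y)
      lem = solve-∀ ℚ-ring
    second : K₂ * B * ((y + c) * (y + c)) ^ j ≤ ¼ * (y * y * s)
    second = ≤-trans (*-monoˡ (0≤* 0≤K₂ 0≤B) (≤-trans (^-mono j (0≤x*x (y + c)) square)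
        (≤-reflexive (^-*-distrib 4ℚ (y * y) j))))
      (≤-trans (≤-reflexive (lem K₂ B (4ℚ ^ j) s))
      (≤-trans (*-monoˡ (0≤* (0≤lit ¼) 0≤s) (≤-trans (*-monoʳ 0≤B 4K₂4ʲ≤C₁) large))
        (≤-reflexive (lem′ (y * y) s))))
      where
      lem : ∀ K B f s → K * B * (f * s) ≡ ¼ * s * (4ℚ * (K * f) * B)
      lem = solve-∀ ℚ-ring
      lem′ : ∀ y s → ¼ * s * y ≡ ¼ * (y * s)
      lem′ = solve-∀ ℚ-ring
    lem₅ : ∀ u → ¼ * u + ¼ * u ≡ ℚ.½ * u
    lem₅ = solve-∀ ℚ-ring
  ... | inj₂ small = ≤-trans (+-mono-≤ first second)
        (≤-by (ℚ.½ * (y * y * s)) (0≤* (0≤lit ℚ.½) (0≤* (0≤x*x y) 0≤s))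
          (lem₅ K₁ K₂ C₅ (C₅ ^ j) B (B ^ j) (ℚ.½ * (y * y * s))))
    where
    B = L * M
    s = (y * y) ^ j
    c = K₃ * L
    0≤s : 0ℚ ≤ s
    0≤s = 0≤^ j (0≤x*x y)
    0≤B : 0ℚ ≤ B
    0≤B = 0≤* 0≤L (≤-trans 0≤L L≤M)
    L²≤B : L * L ≤ B
    L²≤B = *-monoˡ 0≤L L≤M
    0≤C₅B = 0≤* 0≤C₅ 0≤B
    y²≤ : y * y ≤ C₅ * B
    y²≤ = ≤-trans small (*-monoʳ 0≤B C₁≤C₅)
    s≤ : s ≤ C₅ ^ j * B ^ j
    s≤ = ≤-trans (^-mono j (0≤x*x y) y²≤) (≤-reflexive (^-*-distrib C₅ B j))
    Ly≤ : L * y ≤ C₅ * B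
    Ly≤ = ≤-trans (≤-by ((L - y) * (L - y) + L * y) (0≤+ (0≤x*x (L - y)) (0≤* 0≤L 0≤y)) (lem L y))
      (≤-trans (+-mono-≤ L²≤B small)
        (≤-by ((C₁ + 2ℚ * (K₃ * K₃)) * B) (0≤* (0≤+ 0≤C₁ (0≤* (0≤lit 2ℚ) t₂)) 0≤B) (lem′ B C₁ (K₃ * K₃))))
      where
      lem : ∀ L y → L * y + ((L - y) * (L - y) + L * y) ≡ L * L + y * y
      lem = solve-∀ ℚ-ring
      lem′ : ∀ B C k → B + C * B + (C + 2ℚ * k) * B ≡ (1ℚ + 2ℚ * C + 2ℚ * k) * B
      lem′ = solve-∀ ℚ-ring
    square : (y + c) * (y + c) ≤ C₅ * B
    square = ≤-trans (≤-by ((y - c) * (y - c)) (0≤x*x (y - c)) (lem y K₃ L))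
      (≤-trans (+-mono-≤ (*-monoˡ (0≤lit 2ℚ) small)
          (*-monoˡ (0≤* (0≤lit 2ℚ) t₂) L²≤B))
        (≤-by B 0≤B (lem′ B C₁ (K₃ * K₃))))
      where
      lem : ∀ y K L → (y + K * L) * (y + K * L) + (y - K * L) * (y - K * L) ≡ 2ℚ * (y * y) + 2ℚ * (K * K) * (L * L)
      lem = solve-∀ ℚ-ring
      lem′ : ∀ B C k → 2ℚ * (C * B) + 2ℚ * k * B + B ≡ (1ℚ + 2ℚ * C + 2ℚ * k) * B
      lem′ = solve-∀ ℚ-ring
    first : K₁ * (L * (y * s)) ≤ K₁ * (C₅ * B * (C₅ ^ j * B ^ j))
    first = *-monoˡ 0≤K₁ (≤-trans (≤-reflexive (sym (*-assoc L y s))) (*-mono 0≤s 0≤C₅B Ly≤ s≤))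
    second : K₂ * B * ((y + c) * (y + c)) ^ j ≤ K₂ * B * (C₅ ^ j * B ^ j)
    second = *-monoˡ (0≤* 0≤K₂ 0≤B) (≤-trans (^-mono j (0≤x*x (y + c)) square) (≤-reflexive (^-*-distrib C₅ B j)))
    lem₅ : ∀ K₁ K₂ C Cʲ B Bʲ u → K₁ * (C * B * (Cʲ * Bʲ)) + K₂ * B * (Cʲ * Bʲ) + u
      ≡ u + (K₁ * C + K₂) * Cʲ * (B * Bʲ)
    lem₅ = solve-∀ ℚ-ring

-- The power x^(2j+2) is written through `x * x`, so that it is visibly nonnegative and `x` may be
-- exchanged for its absolute value by rewriting the square.
even-power : ℕ → ℚ → ℚ
even-power j x = x * x * (x * x) ^ j

0≤even-power : ∀ j x → 0ℚ ≤ even-power j x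
0≤even-power j x = 0≤* (0≤x*x x) (0≤^ j (0≤x*x x))

x*x^[j+j]≡ : ∀ j x → x * (x ^ (j ℕ.+ j)) ≡ x * (x * x) ^ j
x*x^[j+j]≡ j x = cong (x *_) (^-double x j)

even-power≡^ : ∀ j x → x ^ (2 ℕ.+ (j ℕ.+ j)) ≡ even-power j x
even-power≡^ j x = trans (sym (*-assoc x x _)) (cong (x * x *_) (^-double x j))

-- The 16 is the coefficient in `error-bound`. The 40 is 5 · 8: the maximal jump is 5 R² L, and the
-- total movement `T e + Q * G` is at most 8 R m². The 5 of `noise-K₃` is 1 + 4, for the degree and
-- for the average degree.
noise-K₁ noise-K₂ : ℕ → ℚ → ℚ
noise-K₁ j R = (+ 16 / 1) * ι (2 ℕ.+ (j ℕ.+ j)) * (R * R)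
noise-K₂ j R = (+ 40 / 1) * (ι (2 ℕ.+ (j ℕ.+ j)) * ι (2 ℕ.+ (j ℕ.+ j))) * (R * R * R)

noise-K₃ : ℚ → ℚ
noise-K₃ R = (+ 5 / 1) * (R * R)

step-constant : ℕ → ℚ → ℚ
step-constant j R = noise-constant j (noise-K₁ j R) (noise-K₂ j R) (noise-K₃ R)

0≤step-constant : ∀ j {R} → 0ℚ ≤ R → 0ℚ ≤ step-constant j R
0≤step-constant j {R} 0≤R = 0≤noise-constant j (noise-K₁ j R) (noise-K₂ j R) (noise-K₃ R)
  (0≤* (0≤* (0≤lit (+ 16 / 1)) 0≤N) (0≤x*x R))
  (0≤* (0≤* (0≤lit (+ 40 / 1)) (0≤* 0≤N 0≤N)) (0≤* (0≤x*x R) 0≤R))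
  (0≤* (0≤lit (+ 5 / 1)) (0≤x*x R))
  where
  0≤N = 0≤ι (2 ℕ.+ (j ℕ.+ j))

[1-b]*-mono : ∀ b {p q} → (b ≡ false → p ≤ q) → (1ℚ - [ b ]) * p ≤ (1ℚ - [ b ]) * q
[1-b]*-mono true  {p} {q} h = ≤-reflexive (trans (*-zeroˡ p) (sym (*-zeroˡ q)))
[1-b]*-mono false h = *-monoˡ 0≤1 (h refl)

-- Degrees and codegrees in a uniform hypergraph

module Hypergraph
  {I J : Set} (E : List I) (H : List J) (inc : I → J → Bool) (eqᵇ : I → I → Bool) (meet : J → J → Bool)
  where

  i : I → J → ℚ
  i e K = [ inc e K ]

  eq : I → I → ℚ
  eq e f = [ eqᵇ e f ]

  mt : J → J → ℚ
  mt K′ K = [ meet K′ K ]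

  A Q : ℚ
  A = ι (length E)
  Q = ι (length H)

  d : I → ℚ
  d e = ∑ H (i e)

  cod : I → I → ℚ
  cod e f = ∑ H (λ K → i e K * i f K)

  -- s counts the common vertices; σ bounds the overcounting when s replaces mt.
  s σ : J → J → ℚ
  s K′ K = ∑ E (λ f → i f K′ * i f K)
  σ K′ K = s K′ K * s K′ K - s K′ K

  sd : J → ℚ
  sd K = ∑ E (λ f → i f K * d f)

  -- The decrease of d e, respectively of the number of hyperedges, caused by the removal of K.
  δ : I → J → ℚ
  δ e K = ∑ H (λ K′ → i e K′ * mt K′ K)

  Δ : J → ℚ
  Δ K = ∑ H (λ K′ → mt K′ K)

  -- T e is the total loss of d e over the removals that spare e; its main term is W e − (d e)².
  T W : I → ℚ
  T e = ∑ H (λ K → (1ℚ - i e K) * δ e K)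
  W e = ∑ H (λ K → i e K * sd K)

  -- The two fields comparing `mt` and `s` retain what matters of `mt` being the indicator of s > 0:
  -- for a natural number s, this indicator is at most s, and s is at most the indicator plus s (s -
  -- 1).
  record IsUniformHypergraph (R L : ℚ) : Set where
    field
      uniform   : ∀ {K} → K ∈ H → ∑ E (λ e → i e K) ≡ R
      codegree  : ∀ {e f} → e ∈ E → f ∈ E → e ≡ f ⊎ cod e f ≤ L
      eq-refl   : ∀ e → eqᵇ e e ≡ true
      eq-sum    : ∀ {e} → e ∈ E → ∀ (φ : I → ℚ) → ∑ E (λ f → eq e f * φ f) ≡ φ e
      mt≤s      : ∀ {K′ K} → K′ ∈ H → K ∈ H → mt K′ K ≤ s K′ K
      s≤mt+σ    : ∀ {K′ K} → K′ ∈ H → K ∈ H → s K′ K ≤ mt K′ K + σ K′ K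
      0≤L       : 0ℚ ≤ L

  module Counting {R L : ℚ} (inst : IsUniformHypergraph R L) where
    open IsUniformHypergraph inst

    0≤i : ∀ e K → 0ℚ ≤ i e K
    0≤i e K = 0≤[] (inc e K)

    0≤1-i : ∀ e K → 0ℚ ≤ 1ℚ - i e K
    0≤1-i e K = p≤q⇒0≤q-p ([]≤1 (inc e K))

    i*i≡i : ∀ e K → i e K * i e K ≡ i e K
    i*i≡i e K = []*[]≡[] (inc e K)

    0≤mt : ∀ K′ K → 0ℚ ≤ mt K′ K
    0≤mt K′ K = 0≤[] (meet K′ K)

    0≤d : ∀ e → 0ℚ ≤ d e
    0≤d e = 0≤∑ H (λ {K} _ → 0≤i e K)

    0≤cod : ∀ e f → 0ℚ ≤ cod e f
    0≤cod e f = 0≤∑ H (λ {K} _ → 0≤* (0≤i e K) (0≤i f K))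

    off-diagonal : ∀ (φ : I → I → ℚ) →
      ∑ E (λ f → ∑ E (λ g → (1ℚ - eq f g) * φ f g)) ≡ ∑ E (λ f → ∑ E (φ f)) - ∑ E (λ f → φ f f)
    off-diagonal φ = trans (∑-cong E inner) (∑-- E (λ f → ∑ E (φ f)) (λ f → φ f f))
      where
      lem : ∀ a b → (1ℚ - a) * b ≡ b - a * b
      lem = solve-∀ ℚ-ring
      inner : ∀ {f} → f ∈ E → ∑ E (λ g → (1ℚ - eq f g) * φ f g) ≡ ∑ E (φ f) - φ f f
      inner {f} f∈ = trans (∑-cong E (λ {g} _ → lem (eq f g) (φ f g)))
        (trans (∑-- E (φ f) (λ g → eq f g * φ f g)) (cong (λ z → ∑ E (φ f) - z) (eq-sum f∈ (φ f))))

    ∑s≡sd : ∀ K → ∑ H (λ K′ → s K′ K) ≡ sd K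
    ∑s≡sd K = trans (∑-swap H E (λ K′ f → i f K′ * i f K))
      (∑-cong E (λ {f} _ → trans (∑-*ʳ H (i f K) (i f)) (*-comm (d f) (i f K))))

    s-sym : ∀ K′ K → s K′ K ≡ s K K′
    s-sym K′ K = ∑-cong E (λ {f} _ → *-comm (i f K′) (i f K))

    ∑d≡R*Q : ∑ E d ≡ R * Q
    ∑d≡R*Q = trans (∑-swap E H i) (trans (∑-cong H uniform)
      (trans (∑-const H R) (*-comm Q R)))

    -- Since indicators are idempotent, s² - s counts the ordered pairs of distinct common vertices.
    -- Hence `σ` is nonnegative and its sums reduce to codegrees.
    σ≡off-diagonal : ∀ K′ K → σ K′ K ≡
      ∑ E (λ f → ∑ E (λ g → (1ℚ - eq f g) * ((i f K′ * i f K) * (i g K′ * i g K))))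
    σ≡off-diagonal K′ K = sym (trans (off-diagonal (λ f g → (i f K′ * i f K) * (i g K′ * i g K)))
      (cong₂ _-_ (sym (∑-*-∑ E E (λ f → i f K′ * i f K) (λ f → i f K′ * i f K)))
        (∑-cong E (λ {f} _ → trans (lem (i f K′) (i f K)) (cong₂ _*_ (i*i≡i f K′) (i*i≡i f K))))))
      where
      lem : ∀ a b → (a * b) * (a * b) ≡ (a * a) * (b * b)
      lem = solve-∀ ℚ-ring

    0≤1-eq : ∀ f g → 0ℚ ≤ 1ℚ - eq f g
    0≤1-eq f g = p≤q⇒0≤q-p ([]≤1 (eqᵇ f g))

    0≤σ : ∀ K′ K → 0ℚ ≤ σ K′ K
    0≤σ K′ K = ≤-trans (0≤∑ E (λ {f} _ → 0≤∑ E (λ {g} _ → 0≤* (0≤1-eq f g)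
      (0≤* (0≤* (0≤i f K′) (0≤i f K)) (0≤* (0≤i g K′) (0≤i g K))))))
      (≤-reflexive (sym (σ≡off-diagonal K′ K)))

    [1-eq]*cod≤L : ∀ {f g} → f ∈ E → g ∈ E → (1ℚ - eq f g) * cod f g ≤ L
    [1-eq]*cod≤L {f} {g} f∈ g∈ with codegree f∈ g∈
    ... | inj₁ refl = ≤-trans (≤-reflexive (trans (cong (λ b → (1ℚ - [ b ]) * cod f f) (eq-refl f))
            (*-zeroˡ (cod f f)))) 0≤L
    ... | inj₂ c≤L = ≤-trans (*-monoʳ (0≤cod f g) (1-p≤1 (0≤[] (eqᵇ f g))))
            (≤-trans (≤-reflexive (*-identityˡ (cod f g))) c≤L)

    -- Double counting: each of the at most R² ordered pairs of distinct vertices of `K` lies in at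
    -- most `L` hyperedges `K′`.
    ∑σ≤ : ∀ {K} → K ∈ H → ∑ H (λ K′ → σ K′ K) ≤ R * R * L
    ∑σ≤ {K} K∈ = ≤-trans (≤-reflexive expand)
      (≤-trans (∑-mono E (λ {f} f∈ → ∑-mono E (λ {g} g∈ →
          *-monoˡ (0≤* (0≤i f K) (0≤i g K)) ([1-eq]*cod≤L f∈ g∈))))
        (≤-reflexive collect))
      where
      lem : ∀ n a b c d → n * ((a * b) * (c * d)) ≡ (b * d) * (n * (a * c))
      lem = solve-∀ ℚ-ring
      expand : ∑ H (λ K′ → σ K′ K) ≡ ∑ E (λ f → ∑ E (λ g → (i f K * i g K) * ((1ℚ - eq f g) * cod f g)))
      expand = trans (∑-cong H (λ {K′} _ → σ≡off-diagonal K′ K))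
        (trans (∑-swap H E (λ K′ f → ∑ E (λ g → (1ℚ - eq f g) * ((i f K′ * i f K) * (i g K′ * i g K)))))
        (∑-cong E (λ {f} _ → trans (∑-swap H E (λ K′ g → (1ℚ - eq f g) * ((i f K′ * i f K) * (i g K′ * i g K))))
        (∑-cong E (λ {g} _ → trans (∑-cong H (λ {K′} _ → lem (1ℚ - eq f g) (i f K′) (i f K) (i g K′) (i g K)))
          (trans (∑-*ˡ H (i f K * i g K) (λ K′ → (1ℚ - eq f g) * (i f K′ * i g K′)))
            (cong (i f K * i g K *_) (∑-*ˡ H (1ℚ - eq f g) (λ K′ → i f K′ * i g K′)))))))))
      collect : ∑ E (λ f → ∑ E (λ g → (i f K * i g K) * L)) ≡ R * R * L
      collect = trans (∑-cong E (λ {f} _ → ∑-*ʳ E L (λ g → i f K * i g K)))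
        (trans (∑-*ʳ E L (λ f → ∑ E (λ g → i f K * i g K)))
          (cong (_* L) (trans (sym (∑-*-∑ E E (λ f → i f K) (λ g → i g K)))
            (cong₂ _*_ (uniform K∈) (uniform K∈)))))

    Δ≤sd : ∀ {K} → K ∈ H → Δ K ≤ sd K
    Δ≤sd {K} K∈ = ≤-trans (∑-mono H (λ K′∈ → mt≤s K′∈ K∈)) (≤-reflexive (∑s≡sd K))

    sd≤Δ+R²L : ∀ {K} → K ∈ H → sd K ≤ Δ K + R * R * L
    sd≤Δ+R²L {K} K∈ = ≤-trans (≤-reflexive (sym (∑s≡sd K)))
      (≤-trans (∑-mono H (λ K′∈ → s≤mt+σ K′∈ K∈))
      (≤-trans (≤-reflexive (∑-+ H (λ K′ → mt K′ K) (λ K′ → σ K′ K))) (+-monoʳ-≤ (Δ K) (∑σ≤ K∈))))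

    0≤Δ : ∀ K → 0ℚ ≤ Δ K
    0≤Δ K = 0≤∑ H (λ {K′} _ → 0≤mt K′ K)

    0≤δ : ∀ e K → 0ℚ ≤ δ e K
    0≤δ e K = 0≤∑ H (λ {K′} _ → 0≤* (0≤i e K′) (0≤mt K′ K))

    ∑i*s≡∑i*cod : ∀ e K → ∑ H (λ K′ → i e K′ * s K′ K) ≡ ∑ E (λ f → i f K * cod e f)
    ∑i*s≡∑i*cod e K = trans (∑-cong H (λ {K′} _ → sym (∑-*ˡ E (i e K′) (λ f → i f K′ * i f K))))
      (trans (∑-swap H E (λ K′ f → i e K′ * (i f K′ * i f K)))
      (∑-cong E (λ {f} _ → trans (∑-cong H (λ {K′} _ → lem (i e K′) (i f K′) (i f K)))
        (∑-*ˡ H (i f K) (λ K′ → i e K′ * i f K′)))))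
      where
      lem : ∀ a b c → a * (b * c) ≡ c * (a * b)
      lem = solve-∀ ℚ-ring

    -- A hyperedge through `e` that meets `K` contains `e` and some vertex f of `K`. As `K` spares
    -- `e`, f differs from `e`, so each of the R choices of f accounts for at most `L` hyperedges.
    [1-i]*δ≤RL : ∀ {e K} → e ∈ E → K ∈ H → (1ℚ - i e K) * δ e K ≤ R * L
    [1-i]*δ≤RL {e} {K} e∈ K∈ = ≤-trans (*-monoˡ (0≤1-i e K)
        (≤-trans (∑-mono H (λ {K′} K′∈ → *-monoˡ (0≤i e K′) (mt≤s K′∈ K∈))) (≤-reflexive (∑i*s≡∑i*cod e K))))
      (≤-trans (≤-reflexive (sym (∑-*ˡ E (1ℚ - i e K) (λ f → i f K * cod e f))))
      (≤-trans (∑-mono E pointwise)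
        (≤-reflexive (trans (∑-*ʳ E L (λ f → i f K)) (cong (_* L) (uniform K∈))))))
      where
      pointwise : ∀ {f} → f ∈ E → (1ℚ - i e K) * (i f K * cod e f) ≤ i f K * L
      pointwise {f} f∈ with codegree e∈ f∈
      ... | inj₁ refl = ≤-trans (≤-reflexive (trans (lem (i e K) (cod e e))
              (trans (cong (λ z → (i e K - z) * cod e e) (i*i≡i e K)) (lem′ (i e K) (cod e e)))))
              (0≤* (0≤i e K) 0≤L)
        where
        lem : ∀ a b → (1ℚ - a) * (a * b) ≡ (a - a * a) * b
        lem = solve-∀ ℚ-ring
        lem′ : ∀ a b → (a - a) * b ≡ 0ℚ
        lem′ = solve-∀ ℚ-ring
      ... | inj₂ c≤L = ≤-trans (*-monoʳ (0≤* (0≤i f K) (0≤cod e f)) (1-p≤1 (0≤i e K)))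
              (≤-trans (≤-reflexive (*-identityˡ _)) (*-monoˡ (0≤i f K) c≤L))

    T≡ : ∀ e → T e ≡ ∑ H (λ K → ∑ H (λ K′ → (1ℚ - i e K) * (i e K′ * mt K′ K)))
    T≡ e = ∑-cong H (λ {K} _ → sym (∑-*ˡ H (1ℚ - i e K) (λ K′ → i e K′ * mt K′ K)))

    -- With `s` in place of `mt` the loss can be evaluated exactly. Over all `K` the double sum is
    -- `W e`; in the excluded part both hyperedges contain `e`, and sorting these pairs by a common
    -- vertex f gives the square of `cod e f`.
    core : ∀ e → ∑ H (λ K → ∑ H (λ K′ → (1ℚ - i e K) * (i e K′ * s K′ K)))
      ≡ W e - ∑ E (λ f → cod e f * cod e f)
    core e = trans (∑-cong H (λ {K} _ → trans (∑-cong H (λ {K′} _ → lem (i e K) (i e K′) (s K′ K)))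
          (∑-- H (λ K′ → i e K′ * s K′ K) (λ K′ → i e K * (i e K′ * s K′ K)))))
      (trans (∑-- H (λ K → ∑ H (λ K′ → i e K′ * s K′ K)) (λ K → ∑ H (λ K′ → i e K * (i e K′ * s K′ K))))
      (cong₂ _-_ left right))
      where
      lem : ∀ a b c → (1ℚ - a) * (b * c) ≡ b * c - a * (b * c)
      lem = solve-∀ ℚ-ring
      left : ∑ H (λ K → ∑ H (λ K′ → i e K′ * s K′ K)) ≡ W e
      left = trans (∑-swap H H (λ K K′ → i e K′ * s K′ K))
        (∑-cong H (λ {K′} _ → trans (∑-*ˡ H (i e K′) (s K′))
          (cong (i e K′ *_) (trans (∑-cong H (λ {K} _ → s-sym K′ K)) (∑s≡sd K′)))))
      lem′ : ∀ a b c → a * (b * c) ≡ (a * b) * c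
      lem′ = solve-∀ ℚ-ring
      right : ∑ H (λ K → ∑ H (λ K′ → i e K * (i e K′ * s K′ K))) ≡ ∑ E (λ f → cod e f * cod e f)
      right = trans (∑-cong H (λ {K} _ → trans (∑-*ˡ H (i e K) (λ K′ → i e K′ * s K′ K))
          (trans (cong (i e K *_) (∑i*s≡∑i*cod e K)) (sym (∑-*ˡ E (i e K) (λ f → i f K * cod e f))))))
        (trans (∑-swap H E (λ K f → i e K * (i f K * cod e f)))
        (∑-cong E (λ {f} _ → trans (∑-cong H (λ {K} _ → lem′ (i e K) (i f K) (cod e f)))
          (∑-*ʳ H (cod e f) (λ K → i e K * i f K)))))

    cod-diagonal : ∀ e → cod e e ≡ d e
    cod-diagonal e = ∑-cong H (λ {K} _ → i*i≡i e K)

    d²≤∑cod² : ∀ {e} → e ∈ E → d e * d e ≤ ∑ E (λ f → cod e f * cod e f)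
    d²≤∑cod² {e} e∈ = ≤-trans (≤-reflexive (sym (cong₂ _*_ (cod-diagonal e) (cod-diagonal e))))
      (∑-single-≤ E (λ {f} _ → 0≤x*x (cod e f)) e∈)

    ∑cod≡R*d : ∀ e → ∑ E (cod e) ≡ R * d e
    ∑cod≡R*d e = trans (∑-swap E H (λ f K → i e K * i f K))
      (trans (∑-cong H (λ {K} K∈ → trans (∑-*ˡ E (i e K) (λ f → i f K)) (cong (i e K *_) (uniform K∈))))
      (trans (∑-*ʳ H R (i e)) (*-comm (d e) R)))

    -- Only f = e has a large codegree, namely `d e`. For all other f one factor is at most `L`, and
    -- the remaining factors sum to at most `R * d e`.
    ∑cod²≤ : ∀ {e} → e ∈ E → ∑ E (λ f → cod e f * cod e f) ≤ d e * d e + L * (R * d e)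
    ∑cod²≤ {e} e∈ = ≤-trans (∑-mono E pointwise)
      (≤-reflexive (trans (∑-+ E (λ f → eq e f * (d e * d e)) (λ f → L * cod e f))
        (cong₂ _+_ (eq-sum e∈ (λ _ → d e * d e)) (trans (∑-*ˡ E L (cod e)) (cong (L *_) (∑cod≡R*d e))))))
      where
      pointwise : ∀ {f} → f ∈ E → cod e f * cod e f ≤ eq e f * (d e * d e) + L * cod e f
      pointwise {f} f∈ with codegree e∈ f∈
      ... | inj₁ refl = ≤-by (L * cod e e) (0≤* 0≤L (0≤cod e e)) (cong (_+ L * cod e e)
              (trans (cong₂ _*_ (cod-diagonal e) (cod-diagonal e))
                (trans (sym (*-identityˡ (d e * d e))) (cong (λ b → [ b ] * (d e * d e)) (sym (eq-refl e))))))
      ... | inj₂ c≤L = ≤-trans (*-monoʳ (0≤cod e f) c≤L)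
              (≤-by (eq e f * (d e * d e)) (0≤* (0≤[] (eqᵇ e f)) (0≤x*x (d e))) (+-comm (L * cod e f) _))

    T≤W-d² : ∀ {e} → e ∈ E → T e ≤ W e - d e * d e
    T≤W-d² {e} e∈ = ≤-trans (≤-reflexive (T≡ e))
      (≤-trans (∑-mono H (λ {K} K∈ → ∑-mono H (λ {K′} K′∈ →
          *-monoˡ (0≤1-i e K) (*-monoˡ (0≤i e K′) (mt≤s K′∈ K∈)))))
      (≤-trans (≤-reflexive (core e)) (+-monoʳ-≤ (W e) (neg-antimono-≤ (d²≤∑cod² e∈)))))

    W-d²≤T : ∀ {e} → e ∈ E → W e - d e * d e ≤ T e + (R * L + R * R * L) * d e
    W-d²≤T {e} e∈ = ≤-trans (≤-by (d e * d e + L * (R * d e) - C²) (p≤q⇒0≤q-p (∑cod²≤ e∈)) (lem (W e) (d e) L R C²))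
      (≤-trans (+-monoˡ-≤ (L * (R * d e)) core≤) (≤-reflexive (lem′ (T e) R L (d e))))
      where
      C² = ∑ E (λ f → cod e f * cod e f)
      lem : ∀ W d L R C → W - d * d + (d * d + L * (R * d) - C) ≡ W - C + L * (R * d)
      lem = solve-∀ ℚ-ring
      lem′ : ∀ T R L d → T + R * R * L * d + L * (R * d) ≡ T + (R * L + R * R * L) * d
      lem′ = solve-∀ ℚ-ring
      pointwise : ∀ {K K′} → K ∈ H → K′ ∈ H →
        (1ℚ - i e K) * (i e K′ * s K′ K) ≤ (1ℚ - i e K) * (i e K′ * mt K′ K) + i e K′ * σ K′ K
      pointwise {K} {K′} K∈ K′∈ = ≤-trans (*-monoˡ (0≤1-i e K) (*-monoˡ (0≤i e K′) (s≤mt+σ K′∈ K∈)))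
        (≤-by (i e K * (i e K′ * σ K′ K)) (0≤* (0≤i e K) (0≤* (0≤i e K′) (0≤σ K′ K)))
          (lem″ (i e K) (i e K′) (mt K′ K) (σ K′ K)))
        where
        lem″ : ∀ a b m s → (1ℚ - a) * (b * (m + s)) + a * (b * s) ≡ (1ℚ - a) * (b * m) + b * s
        lem″ = solve-∀ ℚ-ring
      ∑∑σ≤ : ∑ H (λ K → ∑ H (λ K′ → i e K′ * σ K′ K)) ≤ R * R * L * d e
      ∑∑σ≤ = ≤-trans (≤-reflexive (trans (∑-swap H H (λ K K′ → i e K′ * σ K′ K))
          (∑-cong H (λ {K′} _ → trans (∑-*ˡ H (i e K′) (σ K′)) (cong (i e K′ *_)
            (∑-cong H (λ {K} _ → cong₂ (λ u v → u * v - v) (s-sym K′ K) (s-sym K′ K))))))))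
        (≤-trans (∑-mono H (λ {K′} K′∈ → *-monoˡ (0≤i e K′) (∑σ≤ K′∈)))
          (≤-reflexive (trans (∑-*ʳ H (R * R * L) (i e)) (*-comm (d e) (R * R * L)))))
      core≤ : W e - C² ≤ T e + R * R * L * d e
      core≤ = ≤-trans (≤-reflexive (sym (core e)))
        (≤-trans (∑-mono H (λ K∈ → ∑-mono H (λ K′∈ → pointwise K∈ K′∈)))
        (≤-trans (≤-reflexive (trans (∑-cong H (λ {K} _ → ∑-+ H (λ K′ → (1ℚ - i e K) * (i e K′ * mt K′ K)) (λ K′ → i e K′ * σ K′ K)))
            (trans (∑-+ H (λ K → ∑ H (λ K′ → (1ℚ - i e K) * (i e K′ * mt K′ K))) (λ K → ∑ H (λ K′ → i e K′ * σ K′ K)))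
              (cong (_+ ∑ H (λ K → ∑ H (λ K′ → i e K′ * σ K′ K))) (sym (T≡ e))))))
          (+-monoʳ-≤ (T e) ∑∑σ≤)))

    ∑sd≡∑d² : ∑ H sd ≡ ∑ E (λ f → d f * d f)
    ∑sd≡∑d² = trans (∑-swap H E (λ K f → i f K * d f)) (∑-cong E (λ {f} _ → ∑-*ʳ H (d f) (i f)))

    ∑Δ≤∑d² : ∑ H Δ ≤ ∑ E (λ f → d f * d f)
    ∑Δ≤∑d² = ≤-trans (∑-mono H Δ≤sd) (≤-reflexive ∑sd≡∑d²)

    ∑d²≤∑Δ+QR²L : ∑ E (λ f → d f * d f) ≤ ∑ H Δ + Q * (R * R * L)
    ∑d²≤∑Δ+QR²L = ≤-trans (≤-reflexive (sym ∑sd≡∑d²)) (≤-trans (∑-mono H sd≤Δ+R²L)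
      (≤-reflexive (trans (∑-+ H Δ (λ _ → R * R * L)) (cong (λ z → ∑ H Δ + z) (∑-const H (R * R * L))))))

    -- m is the average degree; a and a′ are the inverses of A and of A − R, the number of vertices after the step.
    record IsBalanced (M a a′ m η : ℚ) (j : ℕ) : Set where
      field
        1≤R     : 1ℚ ≤ R
        0≤a     : 0ℚ ≤ a
        0≤a′    : 0ℚ ≤ a′
        0≤m     : 0ℚ ≤ m
        Aa≡1    : A * a ≡ 1ℚ
        Am≡RQ   : A * m ≡ R * Q
        Aa′≡    : A * a′ ≡ 1ℚ + R * a′
        a′≤2a   : a′ ≤ 2ℚ * a
        am≤L    : a * m ≤ L
        L≤M     : L ≤ M
        m≤M     : m ≤ M
        0≤η     : 0ℚ ≤ η
        η≤1     : η ≤ 1ℚ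
        η-small : (+ 6 / 1) * ι (2 ℕ.+ (j ℕ.+ j)) * R * η ≤ 1ℚ
        good    : ∀ {e} → e ∈ E → ∣ d e - m ∣ ≤ η * m

    -- Drift of the moment in one step

    module OneStep {M a a′ m η : ℚ} {j : ℕ} (bal : IsBalanced M a a′ m η j) where

      open IsBalanced bal
      open ℚₚ.≤-Reasoning

      N : ℚ
      N = ι (2 ℕ.+ (j ℕ.+ j))

      0≤N : 0ℚ ≤ N
      0≤N = 0≤ι (2 ℕ.+ (j ℕ.+ j))

      0≤R : 0ℚ ≤ R
      0≤R = ≤-trans 0≤1 1≤R

      0≤A : 0ℚ ≤ A
      0≤A = 0≤ι (length E)

      0≤Q : 0ℚ ≤ Q
      0≤Q = 0≤ι (length H)

      0≤2 : 0ℚ ≤ 2ℚ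
      0≤2 = 0≤lit 2ℚ

      x y t F c C : I → ℚ
      x e = d e - m
      y e = ∣ x e ∣
      t e = (x e * x e) ^ j
      F e = x e * x e * t e
      c e = x e * t e
      C e = y e * t e

      -- `x′` is the deviation from the new average degree `R * (Q - Δ K) * a′` after `K` is
      -- removed. In the jump `ξ`, the average degree falls by `R * a′ * (Δ K - m)` and the degree
      -- by `δ e K`.
      x′ ξ : I → J → ℚ
      x′ e K = d e - δ e K - R * (Q - Δ K) * a′
      ξ e K  = R * a′ * (Δ K - m) - δ e K

      0≤y : ∀ e → 0ℚ ≤ y e
      0≤y e = 0≤∣p∣ (x e)

      0≤t : ∀ e → 0ℚ ≤ t e
      0≤t e = 0≤^ j (0≤x*x (x e))

      0≤F : ∀ e → 0ℚ ≤ F e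
      0≤F e = 0≤even-power j (x e)

      0≤C : ∀ e → 0ℚ ≤ C e
      0≤C e = 0≤* (0≤y e) (0≤t e)

      y*y≡x*x : ∀ e → y e * y e ≡ x e * x e
      y*y≡x*x e = ∣p∣*∣p∣≡p*p (x e)

      d≡m+x : ∀ e → d e ≡ m + x e
      d≡m+x e = lem (d e) m
        where
        lem : ∀ d m → d ≡ m + (d - m)
        lem = solve-∀ ℚ-ring

      d≤m+ηm : ∀ {e} → e ∈ E → d e ≤ m + η * m
      d≤m+ηm {e} e∈ = ≤-trans (≤-reflexive (d≡m+x e)) (+-monoʳ-≤ m (≤-trans (p≤∣p∣ (x e)) (good e∈)))

      d≤2m : ∀ {e} → e ∈ E → d e ≤ 2ℚ * m
      d≤2m {e} e∈ = begin
        d e            ≤⟨ d≤m+ηm e∈ ⟩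
        m + η * m      ≤⟨ +-monoʳ-≤ m (*-monoʳ 0≤m η≤1) ⟩
        m + 1ℚ * m     ≡⟨ lem m ⟩
        2ℚ * m         ∎
        where
        lem : ∀ m → m + 1ℚ * m ≡ 2ℚ * m
        lem = solve-∀ ℚ-ring

      sd≤2Rm : ∀ {K} → K ∈ H → sd K ≤ 2ℚ * R * m
      sd≤2Rm {K} K∈ = begin
        sd K                                  ≤⟨ ∑-mono E (λ {f} f∈ → *-monoˡ (0≤i f K) (d≤2m f∈)) ⟩
        ∑ E (λ f → i f K * (2ℚ * m))          ≡⟨ ∑-*ʳ E (2ℚ * m) (λ f → i f K) ⟩
        ∑ E (λ f → i f K) * (2ℚ * m)          ≡⟨ cong (_* (2ℚ * m)) (uniform K∈) ⟩
        R * (2ℚ * m)                          ≡⟨ lem R m ⟩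
        2ℚ * R * m                            ∎
        where
        lem : ∀ R m → R * (2ℚ * m) ≡ 2ℚ * R * m
        lem = solve-∀ ℚ-ring

      Δ≤2Rm : ∀ {K} → K ∈ H → Δ K ≤ 2ℚ * R * m
      Δ≤2Rm K∈ = ≤-trans (Δ≤sd K∈) (sd≤2Rm K∈)

      0≤2Rm : 0ℚ ≤ 2ℚ * R * m
      0≤2Rm = 0≤* (0≤* 0≤2 0≤R) 0≤m

      m≤2Rm : m ≤ 2ℚ * R * m
      m≤2Rm = begin
        m            ≡⟨ *-identityˡ m ⟨
        1ℚ * m       ≤⟨ *-monoʳ 0≤m 1≤R ⟩
        R * m        ≤⟨ ≤-by (R * m) (0≤* 0≤R 0≤m) (lem R m) ⟩
        2ℚ * R * m   ∎
        where
        lem : ∀ R m → R * m + R * m ≡ 2ℚ * R * m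
        lem = solve-∀ ℚ-ring

      ∣Δ-m∣≤2Rm : ∀ {K} → K ∈ H → ∣ Δ K - m ∣ ≤ 2ℚ * R * m
      ∣Δ-m∣≤2Rm {K} K∈ = ∣p∣≤
        (≤-trans (≤-by m 0≤m (lem (Δ K) m)) (Δ≤2Rm K∈))
        (≤-trans (≤-by (Δ K) (0≤Δ K) (lem′ (Δ K) m)) m≤2Rm)
        where
        lem : ∀ D m → D - m + m ≡ D
        lem = solve-∀ ℚ-ring
        lem′ : ∀ D m → - (D - m) + D ≡ m
        lem′ = solve-∀ ℚ-ring

      Aa′≤2 : A * a′ ≤ 2ℚ
      Aa′≤2 = begin
        A * a′         ≤⟨ *-monoˡ 0≤A a′≤2a ⟩
        A * (2ℚ * a)   ≡⟨ lem A a ⟩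
        2ℚ * (A * a)   ≡⟨ cong (2ℚ *_) Aa≡1 ⟩
        2ℚ * 1ℚ        ≡⟨ *-identityʳ 2ℚ ⟩
        2ℚ             ∎
        where
        lem : ∀ A a → A * (2ℚ * a) ≡ 2ℚ * (A * a)
        lem = solve-∀ ℚ-ring

      a′m≤2L : a′ * m ≤ 2ℚ * L
      a′m≤2L = begin
        a′ * m         ≤⟨ *-monoʳ 0≤m a′≤2a ⟩
        2ℚ * a * m     ≡⟨ *-assoc 2ℚ a m ⟩
        2ℚ * (a * m)   ≤⟨ *-monoˡ 0≤2 am≤L ⟩
        2ℚ * L         ∎

      -- A bound for the change of the average degree in one step.
      G : ℚ
      G = R * a′ * (2ℚ * R * m)

      0≤Ra′ : 0ℚ ≤ R * a′
      0≤Ra′ = 0≤* 0≤R 0≤a′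

      0≤G : 0ℚ ≤ G
      0≤G = 0≤* 0≤Ra′ 0≤2Rm

      G≤4RRL : G ≤ (+ 4 / 1) * (R * R) * L
      G≤4RRL = begin
        G                              ≡⟨ lem R a′ m ⟩
        2ℚ * (R * R) * (a′ * m)        ≤⟨ *-monoˡ (0≤* 0≤2 (0≤x*x R)) a′m≤2L ⟩
        2ℚ * (R * R) * (2ℚ * L)        ≡⟨ lem′ (R * R) L ⟩
        (+ 4 / 1) * (R * R) * L        ∎
        where
        lem : ∀ R a m → R * a * (2ℚ * R * m) ≡ 2ℚ * (R * R) * (a * m)
        lem = solve-∀ ℚ-ring
        lem′ : ∀ R L → 2ℚ * R * (2ℚ * L) ≡ (+ 4 / 1) * R * L
        lem′ = solve-∀ ℚ-ring

      ∣ξ∣≤δ+G : ∀ e {K} → K ∈ H → ∣ ξ e K ∣ ≤ δ e K + G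
      ∣ξ∣≤δ+G e {K} K∈ = begin
        ∣ ξ e K ∣                              ≤⟨ ℚₚ.∣p-q∣≤∣p∣+∣q∣ (R * a′ * (Δ K - m)) (δ e K) ⟩
        ∣ R * a′ * (Δ K - m) ∣ + ∣ δ e K ∣      ≡⟨ cong₂ _+_ (trans (∣p*q∣≡∣p∣*∣q∣ (R * a′) (Δ K - m))
                                                     (cong (_* ∣ Δ K - m ∣) (0≤p⇒∣p∣≡p 0≤Ra′)))
                                                   (0≤p⇒∣p∣≡p (0≤δ e K)) ⟩
        R * a′ * ∣ Δ K - m ∣ + δ e K            ≤⟨ +-monoˡ-≤ (δ e K) (*-monoˡ 0≤Ra′ (∣Δ-m∣≤2Rm K∈)) ⟩
        G + δ e K                              ≡⟨ +-comm G (δ e K) ⟩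
        δ e K + G                              ∎

      K₃ c₀ : ℚ
      K₃ = noise-K₃ R
      c₀ = K₃ * L

      δ≤RRL : ∀ {e K} → e ∈ E → K ∈ H → inc e K ≡ false → δ e K ≤ R * R * L
      δ≤RRL {e} {K} e∈ K∈ eq = begin
        δ e K                     ≡⟨ *-identityˡ (δ e K) ⟨
        1ℚ * δ e K                ≡⟨ cong (λ b → (1ℚ - [ b ]) * δ e K) eq ⟨
        (1ℚ - i e K) * δ e K      ≤⟨ [1-i]*δ≤RL e∈ K∈ ⟩
        R * L                     ≡⟨ cong (_* L) (*-identityˡ R) ⟨
        1ℚ * R * L                ≤⟨ *-monoʳ 0≤L (*-monoʳ 0≤R 1≤R) ⟩
        R * R * L                 ∎

      ∣ξ∣≤c₀ : ∀ {e K} → e ∈ E → K ∈ H → inc e K ≡ false → ∣ ξ e K ∣ ≤ c₀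
      ∣ξ∣≤c₀ {e} {K} e∈ K∈ eq = begin
        ∣ ξ e K ∣                              ≤⟨ ∣ξ∣≤δ+G e K∈ ⟩
        δ e K + G                              ≤⟨ +-mono-≤ (δ≤RRL e∈ K∈ eq) G≤4RRL ⟩
        R * R * L + (+ 4 / 1) * (R * R) * L    ≡⟨ lem (R * R) L ⟩
        c₀                                     ∎
        where
        lem : ∀ R L → R * L + (+ 4 / 1) * R * L ≡ (+ 5 / 1) * R * L
        lem = solve-∀ ℚ-ring

      0≤c₀ : 0ℚ ≤ c₀
      0≤c₀ = 0≤* (0≤* (0≤lit (+ 5 / 1)) (0≤x*x R)) 0≤L

      x′≡x+ξ : ∀ e K → x′ e K ≡ x e + ξ e K
      x′≡x+ξ e K = begin-equality
        x′ e K                                               ≡⟨ lem₁ (d e) (δ e K) R Q (Δ K) a′ ⟩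
        d e - δ e K - R * Q * a′ + R * Δ K * a′              ≡⟨ cong (λ z → d e - δ e K - z * a′ + R * Δ K * a′) Am≡RQ ⟨
        d e - δ e K - A * m * a′ + R * Δ K * a′              ≡⟨ lem₂ (d e) (δ e K) A m R (Δ K) a′ ⟩
        d e - δ e K - m * (A * a′) + R * Δ K * a′            ≡⟨ cong (λ z → d e - δ e K - m * z + R * Δ K * a′) Aa′≡ ⟩
        d e - δ e K - m * (1ℚ + R * a′) + R * Δ K * a′       ≡⟨ lem₃ (d e) (δ e K) m R (Δ K) a′ ⟩
        x e + ξ e K                                          ∎
        where
        lem₁ : ∀ d δ R Q D a → d - δ - R * (Q - D) * a ≡ d - δ - R * Q * a + R * D * a
        lem₁ = solve-∀ ℚ-ring
        lem₂ : ∀ d δ A m R D a → d - δ - A * m * a + R * D * a ≡ d - δ - m * (A * a) + R * D * a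
        lem₂ = solve-∀ ℚ-ring
        lem₃ : ∀ d δ m R D a → d - δ - m * (1ℚ + R * a) + R * D * a ≡ d - m + (R * a * (D - m) - δ)
        lem₃ = solve-∀ ℚ-ring

      w : I → ℚ
      w e = ((y e + c₀) * (y e + c₀)) ^ j

      0≤w : ∀ e → 0ℚ ≤ w e
      0≤w e = 0≤^ j (0≤x*x (y e + c₀))

      -- Of the two factors in ξ², one is bounded by the maximal jump `c₀`, the other by
      -- `δ e K + G`. The latter sums to order m² over all `K`, so the variance is not estimated by
      -- the square of the maximal jump.
      F′-pointwise : ∀ {e K} → e ∈ E → K ∈ H → inc e K ≡ false →
        even-power j (x′ e K) ≤ F e + N * c e * ξ e K + N * N * (c₀ * (δ e K + G)) * w e
      F′-pointwise {e} {K} e∈ K∈ eq = begin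
        even-power j (x′ e K)                   ≡⟨ cong (even-power j) (x′≡x+ξ e K) ⟩
        even-power j (x e + ξ e K)              ≡⟨ even-power≡^ j (x e + ξ e K) ⟨
        (x e + ξ e K) ^ (2 ℕ.+ (j ℕ.+ j))       ≤⟨ taylor (j ℕ.+ j) (x e) (ξ e K) (∣ξ∣≤c₀ e∈ K∈ eq) ⟩
        x e ^ (2 ℕ.+ (j ℕ.+ j)) + N * x e ^ (1 ℕ.+ (j ℕ.+ j)) * ξ e K + N * N * (ξ e K * ξ e K) * (y e + c₀) ^ (j ℕ.+ j)
          ≡⟨ cong₂ _+_ (cong₂ (λ u v → u + N * v * ξ e K) (even-power≡^ j (x e)) (x*x^[j+j]≡ j (x e)))
               (cong₂ (λ u v → N * N * u * v) (sym (∣p∣*∣p∣≡p*p (ξ e K))) (^-double (y e + c₀) j)) ⟩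
        F e + N * c e * ξ e K + N * N * (∣ ξ e K ∣ * ∣ ξ e K ∣) * w e
          ≤⟨ +-monoʳ-≤ (F e + N * c e * ξ e K) (*-monoʳ (0≤w e) (*-monoˡ (0≤* 0≤N 0≤N)
               (*-mono (0≤∣p∣ (ξ e K)) 0≤c₀ (∣ξ∣≤c₀ e∈ K∈ eq) (∣ξ∣≤δ+G e K∈)))) ⟩
        F e + N * c e * ξ e K + N * N * (c₀ * (δ e K + G)) * w e ∎

      Dr : I → ℚ
      Dr e = ∑ H (λ K → (1ℚ - i e K) * ξ e K)

      T≤4Rmm : ∀ {e} → e ∈ E → T e ≤ (+ 4 / 1) * R * (m * m)
      T≤4Rmm {e} e∈ = begin
        T e                                  ≤⟨ T≤W-d² e∈ ⟩
        W e - d e * d e                      ≤⟨ ≤-by (d e * d e) (0≤x*x (d e)) (lem (W e) (d e)) ⟩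
        W e                                  ≤⟨ ∑-mono H (λ {K} K∈ → *-monoˡ (0≤i e K) (sd≤2Rm K∈)) ⟩
        ∑ H (λ K → i e K * (2ℚ * R * m))     ≡⟨ ∑-*ʳ H (2ℚ * R * m) (i e) ⟩
        d e * (2ℚ * R * m)                   ≤⟨ *-monoʳ 0≤2Rm (d≤2m e∈) ⟩
        2ℚ * m * (2ℚ * R * m)                ≡⟨ lem′ R m ⟩
        (+ 4 / 1) * R * (m * m)              ∎
        where
        lem : ∀ W d → W - d * d + d * d ≡ W
        lem = solve-∀ ℚ-ring
        lem′ : ∀ R m → 2ℚ * m * (2ℚ * R * m) ≡ (+ 4 / 1) * R * (m * m)
        lem′ = solve-∀ ℚ-ring

      QG≤4Rmm : Q * G ≤ (+ 4 / 1) * R * (m * m)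
      QG≤4Rmm = begin
        Q * G                               ≡⟨ lem Q R a′ m ⟩
        R * Q * (2ℚ * R * (a′ * m))         ≡⟨ cong (_* (2ℚ * R * (a′ * m))) Am≡RQ ⟨
        A * m * (2ℚ * R * (a′ * m))         ≡⟨ lem′ A R a′ m ⟩
        2ℚ * R * (m * m) * (A * a′)         ≤⟨ *-monoˡ (0≤* (0≤* 0≤2 0≤R) (0≤x*x m)) Aa′≤2 ⟩
        2ℚ * R * (m * m) * 2ℚ               ≡⟨ lem″ R (m * m) ⟩
        (+ 4 / 1) * R * (m * m)             ∎
        where
        lem : ∀ Q R a m → Q * (R * a * (2ℚ * R * m)) ≡ R * Q * (2ℚ * R * (a * m))
        lem = solve-∀ ℚ-ring
        lem′ : ∀ A R a m → A * m * (2ℚ * R * (a * m)) ≡ 2ℚ * R * (m * m) * (A * a)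
        lem′ = solve-∀ ℚ-ring
        lem″ : ∀ R m → 2ℚ * R * m * 2ℚ ≡ (+ 4 / 1) * R * m
        lem″ = solve-∀ ℚ-ring

      κ : ℚ
      κ = noise-K₂ j R

      edge-sum : ∀ {e} → e ∈ E → ∑ H (λ K → (1ℚ - i e K) * even-power j (x′ e K))
        ≤ Q * F e + N * (c e * Dr e) + m * (κ * (L * M) * w e)
      edge-sum {e} e∈ = begin
        ∑ H (λ K → (1ℚ - i e K) * even-power j (x′ e K))
          ≤⟨ ∑-mono H (λ {K} K∈ → [1-b]*-mono (inc e K) (F′-pointwise e∈ K∈)) ⟩
        ∑ H (λ K → (1ℚ - i e K) * (F e + N * c e * ξ e K + N * N * (c₀ * (δ e K + G)) * w e))
          -- For the terms free of `ξ` and `δ`, the restriction to hyperedges sparing `e` is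
          -- dropped; the amount added is nonnegative.
          ≤⟨ ∑-mono H (λ {K} K∈ → ≤-by (i e K * (F e + Z * G)) (0≤* (0≤i e K) (0≤+ (0≤F e) (0≤* 0≤Z 0≤G)))
               (lem₁ (i e K) (F e) (N * c e) (ξ e K) N c₀ (δ e K) G (w e))) ⟩
        ∑ H (λ K → F e + Z * G + (N * c e * ((1ℚ - i e K) * ξ e K) + Z * ((1ℚ - i e K) * δ e K)))
          ≡⟨ trans (∑-+ H (λ _ → F e + Z * G) (λ K → N * c e * ((1ℚ - i e K) * ξ e K) + Z * ((1ℚ - i e K) * δ e K)))
             (cong₂ _+_ (∑-const H (F e + Z * G))
             (trans (∑-+ H (λ K → N * c e * ((1ℚ - i e K) * ξ e K)) (λ K → Z * ((1ℚ - i e K) * δ e K)))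
               (cong₂ _+_ (∑-*ˡ H (N * c e) (λ K → (1ℚ - i e K) * ξ e K)) (∑-*ˡ H Z (λ K → (1ℚ - i e K) * δ e K))))) ⟩
        Q * (F e + Z * G) + (N * c e * Dr e + Z * T e)
          ≡⟨ lem₂ Q (F e) Z G (N) (c e) (Dr e) (T e) ⟩
        Q * F e + N * (c e * Dr e) + Z * (T e + Q * G)
          ≤⟨ +-monoʳ-≤ (Q * F e + N * (c e * Dr e)) (begin
               Z * (T e + Q * G)                                         ≤⟨ *-monoˡ 0≤Z (+-mono-≤ (T≤4Rmm e∈) QG≤4Rmm) ⟩
               Z * ((+ 4 / 1) * R * (m * m) + (+ 4 / 1) * R * (m * m))   ≡⟨ lem₃ Z R m ⟩
               -- One factor m is kept as the common factor of the step. The other is replaced by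
               -- the time-independent bound `M`, so that all steps share the noise level `L * M`.
               Z * ((+ 8 / 1) * R * m) * m                               ≤⟨ *-monoˡ (0≤* 0≤Z (0≤* (0≤* (0≤lit (+ 8 / 1)) 0≤R) 0≤m)) m≤M ⟩
               Z * ((+ 8 / 1) * R * m) * M                               ≡⟨ lem₄ N R L (w e) m M ⟩
               m * (κ * (L * M) * w e) ∎) ⟩
        Q * F e + N * (c e * Dr e) + m * (κ * (L * M) * w e) ∎
        where
        Z = N * N * c₀ * w e
        0≤Z : 0ℚ ≤ Z
        0≤Z = 0≤* (0≤* (0≤* 0≤N 0≤N) 0≤c₀) (0≤w e)
        lem₁ : ∀ i F Nc ξ N c₀ δ G w → (1ℚ - i) * (F + Nc * ξ + N * N * (c₀ * (δ + G)) * w) + i * (F + N * N * c₀ * w * G)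
          ≡ F + N * N * c₀ * w * G + (Nc * ((1ℚ - i) * ξ) + N * N * c₀ * w * ((1ℚ - i) * δ))
        lem₁ = solve-∀ ℚ-ring
        lem₂ : ∀ Q F Z G N c D T → Q * (F + Z * G) + (N * c * D + Z * T) ≡ Q * F + N * (c * D) + Z * (T + Q * G)
        lem₂ = solve-∀ ℚ-ring
        lem₃ : ∀ Z R m → Z * ((+ 4 / 1) * R * (m * m) + (+ 4 / 1) * R * (m * m)) ≡ Z * ((+ 8 / 1) * R * m) * m
        lem₃ = solve-∀ ℚ-ring
        lem₄ : ∀ N R L w m M → N * N * ((+ 5 / 1) * (R * R) * L) * w * ((+ 8 / 1) * R * m) * M
          ≡ m * ((+ 40 / 1) * (N * N) * (R * R * R) * (L * M) * w)
        lem₄ = solve-∀ ℚ-ring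

      Y V : ℚ
      Y = ∑ E y
      V = ∑ E (λ e → x e * x e)

      ∑x≡0 : ∑ E x ≡ 0ℚ
      ∑x≡0 = trans (∑-- E d (λ _ → m)) (trans (cong₂ _-_ (trans ∑d≡R*Q (sym Am≡RQ)) (∑-const E m))
        (ℚₚ.+-inverseʳ (A * m)))

      ∑d²≡ : ∑ E (λ e → d e * d e) ≡ A * (m * m) + V
      ∑d²≡ = begin-equality
        ∑ E (λ e → d e * d e)                                  ≡⟨ ∑-cong E (λ {e} _ → lem (d e) m) ⟩
        ∑ E (λ e → m * m + (2ℚ * m * x e + x e * x e))
          ≡⟨ trans (∑-+ E (λ _ → m * m) (λ e → 2ℚ * m * x e + x e * x e))
             (cong₂ _+_ (∑-const E (m * m)) (trans (∑-+ E (λ e → 2ℚ * m * x e) (λ e → x e * x e))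
               (cong (_+ V) (trans (∑-*ˡ E (2ℚ * m) x) (cong (2ℚ * m *_) ∑x≡0))))) ⟩
        A * (m * m) + (2ℚ * m * 0ℚ + V)                        ≡⟨ lem′ (A * (m * m)) m V ⟩
        A * (m * m) + V                                        ∎
        where
        lem : ∀ d m → d * d ≡ m * m + (2ℚ * m * (d - m) + (d - m) * (d - m))
        lem = solve-∀ ℚ-ring
        lem′ : ∀ u m V → u + (2ℚ * m * 0ℚ + V) ≡ u + V
        lem′ = solve-∀ ℚ-ring

      V≤ηmY : V ≤ η * m * Y
      V≤ηmY = begin
        V                             ≤⟨ ∑-mono E (λ {e} e∈ → ≤-trans (≤-reflexive (sym (y*y≡x*x e))) (*-monoʳ (0≤y e) (good e∈))) ⟩
        ∑ E (λ e → η * m * y e)       ≡⟨ ∑-*ˡ E (η * m) y ⟩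
        η * m * Y                     ∎

      0≤V : 0ℚ ≤ V
      0≤V = 0≤∑ E (λ {e} _ → 0≤x*x (x e))

      -- Q times the drift of x e is −(R − 1) m (x e) − Z e + err e, where Z e is the pull of the neighbours of e.
      Z err I₀ : I → ℚ
      Z e   = W e - d e * d e - (R - 1ℚ) * m * d e
      err e = Dr e + (R - 1ℚ) * m * x e + Z e
      I₀ e  = ∑ H (λ K → i e K * (Δ K - m))

      ∣I₀∣≤ : ∀ {e} → e ∈ E → ∣ I₀ e ∣ ≤ (+ 4 / 1) * R * (m * m)
      ∣I₀∣≤ {e} e∈ = begin
        ∣ I₀ e ∣                              ≤⟨ ∣∑∣≤ H (λ K → i e K * (Δ K - m)) ⟩
        ∑ H (λ K → ∣ i e K * (Δ K - m) ∣)     ≤⟨ ∑-mono H (λ {K} K∈ → ≤-trans (≤-reflexive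
                                                   (trans (∣p*q∣≡∣p∣*∣q∣ (i e K) (Δ K - m))
                                                     (cong (_* ∣ Δ K - m ∣) (0≤p⇒∣p∣≡p (0≤i e K)))))
                                                 (*-monoˡ (0≤i e K) (∣Δ-m∣≤2Rm K∈))) ⟩
        ∑ H (λ K → i e K * (2ℚ * R * m))      ≡⟨ ∑-*ʳ H (2ℚ * R * m) (i e) ⟩
        d e * (2ℚ * R * m)                    ≤⟨ *-monoʳ 0≤2Rm (d≤2m e∈) ⟩
        2ℚ * m * (2ℚ * R * m)                 ≡⟨ lem′ R m ⟩
        (+ 4 / 1) * R * (m * m)               ∎
        where
        lem′ : ∀ R m → 2ℚ * m * (2ℚ * R * m) ≡ (+ 4 / 1) * R * (m * m)
        lem′ = solve-∀ ℚ-ring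

      Dr≡ : ∀ e → Dr e ≡ R * a′ * (∑ H Δ - Q * m - I₀ e) - T e
      Dr≡ e = begin-equality
        Dr e
          ≡⟨ ∑-cong H (λ {K} _ → lem (i e K) (R * a′) (Δ K) m (δ e K)) ⟩
        ∑ H (λ K → R * a′ * (Δ K - m - i e K * (Δ K - m)) - (1ℚ - i e K) * δ e K)
          ≡⟨ ∑-- H (λ K → R * a′ * (Δ K - m - i e K * (Δ K - m))) (λ K → (1ℚ - i e K) * δ e K) ⟩
        ∑ H (λ K → R * a′ * (Δ K - m - i e K * (Δ K - m))) - T e
          ≡⟨ cong (_- T e) (trans (∑-*ˡ H (R * a′) (λ K → Δ K - m - i e K * (Δ K - m))) (cong (R * a′ *_)
               (trans (∑-- H (λ K → Δ K - m) (λ K → i e K * (Δ K - m)))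
                 (cong (_- I₀ e) (trans (∑-- H Δ (λ _ → m)) (cong (λ z → ∑ H Δ - z) (∑-const H m))))))) ⟩
        R * a′ * (∑ H Δ - Q * m - I₀ e) - T e ∎
        where
        lem : ∀ i k D m δ → (1ℚ - i) * (k * (D - m) - δ) ≡ k * (D - m - i * (D - m)) - (1ℚ - i) * δ
        lem = solve-∀ ℚ-ring

      err≡ : ∀ e → err e ≡ (W e - d e * d e - T e) + R * a′ * (∑ H Δ - Q * m - I₀ e) - (R - 1ℚ) * (m * m)
      err≡ e = trans (cong (λ z → z + (R - 1ℚ) * m * x e + Z e) (Dr≡ e))
        (lem (R * a′ * (∑ H Δ - Q * m - I₀ e)) (T e) R m (d e) (W e))
        where
        lem : ∀ k T R m d W → k - T + (R - 1ℚ) * m * (d - m) + (W - d * d - (R - 1ℚ) * m * d)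
          ≡ (W - d * d - T) + k - (R - 1ℚ) * (m * m)
        lem = solve-∀ ℚ-ring

      -- The expected loss of a typical degree and that of the average degree both have leading term
      -- (R - 1) m² (times 1/Q). After cancellation there remain a term of relative order `a′` and
      -- the variance `V` of the degrees.
      main-terms-cancel : R * a′ * (A * (m * m) + V - Q * m) - (R - 1ℚ) * (m * m) ≡ (R - 1ℚ) * (R * (a′ * m) * m) + R * a′ * V
      main-terms-cancel = begin-equality
        R * a′ * (A * (m * m) + V - Q * m) - (R - 1ℚ) * (m * m)                      ≡⟨ lem₁ R a′ A m V Q ⟩
        R * (m * m) * (A * a′) + R * a′ * V - a′ * m * (R * Q) - (R - 1ℚ) * (m * m)
          ≡⟨ cong (λ z → R * (m * m) * (A * a′) + R * a′ * V - a′ * m * z - (R - 1ℚ) * (m * m)) Am≡RQ ⟨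
        R * (m * m) * (A * a′) + R * a′ * V - a′ * m * (A * m) - (R - 1ℚ) * (m * m)  ≡⟨ lem₂ R a′ A m V ⟩
        (R - 1ℚ) * (m * m) * (A * a′) + R * a′ * V - (R - 1ℚ) * (m * m)
          ≡⟨ cong (λ z → (R - 1ℚ) * (m * m) * z + R * a′ * V - (R - 1ℚ) * (m * m)) Aa′≡ ⟩
        (R - 1ℚ) * (m * m) * (1ℚ + R * a′) + R * a′ * V - (R - 1ℚ) * (m * m)         ≡⟨ lem₃ R a′ m V ⟩
        (R - 1ℚ) * (R * (a′ * m) * m) + R * a′ * V                                   ∎
        where
        lem₁ : ∀ R a A m V Q → R * a * (A * (m * m) + V - Q * m) - (R - 1ℚ) * (m * m)
          ≡ R * (m * m) * (A * a) + R * a * V - a * m * (R * Q) - (R - 1ℚ) * (m * m)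
        lem₁ = solve-∀ ℚ-ring
        lem₂ : ∀ R a A m V → R * (m * m) * (A * a) + R * a * V - a * m * (A * m) - (R - 1ℚ) * (m * m)
          ≡ (R - 1ℚ) * (m * m) * (A * a) + R * a * V - (R - 1ℚ) * (m * m)
        lem₂ = solve-∀ ℚ-ring
        lem₃ : ∀ R a m V → (R - 1ℚ) * (m * m) * (1ℚ + R * a) + R * a * V - (R - 1ℚ) * (m * m)
          ≡ (R - 1ℚ) * (R * (a * m) * m) + R * a * V
        lem₃ = solve-∀ ℚ-ring

      RRLm : ℚ
      RRLm = R * R * L * m

      0≤RRLm : 0ℚ ≤ RRLm
      0≤RRLm = 0≤* (0≤* (0≤x*x R) 0≤L) 0≤m

      Ra′∣I₀∣≤ : ∀ {e} → e ∈ E → R * a′ * ∣ I₀ e ∣ ≤ (+ 8 / 1) * RRLm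
      Ra′∣I₀∣≤ {e} e∈ = begin
        R * a′ * ∣ I₀ e ∣                          ≤⟨ *-monoˡ 0≤Ra′ (∣I₀∣≤ e∈) ⟩
        R * a′ * ((+ 4 / 1) * R * (m * m))         ≡⟨ lem R a′ m ⟩
        (+ 4 / 1) * (R * R) * m * (a′ * m)         ≤⟨ *-monoˡ (0≤* (0≤* (0≤lit (+ 4 / 1)) (0≤x*x R)) 0≤m) a′m≤2L ⟩
        (+ 4 / 1) * (R * R) * m * (2ℚ * L)         ≡⟨ lem′ R m L ⟩
        (+ 8 / 1) * RRLm                           ∎
        where
        lem : ∀ R a m → R * a * ((+ 4 / 1) * R * (m * m)) ≡ (+ 4 / 1) * (R * R) * m * (a * m)
        lem = solve-∀ ℚ-ring
        lem′ : ∀ R m L → (+ 4 / 1) * (R * R) * m * (2ℚ * L) ≡ (+ 8 / 1) * (R * R * L * m)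
        lem′ = solve-∀ ℚ-ring

      [RL+RRL]d≤ : ∀ {e} → e ∈ E → (R * L + R * R * L) * d e ≤ (+ 4 / 1) * RRLm
      [RL+RRL]d≤ {e} e∈ = begin
        (R * L + R * R * L) * d e              ≤⟨ *-mono (0≤d e) (0≤+ 0≤RRL 0≤RRL) (+-monoˡ-≤ (R * R * L) RL≤) (d≤2m e∈) ⟩
        (R * R * L + R * R * L) * (2ℚ * m)     ≡⟨ lem R L m ⟩
        (+ 4 / 1) * RRLm                       ∎
        where
        0≤RRL : 0ℚ ≤ R * R * L
        0≤RRL = 0≤* (0≤x*x R) 0≤L
        RL≤ : R * L ≤ R * R * L
        RL≤ = ≤-trans (≤-reflexive (sym (cong (_* L) (*-identityˡ R)))) (*-monoʳ 0≤L (*-monoʳ 0≤R 1≤R))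
        lem : ∀ R L m → (R * R * L + R * R * L) * (2ℚ * m) ≡ (+ 4 / 1) * (R * R * L * m)
        lem = solve-∀ ℚ-ring

      0≤R-1 : 0ℚ ≤ R - 1ℚ
      0≤R-1 = p≤q⇒0≤q-p 1≤R

      0≤Ra′m : 0ℚ ≤ R * (a′ * m)
      0≤Ra′m = 0≤* 0≤R (0≤* 0≤a′ 0≤m)

      0≤second-order : 0ℚ ≤ (R - 1ℚ) * (R * (a′ * m) * m) + R * a′ * V
      0≤second-order = 0≤+ (0≤* 0≤R-1 (0≤* 0≤Ra′m 0≤m)) (0≤* 0≤Ra′ 0≤V)

      -- The variance is estimated by η m Y with the first absolute moment `Y` kept explicit,
      -- because `Y` times the sum of the odd powers can be returned to `Φ`, with the small factor η
      -- in front.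
      error-bound : ℚ
      error-bound = (+ 16 / 1) * RRLm + 2ℚ * R * η * m * (a * Y)

      0≤Y : 0ℚ ≤ Y
      0≤Y = 0≤∑ E (λ {e} _ → 0≤y e)

      0≤YTerm : 0ℚ ≤ 2ℚ * R * η * m * (a * Y)
      0≤YTerm = 0≤* (0≤* (0≤* (0≤* 0≤2 0≤R) 0≤η) 0≤m) (0≤* 0≤a 0≤Y)

      second-order≤ : (R - 1ℚ) * (R * (a′ * m) * m) + R * a′ * V ≤ 2ℚ * RRLm + 2ℚ * R * η * m * (a * Y)
      second-order≤ = +-mono-≤ (begin
          (R - 1ℚ) * (R * (a′ * m) * m)      ≤⟨ *-mono (0≤* 0≤Ra′m 0≤m) 0≤R R-1≤R (*-monoʳ 0≤m (*-monoˡ 0≤R a′m≤2L)) ⟩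
          R * (R * (2ℚ * L) * m)             ≡⟨ lem R L m ⟩
          2ℚ * RRLm                          ∎)
        (begin
          R * a′ * V                         ≤⟨ *-mono 0≤V (0≤* 0≤R (0≤* 0≤2 0≤a)) (*-monoˡ 0≤R a′≤2a) V≤ηmY ⟩
          R * (2ℚ * a) * (η * m * Y)         ≡⟨ lem′ R a η m Y ⟩
          2ℚ * R * η * m * (a * Y)           ∎)
        where
        R-1≤R : R - 1ℚ ≤ R
        R-1≤R = ≤-by 1ℚ 0≤1 (lem″ R)
          where
          lem″ : ∀ R → R - 1ℚ + 1ℚ ≡ R
          lem″ = solve-∀ ℚ-ring
        lem : ∀ R L m → R * (R * (2ℚ * L) * m) ≡ 2ℚ * (R * R * L * m)
        lem = solve-∀ ℚ-ring
        lem′ : ∀ R a η m Y → R * (2ℚ * a) * (η * m * Y) ≡ 2ℚ * R * η * m * (a * Y)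
        lem′ = solve-∀ ℚ-ring

      err≤ : ∀ {e} → e ∈ E → err e ≤ error-bound
      err≤ {e} e∈ = begin
        err e
          ≡⟨ err≡ e ⟩
        (W e - d e * d e - T e) + R * a′ * (∑ H Δ - Q * m - I₀ e) - (R - 1ℚ) * (m * m)
          ≤⟨ +-monoˡ-≤ (- ((R - 1ℚ) * (m * m))) (+-mono-≤ B≤ (*-monoˡ 0≤Ra′ (+-monoˡ-≤ (- I₀ e)
               (+-monoˡ-≤ (- (Q * m)) (≤-trans ∑Δ≤∑d² (≤-reflexive ∑d²≡)))))) ⟩
        (+ 4 / 1) * RRLm + R * a′ * (A * (m * m) + V - Q * m - I₀ e) - (R - 1ℚ) * (m * m)
          ≡⟨ lem₁ ((+ 4 / 1) * RRLm) (R * a′) (A * (m * m) + V - Q * m) (I₀ e) ((R - 1ℚ) * (m * m)) ⟩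
        (+ 4 / 1) * RRLm + (R * a′ * (A * (m * m) + V - Q * m) - (R - 1ℚ) * (m * m)) + R * a′ * (- I₀ e)
          ≡⟨ cong (λ z → (+ 4 / 1) * RRLm + z + R * a′ * (- I₀ e)) main-terms-cancel ⟩
        (+ 4 / 1) * RRLm + ((R - 1ℚ) * (R * (a′ * m) * m) + R * a′ * V) + R * a′ * (- I₀ e)
          ≤⟨ +-mono-≤ (+-monoʳ-≤ ((+ 4 / 1) * RRLm) second-order≤)
               (≤-trans (*-monoˡ 0≤Ra′ (≤-trans (p≤∣p∣ (- I₀ e)) (≤-reflexive (ℚₚ.∣-p∣≡∣p∣ (I₀ e))))) (Ra′∣I₀∣≤ e∈)) ⟩
        (+ 4 / 1) * RRLm + (2ℚ * RRLm + 2ℚ * R * η * m * (a * Y)) + (+ 8 / 1) * RRLm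
          ≤⟨ ≤-by (2ℚ * RRLm) (0≤* 0≤2 0≤RRLm) (lem₂ RRLm (2ℚ * R * η * m * (a * Y))) ⟩
        error-bound ∎
        where
        B≤ : W e - d e * d e - T e ≤ (+ 4 / 1) * RRLm
        B≤ = ≤-trans (≤-trans (+-monoˡ-≤ (- T e) (W-d²≤T e∈)) (≤-reflexive (lem (T e) ((R * L + R * R * L) * d e))))
          ([RL+RRL]d≤ e∈)
          where
          lem : ∀ T u → T + u - T ≡ u
          lem = solve-∀ ℚ-ring
        lem₁ : ∀ u k S I v → u + k * (S - I) - v ≡ u + (k * S - v) + k * (- I)
        lem₁ = solve-∀ ℚ-ring
        lem₂ : ∀ u v → (+ 4 / 1) * u + (2ℚ * u + v) + (+ 8 / 1) * u + 2ℚ * u ≡ (+ 16 / 1) * u + v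
        lem₂ = solve-∀ ℚ-ring

      -err≤ : ∀ {e} → e ∈ E → - err e ≤ error-bound
      -err≤ {e} e∈ = begin
        - err e
          ≡⟨ cong -_ (err≡ e) ⟩
        - ((W e - d e * d e - T e) + R * a′ * (∑ H Δ - Q * m - I₀ e) - (R - 1ℚ) * (m * m))
          ≡⟨ lem₀ (W e - d e * d e - T e) (R * a′) (∑ H Δ) (Q * m) (I₀ e) ((R - 1ℚ) * (m * m)) ⟩
        R * a′ * (- ∑ H Δ) + (- (W e - d e * d e - T e) + (R * a′ * (Q * m + I₀ e) + (R - 1ℚ) * (m * m)))
          ≤⟨ +-mono-≤ (*-monoˡ 0≤Ra′ -∑Δ≤) (+-monoˡ-≤ (R * a′ * (Q * m + I₀ e) + (R - 1ℚ) * (m * m))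
               (neg-antimono-≤ (p≤q⇒0≤q-p (T≤W-d² e∈)))) ⟩
        R * a′ * (Q * (R * R * L) - (A * (m * m) + V)) + (0ℚ + (R * a′ * (Q * m + I₀ e) + (R - 1ℚ) * (m * m)))
          ≡⟨ lem₁ (R * a′) (Q * (R * R * L)) (A * (m * m) + V) (Q * m) (I₀ e) ((R - 1ℚ) * (m * m)) ⟩
        R * a′ * (Q * (R * R * L)) - (R * a′ * (A * (m * m) + V - Q * m) - (R - 1ℚ) * (m * m)) + R * a′ * I₀ e
          ≡⟨ cong (λ z → R * a′ * (Q * (R * R * L)) - z + R * a′ * I₀ e) main-terms-cancel ⟩
        R * a′ * (Q * (R * R * L)) - ((R - 1ℚ) * (R * (a′ * m) * m) + R * a′ * V) + R * a′ * I₀ e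
          ≤⟨ +-mono-≤ (+-mono-≤ ε₂≤ (neg-antimono-≤ 0≤second-order))
               (≤-trans (*-monoˡ 0≤Ra′ (p≤∣p∣ (I₀ e))) (Ra′∣I₀∣≤ e∈)) ⟩
        2ℚ * RRLm - 0ℚ + (+ 8 / 1) * RRLm
          ≤⟨ ≤-by ((+ 6 / 1) * RRLm + 2ℚ * R * η * m * (a * Y)) (0≤+ (0≤* (0≤lit (+ 6 / 1)) 0≤RRLm) 0≤YTerm)
               (lem₂ RRLm (2ℚ * R * η * m * (a * Y))) ⟩
        error-bound ∎
        where
        lem₀ : ∀ B k D q I v → - (B + k * (D - q - I) - v) ≡ k * (- D) + (- B + (k * (q + I) + v))
        lem₀ = solve-∀ ℚ-ring
        -∑Δ≤ : - ∑ H Δ ≤ Q * (R * R * L) - (A * (m * m) + V)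
        -∑Δ≤ = ≤-trans (≤-by (∑ H Δ + Q * (R * R * L) - ∑ E (λ f → d f * d f)) (p≤q⇒0≤q-p ∑d²≤∑Δ+QR²L)
            (lem (∑ H Δ) (Q * (R * R * L)) (∑ E (λ f → d f * d f)))) (≤-reflexive (cong (λ z → Q * (R * R * L) - z) ∑d²≡))
          where
          lem : ∀ D u S → - D + (D + u - S) ≡ u - S
          lem = solve-∀ ℚ-ring
        lem₁ : ∀ k u S q I v → k * (u - S) + (0ℚ + (k * (q + I) + v)) ≡ k * u - (k * (S - q) - v) + k * I
        lem₁ = solve-∀ ℚ-ring
        lem₂ : ∀ u v → 2ℚ * u - 0ℚ + (+ 8 / 1) * u + ((+ 6 / 1) * u + v) ≡ (+ 16 / 1) * u + v
        lem₂ = solve-∀ ℚ-ring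
        ε₂≤ : R * a′ * (Q * (R * R * L)) ≤ 2ℚ * RRLm
        ε₂≤ = begin
          R * a′ * (Q * (R * R * L))      ≡⟨ lem R a′ Q L ⟩
          R * Q * (a′ * (R * R * L))      ≡⟨ cong (_* (a′ * (R * R * L))) Am≡RQ ⟨
          A * m * (a′ * (R * R * L))      ≡⟨ lem′ A m a′ (R * R * L) ⟩
          R * R * L * m * (A * a′)        ≤⟨ *-monoˡ 0≤RRLm Aa′≤2 ⟩
          R * R * L * m * 2ℚ              ≡⟨ *-comm RRLm 2ℚ ⟩
          2ℚ * RRLm                       ∎
          where
          lem : ∀ R a Q L → R * a * (Q * (R * R * L)) ≡ R * Q * (a * (R * R * L))
          lem = solve-∀ ℚ-ring
          lem′ : ∀ A m a u → A * m * (a * u) ≡ u * m * (A * a)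
          lem′ = solve-∀ ℚ-ring

      ∣err∣≤ : ∀ {e} → e ∈ E → ∣ err e ∣ ≤ error-bound
      ∣err∣≤ e∈ = ∣p∣≤ (err≤ e∈) (-err≤ e∈)

      ∣c∣≡C : ∀ e → ∣ c e ∣ ≡ C e
      ∣c∣≡C e = trans (∣p*q∣≡∣p∣*∣q∣ (x e) (t e)) (cong (y e *_) (0≤p⇒∣p∣≡p (0≤t e)))

      c*err≤ : ∀ {e} → e ∈ E → c e * err e ≤ C e * error-bound
      c*err≤ {e} e∈ = begin
        c e * err e            ≤⟨ p≤∣p∣ (c e * err e) ⟩
        ∣ c e * err e ∣         ≡⟨ trans (∣p*q∣≡∣p∣*∣q∣ (c e) (err e)) (cong (_* ∣ err e ∣) (∣c∣≡C e)) ⟩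
        C e * ∣ err e ∣         ≤⟨ *-monoˡ (0≤C e) (∣err∣≤ e∈) ⟩
        C e * error-bound      ∎

      Φ ∑C : ℚ
      Φ  = ∑ E F
      ∑C = ∑ E C

      0≤Φ : 0ℚ ≤ Φ
      0≤Φ = 0≤∑ E (λ {e} _ → 0≤F e)

      -- The identity behind Chebyshev's sum inequality.
      symmetric-sum : ∀ (u v : I → ℚ) → ∑ E (λ e → ∑ E (λ f → (u e - u f) * (v e - v f)))
        ≡ 2ℚ * (A * ∑ E (λ e → u e * v e)) - 2ℚ * (∑ E u * ∑ E v)
      symmetric-sum u v = begin-equality
        ∑ E (λ e → ∑ E (λ f → (u e - u f) * (v e - v f)))
          ≡⟨ ∑-cong E (λ {e} _ → trans (∑-cong E (λ {f} _ → lem (u e) (u f) (v e) (v f)))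
               (trans (∑-- E (λ f → u e * v e + u f * v f) (λ f → u e * v f + v e * u f))
                 (cong₂ _-_ (trans (∑-+ E (λ _ → u e * v e) (λ f → u f * v f)) (cong (_+ UV) (∑-const E (u e * v e))))
                   (trans (∑-+ E (λ f → u e * v f) (λ f → v e * u f)) (cong₂ _+_ (∑-*ˡ E (u e) v) (∑-*ˡ E (v e) u)))))) ⟩
        ∑ E (λ e → A * (u e * v e) + UV - (u e * ∑ E v + v e * ∑ E u))
          ≡⟨ trans (∑-- E (λ e → A * (u e * v e) + UV) (λ e → u e * ∑ E v + v e * ∑ E u))
               (cong₂ _-_ (trans (∑-+ E (λ e → A * (u e * v e)) (λ _ → UV))
                   (cong₂ _+_ (∑-*ˡ E A (λ e → u e * v e)) (∑-const E UV)))
                 (trans (∑-+ E (λ e → u e * ∑ E v) (λ e → v e * ∑ E u)) (cong₂ _+_ (∑-*ʳ E (∑ E v) u) (∑-*ʳ E (∑ E u) v)))) ⟩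
        A * UV + A * UV - (∑ E u * ∑ E v + ∑ E v * ∑ E u)
          ≡⟨ lem′ (A * UV) (∑ E u) (∑ E v) ⟩
        2ℚ * (A * UV) - 2ℚ * (∑ E u * ∑ E v) ∎
        where
        UV = ∑ E (λ e → u e * v e)
        lem : ∀ a b c d → (a - b) * (c - d) ≡ a * c + b * d - (a * d + c * b)
        lem = solve-∀ ℚ-ring
        lem′ : ∀ a u v → a + a - (u * v + v * u) ≡ 2ℚ * a - 2ℚ * (u * v)
        lem′ = solve-∀ ℚ-ring

      -- Chebyshev's sum inequality for the similarly ordered families |x e| and |x e|^(q-1), whose
      -- products are the summands of `Φ`.
      a*Y*∑C≤Φ : a * Y * ∑C ≤ Φ
      a*Y*∑C≤Φ = begin
        a * Y * ∑C      ≡⟨ lem a Y ∑C ⟩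
        a * (∑C * Y)    ≤⟨ *-monoˡ 0≤a ∑C*Y≤AΦ ⟩
        a * (A * Φ)     ≡⟨ lem′ a A Φ ⟩
        A * a * Φ       ≡⟨ cong (_* Φ) Aa≡1 ⟩
        1ℚ * Φ          ≡⟨ *-identityˡ Φ ⟩
        Φ               ∎
        where
        lem : ∀ a Y C → a * Y * C ≡ a * (C * Y)
        lem = solve-∀ ℚ-ring
        lem′ : ∀ a A F → a * (A * F) ≡ A * a * F
        lem′ = solve-∀ ℚ-ring
        pointwise : ∀ e f → 0ℚ ≤ (C e - C f) * (y e - y f)
        pointwise e f = ≤-trans (odd-power-difference j (y e) (y f)) (≤-reflexive
          (cong (_* (y e - y f)) (cong₂ (λ u v → y e * u ^ j - y f * v ^ j) (y*y≡x*x e) (y*y≡x*x f))))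
        ∑Cy≡Φ : ∑ E (λ e → C e * y e) ≡ Φ
        ∑Cy≡Φ = ∑-cong E (λ {e} _ → trans (lem″ (y e) (t e)) (cong (_* t e) (y*y≡x*x e)))
          where
          lem″ : ∀ y t → y * t * y ≡ y * y * t
          lem″ = solve-∀ ℚ-ring
        ∑C*Y≤AΦ : ∑C * Y ≤ A * Φ
        ∑C*Y≤AΦ = 0≤q-p⇒p≤q (0≤2*p⇒0≤p (≤-trans (0≤∑ E (λ {e} _ → 0≤∑ E (λ {f} _ → pointwise e f)))
          (≤-reflexive (trans (symmetric-sum C y) (trans (cong (λ z → 2ℚ * (A * z) - 2ℚ * (∑C * Y)) ∑Cy≡Φ)
            (lem‴ (A * Φ) (∑C * Y)))))))
          where
          lem‴ : ∀ a b → 2ℚ * a - 2ℚ * b ≡ 2ℚ * (a - b)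
          lem‴ = solve-∀ ℚ-ring

      sx SC SF : J → ℚ
      sx K = ∑ E (λ f → i f K * x f)
      SC K = ∑ E (λ f → i f K * c f)
      SF K = ∑ E (λ f → i f K * F f)

      P : I → ℚ
      P e = ∑ H (λ K → i e K * sx K)

      -- Splitting each degree in `W e` as m plus a deviation, the part with m cancels. What is left
      -- is the sum of `x f` over the neighbours f of `e` with multiplicity: `P e` without its terms
      -- f = e.
      Z≡ : ∀ e → Z e ≡ P e - d e * x e
      Z≡ e = trans (cong (λ z → z - d e * d e - (R - 1ℚ) * m * d e) W≡) (lem R m (d e) (P e))
        where
        sd≡ : ∀ {K} → K ∈ H → sd K ≡ R * m + sx K
        sd≡ {K} K∈ = trans (∑-cong E (λ {f} _ → lem₁ (i f K) (d f) m))
          (trans (∑-+ E (λ f → i f K * m) (λ f → i f K * x f))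
            (cong (_+ sx K) (trans (∑-*ʳ E m (λ f → i f K)) (cong (_* m) (uniform K∈)))))
          where
          lem₁ : ∀ i d m → i * d ≡ i * m + i * (d - m)
          lem₁ = solve-∀ ℚ-ring
        W≡ : W e ≡ d e * (R * m) + P e
        W≡ = trans (∑-cong H (λ {K} K∈ → trans (cong (i e K *_) (sd≡ K∈)) (ℚₚ.*-distribˡ-+ (i e K) (R * m) (sx K))))
          (trans (∑-+ H (λ K → i e K * (R * m)) (λ K → i e K * sx K)) (cong (_+ P e) (∑-*ʳ H (R * m) (i e))))
        lem : ∀ R m d P → d * (R * m) + P - d * d - (R - 1ℚ) * m * d ≡ P - d * (d - m)
        lem = solve-∀ ℚ-ring

      ∑dF ∑CX : ℚ
      ∑dF = ∑ E (λ e → d e * F e)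
      ∑CX = ∑ H (λ K → SC K * sx K)

      ∑SF≡∑dF : ∑ H SF ≡ ∑dF
      ∑SF≡∑dF = trans (∑-swap H E (λ K f → i f K * F f)) (∑-cong E (λ {f} _ → ∑-*ʳ H (F f) (i f)))

      ∑cZ≡ : ∑ E (λ e → c e * Z e) ≡ ∑CX - ∑dF
      ∑cZ≡ = trans (∑-cong E (λ {e} _ → trans (cong (c e *_) (Z≡ e)) (lem (x e) (t e) (P e) (d e))))
        (trans (∑-- E (λ e → c e * P e) (λ e → d e * F e)) (cong (_- ∑dF) ∑cP≡))
        where
        lem : ∀ x t P d → x * t * (P - d * x) ≡ x * t * P - d * (x * x * t)
        lem = solve-∀ ℚ-ring
        lem′ : ∀ c i s → c * (i * s) ≡ i * c * s
        lem′ = solve-∀ ℚ-ring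
        ∑cP≡ : ∑ E (λ e → c e * P e) ≡ ∑CX
        ∑cP≡ = trans (∑-cong E (λ {e} _ → sym (∑-*ˡ H (c e) (λ K → i e K * sx K))))
          (trans (∑-swap E H (λ e K → c e * (i e K * sx K)))
          (∑-cong H (λ {K} _ → trans (∑-cong E (λ {e} _ → lem′ (c e) (i e K) (sx K))) (∑-*ʳ E (sx K) (λ e → i e K * c e)))))

      -- Off-diagonal pairs contribute (c e + c f)(x e + x f) ≥ 0, since c is an odd power of x.
      neighbours-pull : ∀ {K} → K ∈ H → 2ℚ * SF K ≤ R * SF K + SC K * sx K
      neighbours-pull {K} K∈ = 0≤q-p⇒p≤q (0≤2*p⇒0≤p (begin
        0ℚ
          ≤⟨ 0≤∑ E (λ {e} _ → 0≤∑ E (λ {f} _ → 0≤* (0≤1-eq e f) (0≤* (0≤* (0≤i e K) (0≤i f K)) (odd-power-sum j (x e) (x f))))) ⟩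
        ∑ E (λ e → ∑ E (λ f → (1ℚ - eq e f) * φ e f))
          ≡⟨ off-diagonal φ ⟩
        ∑ E (λ e → ∑ E (φ e)) - ∑ E (λ e → φ e e)
          ≡⟨ cong₂ _-_ double diagonal ⟩
        SF K * R + R * SF K + (SC K * sx K + sx K * SC K) - (+ 4 / 1) * SF K
          ≡⟨ lem (SF K) R (SC K) (sx K) ⟩
        2ℚ * (R * SF K + SC K * sx K - 2ℚ * SF K) ∎))
        where
        φ : I → I → ℚ
        φ e f = i e K * i f K * ((c e + c f) * (x e + x f))
        lem : ∀ F R C X → F * R + R * F + (C * X + X * C) - (+ 4 / 1) * F ≡ 2ℚ * (R * F + C * X - 2ℚ * F)
        lem = solve-∀ ℚ-ring
        diagonal : ∑ E (λ e → φ e e) ≡ (+ 4 / 1) * SF K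
        diagonal = trans (∑-cong E (λ {e} _ → trans (cong (_* ((c e + c e) * (x e + x e))) (i*i≡i e K)) (lem′ (i e K) (x e) (t e))))
          (∑-*ˡ E (+ 4 / 1) (λ e → i e K * F e))
          where
          lem′ : ∀ i x t → i * ((x * t + x * t) * (x + x)) ≡ (+ 4 / 1) * (i * (x * x * t))
          lem′ = solve-∀ ℚ-ring
        lem″ : ∀ i j x z s t → i * j * ((x * s + z * t) * (x + z))
          ≡ i * (x * x * s) * j + i * (j * (z * z * t)) + (i * (x * s) * (j * z) + i * x * (j * (z * t)))
        lem″ = solve-∀ ℚ-ring
        double : ∑ E (λ e → ∑ E (φ e)) ≡ SF K * R + R * SF K + (SC K * sx K + sx K * SC K)
        double = trans (∑-cong E (λ {e} _ → trans (∑-cong E (λ {f} _ → lem″ (i e K) (i f K) (x e) (x f) (t e) (t f)))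
            (trans (∑-+ E (λ f → i e K * F e * i f K + i e K * (i f K * F f)) (λ f → i e K * c e * (i f K * x f) + i e K * x e * (i f K * c f)))
              (cong₂ _+_
                (trans (∑-+ E (λ f → i e K * F e * i f K) (λ f → i e K * (i f K * F f)))
                  (cong₂ _+_ (trans (∑-*ˡ E (i e K * F e) (λ f → i f K)) (cong (i e K * F e *_) (uniform K∈)))
                             (∑-*ˡ E (i e K) (λ f → i f K * F f))))
                (trans (∑-+ E (λ f → i e K * c e * (i f K * x f)) (λ f → i e K * x e * (i f K * c f)))
                  (cong₂ _+_ (∑-*ˡ E (i e K * c e) (λ f → i f K * x f)) (∑-*ˡ E (i e K * x e) (λ f → i f K * c f))))))))
          (trans (∑-+ E (λ e → i e K * F e * R + i e K * SF K) (λ e → i e K * c e * sx K + i e K * x e * SC K))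
            (cong₂ _+_
              (trans (∑-+ E (λ e → i e K * F e * R) (λ e → i e K * SF K))
                (cong₂ _+_ (∑-*ʳ E R (λ e → i e K * F e)) (trans (∑-*ʳ E (SF K) (λ e → i e K)) (cong (_* SF K) (uniform K∈)))))
              (trans (∑-+ E (λ e → i e K * c e * sx K) (λ e → i e K * x e * SC K))
                (cong₂ _+_ (∑-*ʳ E (sx K) (λ e → i e K * c e)) (∑-*ʳ E (SC K) (λ e → i e K * x e))))))

      -- Summing `neighbours-pull` over the hyperedges bounds the pull by (R - 1) times the
      -- degree-weighted moment; since every degree is at most (1 + η) m, this is the size of the
      -- contraction up to the factor 1 + η.
      -∑cZ≤ : - ∑ E (λ e → c e * Z e) ≤ (R - 1ℚ) * ((m + η * m) * Φ)
      -∑cZ≤ = begin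
        - ∑ E (λ e → c e * Z e)                       ≡⟨ cong -_ ∑cZ≡ ⟩
        - (∑CX - ∑dF)                                 ≡⟨ lem ∑CX ∑dF R ⟩
        (R * ∑dF - ∑dF) - (R * ∑dF + ∑CX - 2ℚ * ∑dF)   ≤⟨ +-monoʳ-≤ (R * ∑dF - ∑dF) (neg-antimono-≤ (p≤q⇒0≤q-p pull)) ⟩
        (R * ∑dF - ∑dF) - 0ℚ                          ≡⟨ lem′ R ∑dF ⟩
        (R - 1ℚ) * ∑dF                                ≤⟨ *-monoˡ 0≤R-1 (≤-trans (∑-mono E (λ {e} e∈ → *-monoʳ (0≤F e) (d≤m+ηm e∈)))
                                                          (≤-reflexive (∑-*ˡ E (m + η * m) F))) ⟩
        (R - 1ℚ) * ((m + η * m) * Φ)                  ∎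
        where
        lem : ∀ C D R → - (C - D) ≡ (R * D - D) - (R * D + C - 2ℚ * D)
        lem = solve-∀ ℚ-ring
        lem′ : ∀ R D → (R * D - D) - 0ℚ ≡ (R - 1ℚ) * D
        lem′ = solve-∀ ℚ-ring
        pull : 2ℚ * ∑dF ≤ R * ∑dF + ∑CX
        pull = begin
          2ℚ * ∑dF                                ≡⟨ trans (∑-*ˡ H 2ℚ SF) (cong (2ℚ *_) ∑SF≡∑dF) ⟨
          ∑ H (λ K → 2ℚ * SF K)                   ≤⟨ ∑-mono H neighbours-pull ⟩
          ∑ H (λ K → R * SF K + SC K * sx K)      ≡⟨ ∑-+ H (λ K → R * SF K) (λ K → SC K * sx K) ⟩
          ∑ H (λ K → R * SF K) + ∑CX              ≡⟨ cong (_+ ∑CX) (trans (∑-*ˡ H R SF) (cong (R *_) ∑SF≡∑dF)) ⟩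
          R * ∑dF + ∑CX                           ∎

      -- The contraction (R - 1) m Φ cancels against the worst pull of the neighbours, leaving less
      -- than R η m Φ. The variance term in `error-bound` adds 2 R η m Φ, hence the 3; the term with
      -- ∑C goes into the noise.
      ∑c*Dr≤ : ∑ E (λ e → c e * Dr e) ≤ (+ 3 / 1) * R * η * m * Φ + (+ 16 / 1) * RRLm * ∑C
      ∑c*Dr≤ = begin
        ∑ E (λ e → c e * Dr e)
          ≡⟨ ∑-cong E (λ {e} _ → lem (x e) (t e) (Dr e) (R - 1ℚ) m (Z e)) ⟩
        ∑ E (λ e → c e * err e - (R - 1ℚ) * m * F e - c e * Z e)
          ≡⟨ trans (∑-- E (λ e → c e * err e - (R - 1ℚ) * m * F e) (λ e → c e * Z e))
               (cong (_- ∑ E (λ e → c e * Z e)) (trans (∑-- E (λ e → c e * err e) (λ e → (R - 1ℚ) * m * F e))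
                 (cong (λ z → ∑ E (λ e → c e * err e) - z) (∑-*ˡ E ((R - 1ℚ) * m) F)))) ⟩
        ∑ E (λ e → c e * err e) - (R - 1ℚ) * m * Φ - ∑ E (λ e → c e * Z e)
          ≤⟨ +-mono-≤ (+-monoˡ-≤ (- ((R - 1ℚ) * m * Φ)) (≤-trans (∑-mono E c*err≤)
               (≤-reflexive (∑-*ʳ E error-bound C)))) -∑cZ≤ ⟩
        ∑C * error-bound - (R - 1ℚ) * m * Φ + (R - 1ℚ) * ((m + η * m) * Φ)
          ≡⟨ lem₁ ∑C RRLm R η m a Y Φ ⟩
        2ℚ * R * η * m * (a * Y * ∑C) + (R * η * m * Φ - η * m * Φ + (+ 16 / 1) * RRLm * ∑C)
          ≤⟨ +-mono-≤ (*-monoˡ (0≤* (0≤* (0≤* 0≤2 0≤R) 0≤η) 0≤m) a*Y*∑C≤Φ)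
               (≤-by (η * m * Φ) (0≤* (0≤* 0≤η 0≤m) 0≤Φ) (lem₂ (R * η * m * Φ) (η * m * Φ) ((+ 16 / 1) * RRLm * ∑C))) ⟩
        2ℚ * R * η * m * Φ + (R * η * m * Φ + (+ 16 / 1) * RRLm * ∑C)
          ≡⟨ lem₃ R η m Φ ((+ 16 / 1) * RRLm * ∑C) ⟩
        (+ 3 / 1) * R * η * m * Φ + (+ 16 / 1) * RRLm * ∑C ∎
        where
        lem : ∀ x t D r m Z → x * t * D ≡ x * t * (D + r * m * x + Z) - r * m * (x * x * t) - x * t * Z
        lem = solve-∀ ℚ-ring
        lem₁ : ∀ C u R η m a Y F → C * ((+ 16 / 1) * u + 2ℚ * R * η * m * (a * Y)) - (R - 1ℚ) * m * F + (R - 1ℚ) * ((m + η * m) * F)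
          ≡ 2ℚ * R * η * m * (a * Y * C) + (R * η * m * F - η * m * F + (+ 16 / 1) * u * C)
        lem₁ = solve-∀ ℚ-ring
        lem₂ : ∀ u v z → u - v + z + v ≡ u + z
        lem₂ = solve-∀ ℚ-ring
        lem₃ : ∀ R η m F u → 2ℚ * R * η * m * F + (R * η * m * F + u) ≡ (+ 3 / 1) * R * η * m * F + u
        lem₃ = solve-∀ ℚ-ring

      K₁ : ℚ
      K₁ = noise-K₁ j R

      0≤K₁ : 0ℚ ≤ K₁
      0≤K₁ = 0≤* (0≤* (0≤lit (+ 16 / 1)) 0≤N) (0≤x*x R)

      0≤κ : 0ℚ ≤ κ
      0≤κ = 0≤* (0≤* (0≤lit (+ 40 / 1)) (0≤x*x N)) (0≤* (0≤x*x R) 0≤R)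

      0≤K₃ : 0ℚ ≤ K₃
      0≤K₃ = 0≤* (0≤lit (+ 5 / 1)) (0≤x*x R)

      noise : ∑ E (λ e → K₁ * (L * C e) + κ * (L * M) * w e) ≤ ℚ.½ * Φ + A * (step-constant j R * (L * M) ^ (1 ℕ.+ j))
      noise = begin
        ∑ E (λ e → K₁ * (L * C e) + κ * (L * M) * w e)
          ≤⟨ ∑-mono E (λ {e} _ → pointwise e) ⟩
        ∑ E (λ e → ℚ.½ * F e + step-constant j R * (L * M) ^ (1 ℕ.+ j))
          ≡⟨ trans (∑-+ E (λ e → ℚ.½ * F e) (λ _ → step-constant j R * (L * M) ^ (1 ℕ.+ j)))
               (cong₂ _+_ (∑-*ˡ E ℚ.½ F) (∑-const E (step-constant j R * (L * M) ^ (1 ℕ.+ j)))) ⟩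
        ℚ.½ * Φ + A * (step-constant j R * (L * M) ^ (1 ℕ.+ j)) ∎
        where
        pointwise : ∀ e → K₁ * (L * C e) + κ * (L * M) * w e ≤ ℚ.½ * F e + step-constant j R * (L * M) ^ (1 ℕ.+ j)
        pointwise e = subst (λ z → K₁ * (L * (y e * z ^ j)) + κ * (L * M) * w e
            ≤ ℚ.½ * (z * z ^ j) + step-constant j R * (L * M) ^ (1 ℕ.+ j)) (y*y≡x*x e)
          (noise-absorbed j K₁ κ K₃ 0≤K₁ 0≤κ 0≤K₃ 0≤L L≤M (0≤y e))

      -- The gain m Φ consists of two halves: `η-small` reduces the first-order drift to at most m Φ
      -- / 2, and `noise` absorbs the remaining terms into another m Φ / 2 and a constant.
      one-step : ∑ H (λ K → ∑ E (λ e → (1ℚ - i e K) * even-power j (x′ e K)))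
        ≤ Q * Φ + m * (Φ + A * (step-constant j R * (L * M) ^ (1 ℕ.+ j)))
      one-step = begin
        ∑ H (λ K → ∑ E (λ e → (1ℚ - i e K) * even-power j (x′ e K)))
          ≡⟨ ∑-swap H E (λ K e → (1ℚ - i e K) * even-power j (x′ e K)) ⟩
        ∑ E (λ e → ∑ H (λ K → (1ℚ - i e K) * even-power j (x′ e K)))
          ≤⟨ ∑-mono E edge-sum ⟩
        ∑ E (λ e → Q * F e + N * (c e * Dr e) + m * (κ * (L * M) * w e))
          ≡⟨ trans (∑-+ E (λ e → Q * F e + N * (c e * Dr e)) (λ e → m * (κ * (L * M) * w e)))
               (cong₂ _+_ (trans (∑-+ E (λ e → Q * F e) (λ e → N * (c e * Dr e)))
                 (cong₂ _+_ (∑-*ˡ E Q F) (∑-*ˡ E N (λ e → c e * Dr e)))) (∑-*ˡ E m (λ e → κ * (L * M) * w e))) ⟩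
        Q * Φ + N * ∑ E (λ e → c e * Dr e) + m * Ω
          ≤⟨ +-monoˡ-≤ (m * Ω) (+-monoʳ-≤ (Q * Φ) (*-monoˡ 0≤N ∑c*Dr≤)) ⟩
        Q * Φ + N * ((+ 3 / 1) * R * η * m * Φ + (+ 16 / 1) * RRLm * ∑C) + m * Ω
          ≡⟨ lem Q Φ N R η m L ∑C Ω ⟩
        Q * Φ + (m * (ℚ.½ * ((+ 6 / 1) * N * R * η) * Φ) + m * (K₁ * (L * ∑C) + Ω))
          ≤⟨ +-monoʳ-≤ (Q * Φ) (+-mono-≤ (*-monoˡ 0≤m (*-monoʳ 0≤Φ (*-monoˡ (0≤lit ℚ.½) η-small)))
               (*-monoˡ 0≤m (≤-trans (≤-reflexive (sym ∑noise≡)) noise))) ⟩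
        Q * Φ + (m * (ℚ.½ * 1ℚ * Φ) + m * (ℚ.½ * Φ + A * (step-constant j R * (L * M) ^ (1 ℕ.+ j))))
          ≡⟨ lem′ Q Φ m (A * (step-constant j R * (L * M) ^ (1 ℕ.+ j))) ⟩
        Q * Φ + m * (Φ + A * (step-constant j R * (L * M) ^ (1 ℕ.+ j))) ∎
        where
        Ω = ∑ E (λ e → κ * (L * M) * w e)
        lem : ∀ Q F N R η m L C W → Q * F + N * ((+ 3 / 1) * R * η * m * F + (+ 16 / 1) * (R * R * L * m) * C) + m * W
          ≡ Q * F + (m * (ℚ.½ * ((+ 6 / 1) * N * R * η) * F) + m * ((+ 16 / 1) * N * (R * R) * (L * C) + W))
        lem = solve-∀ ℚ-ring
        lem′ : ∀ Q F m u → Q * F + (m * (ℚ.½ * 1ℚ * F) + m * (ℚ.½ * F + u)) ≡ Q * F + m * (F + u)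
        lem′ = solve-∀ ℚ-ring
        ∑noise≡ : ∑ E (λ e → K₁ * (L * C e) + κ * (L * M) * w e) ≡ K₁ * (L * ∑C) + Ω
        ∑noise≡ = trans (∑-+ E (λ e → K₁ * (L * C e)) (λ e → κ * (L * M) * w e))
          (cong (_+ Ω) (trans (∑-*ˡ E K₁ (λ e → L * C e)) (cong (K₁ *_) (∑-*ˡ E L C))))

      Δ≤R[m+ηm] : ∀ {K} → K ∈ H → Δ K ≤ R * (m + η * m)
      Δ≤R[m+ηm] {K} K∈ = begin
        Δ K                                   ≤⟨ Δ≤sd K∈ ⟩
        sd K                                  ≤⟨ ∑-mono E (λ {f} f∈ → *-monoˡ (0≤i f K) (d≤m+ηm f∈)) ⟩
        ∑ E (λ f → i f K * (m + η * m))       ≡⟨ ∑-*ʳ E (m + η * m) (λ f → i f K) ⟩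
        ∑ E (λ f → i f K) * (m + η * m)       ≡⟨ cong (_* (m + η * m)) (uniform K∈) ⟩
        R * (m + η * m)                       ∎

      -- The average degree decreases no faster than A^(r−1+1/q), where q = 2j + 2.
      module _ (r′ : ℕ) (R≡ : R ≡ ι (suc r′)) {τ : ℚ} (0≤τ : 0ℚ ≤ τ) (τ≤1 : τ ≤ 1ℚ)
               (0<1-Ra : 0ℚ < 1ℚ - R * a)
               (Nτ≡Ra : N * τ ≡ R * a)
               (small : N * (R * R * (R * a) + R * τ + R * η) ≤ 1ℚ) where

        private
          q e₀ : ℕ
          q = 2 ℕ.+ (j ℕ.+ j)
          e₀ = suc (r′ ℕ.* q)
          z = R * a
          0≤z : 0ℚ ≤ z
          0≤z = 0≤* 0≤R 0≤a
          0≤1-z : 0ℚ ≤ 1ℚ - z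
          0≤1-z = <⇒≤ 0<1-Ra
          z≤1 : z ≤ 1ℚ
          z≤1 = 0≤q-p⇒p≤q 0≤1-z
          B = 1ℚ - R * (1ℚ + η) * z
          small′ : ι q * (ι (suc r′) * ι (suc r′) * z + ι (suc r′) * τ + ι (suc r′) * η) ≤ 1ℚ
          small′ = subst (λ ρ → N * (ρ * ρ * z + ρ * τ + ρ * η) ≤ 1ℚ) R≡ small
          0≤B : 0ℚ ≤ B
          0≤B = ≤-trans (0≤* (0≤^ (suc r′) 0≤1-z) (p≤q⇒0≤q-p τ≤1))
            (≤-trans ([1-z]^r*[1-t]≤ (suc r′) q 0≤z z≤1 0≤τ τ≤1 Nτ≡Ra small′)
              (≤-reflexive (cong (λ ρ → 1ℚ - ρ * (1ℚ + η) * z) (sym R≡))))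
          power≤ : (1ℚ - z) ^ q * (1ℚ - z) ^ e₀ ≤ B ^ q
          power≤ = ≤-trans (≤-reflexive (trans (lem ((1ℚ - z) ^ q) (1ℚ - z) ((1ℚ - z) ^ (r′ ℕ.* q)))
              (cong (_* (1ℚ - z)) (sym (^-+ (1ℚ - z) q (r′ ℕ.* q))))))
            (≤-trans ([1-z]^[rq+1]≤ (suc r′) q 0≤z z≤1 0≤τ τ≤1 Nτ≡Ra small′)
              (≤-reflexive (cong (λ ρ → (1ℚ - ρ * (1ℚ + η) * z) ^ q) (sym R≡))))
            where
            lem : ∀ u v w → u * (v * w) ≡ u * w * v
            lem = solve-∀ ℚ-ring

        -- Let z = R a, so that the number of vertices shrinks by the factor 1 - z. As Δ K ≤ R (1 +
        -- η) m, the new average times 1 - z is at least m (1 - R (1 + η) z), whose q-th power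
        -- `[1-z]^[rq+1]≤` bounds from below by m^q (1 - z)^(rq+1). Then (1 - z)^q is cancelled.
        average-after : ∀ {K} → K ∈ H → m ^ q * (1ℚ - R * a) ^ e₀ ≤ (R * (Q - Δ K) * a′) ^ q
        average-after {K} K∈ = *-cancelˡ (0<^ q 0<1-Ra) (begin
          (1ℚ - z) ^ q * (m ^ q * (1ℚ - z) ^ e₀)   ≡⟨ lem₀ ((1ℚ - z) ^ q) (m ^ q) ((1ℚ - z) ^ e₀) ⟩
          m ^ q * ((1ℚ - z) ^ q * (1ℚ - z) ^ e₀)   ≤⟨ *-monoˡ (0≤^ q 0≤m) power≤ ⟩
          m ^ q * B ^ q                            ≡⟨ ^-*-distrib m B q ⟨
          (m * B) ^ q                              ≤⟨ ^-mono q (0≤* 0≤m 0≤B) mB≤ ⟩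
          ((1ℚ - z) * m′) ^ q                      ≡⟨ ^-*-distrib (1ℚ - z) m′ q ⟩
          (1ℚ - z) ^ q * m′ ^ q                    ∎)
          where
          m′ = R * (Q - Δ K) * a′
          lem₀ : ∀ u v w → u * (v * w) ≡ v * (u * w)
          lem₀ = solve-∀ ℚ-ring
          lem₁ : ∀ A a a′ R X → (A * a - R * a) * (X * a′) ≡ X * a * (A * a′ - R * a′)
          lem₁ = solve-∀ ℚ-ring
          lem₂ : ∀ X a k → X * a * (1ℚ + k - k) ≡ X * a
          lem₂ = solve-∀ ℚ-ring
          lem₃ : ∀ A m a R D → A * m * a - R * a * D ≡ m * (A * a) - R * a * D
          lem₃ = solve-∀ ℚ-ring
          lem₄ : ∀ R Q D a → R * Q * a - R * a * D ≡ R * (Q - D) * a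
          lem₄ = solve-∀ ℚ-ring
          lem₅ : ∀ m R a η → m * (1ℚ - R * (1ℚ + η) * (R * a)) ≡ m * 1ℚ - R * a * (R * (m + η * m))
          lem₅ = solve-∀ ℚ-ring
          [1-z]m′≡ : (1ℚ - z) * m′ ≡ R * (Q - Δ K) * a
          [1-z]m′≡ = trans (cong (λ u → (u - z) * m′) (sym Aa≡1))
            (trans (lem₁ A a a′ R (R * (Q - Δ K)))
            (trans (cong (λ u → R * (Q - Δ K) * a * (u - R * a′)) Aa′≡) (lem₂ (R * (Q - Δ K)) a (R * a′))))
          mB≤ : m * B ≤ (1ℚ - z) * m′
          mB≤ = begin
            m * B                                   ≡⟨ lem₅ m R a η ⟩
            m * 1ℚ - R * a * (R * (m + η * m))      ≤⟨ +-monoʳ-≤ (m * 1ℚ) (neg-antimono-≤ (*-monoˡ 0≤z (Δ≤R[m+ηm] K∈))) ⟩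
            m * 1ℚ - R * a * Δ K                    ≡⟨ cong (λ u → m * u - R * a * Δ K) Aa≡1 ⟨
            m * (A * a) - R * a * Δ K               ≡⟨ lem₃ A m a R (Δ K) ⟨
            A * m * a - R * a * Δ K                 ≡⟨ cong (λ u → u * a - R * a * Δ K) Am≡RQ ⟩
            R * Q * a - R * a * Δ K                 ≡⟨ lem₄ R Q (Δ K) a ⟩
            R * (Q - Δ K) * a                       ≡⟨ [1-z]m′≡ ⟨
            (1ℚ - z) * m′                           ∎

-- Lists

≡true⇒≡ : ∀ {a b : Bool} → (a ≡ true → b ≡ true) → (b ≡ true → a ≡ true) → a ≡ b
≡true⇒≡ {true}  {b}     f g = sym (f refl)
≡true⇒≡ {false} {true}  f g = g refl
≡true⇒≡ {false} {false} f g = refl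

∧-true : ∀ {a b} → a ∧ b ≡ true → a ≡ true × b ≡ true
∧-true {true} {true} refl = refl , refl

module _ {A : Set} where

  filterᵇ-cong : ∀ {p q : A → Bool} xs → (∀ {x} → x ∈ xs → p x ≡ q x) → filterᵇ p xs ≡ filterᵇ q xs
  filterᵇ-cong []       h = refl
  filterᵇ-cong {p} {q} (x ∷ xs) h with p x | q x | h (here refl)
  ... | true  | .true  | refl = cong (x ∷_) (filterᵇ-cong xs (λ x∈ → h (there x∈)))
  ... | false | .false | refl = filterᵇ-cong xs (λ x∈ → h (there x∈))

  filterᵇ-∧ : ∀ (p q : A → Bool) xs → filterᵇ (λ x → p x ∧ q x) xs ≡ filterᵇ q (filterᵇ p xs)
  filterᵇ-∧ p q []       = refl
  filterᵇ-∧ p q (x ∷ xs) with p x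
  ... | false = filterᵇ-∧ p q xs
  ... | true with q x
  ...   | true  = cong (x ∷_) (filterᵇ-∧ p q xs)
  ...   | false = filterᵇ-∧ p q xs

  filterᵇ-++ : ∀ (p : A → Bool) xs ys → filterᵇ p (xs ++ ys) ≡ filterᵇ p xs ++ filterᵇ p ys
  filterᵇ-++ p []       ys = refl
  filterᵇ-++ p (x ∷ xs) ys with p x
  ... | true  = cong (x ∷_) (filterᵇ-++ p xs ys)
  ... | false = filterᵇ-++ p xs ys

  filterᵇ-map : ∀ {B : Set} (p : A → Bool) (f : B → A) xs → filterᵇ p (map f xs) ≡ map f (filterᵇ (λ x → p (f x)) xs)
  filterᵇ-map p f []       = refl
  filterᵇ-map p f (x ∷ xs) with p (f x)
  ... | true  = cong (f x ∷_) (filterᵇ-map p f xs)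
  ... | false = filterᵇ-map p f xs

  ∈-filterᵇ⁻ : ∀ (p : A → Bool) xs {x} → x ∈ filterᵇ p xs → x ∈ xs × p x ≡ true
  ∈-filterᵇ⁻ p (y ∷ xs) x∈ with p y in eq
  ∈-filterᵇ⁻ p (y ∷ xs) (here refl) | true = here refl , eq
  ∈-filterᵇ⁻ p (y ∷ xs) (there x∈)  | true = let a , b = ∈-filterᵇ⁻ p xs x∈ in there a , b
  ... | false = let a , b = ∈-filterᵇ⁻ p xs x∈ in there a , b

  ∈-filterᵇ⁺ : ∀ (p : A → Bool) xs {x} → x ∈ xs → p x ≡ true → x ∈ filterᵇ p xs
  ∈-filterᵇ⁺ p (y ∷ xs) (here refl) px with p y
  ∈-filterᵇ⁺ p (y ∷ xs) (here refl) refl | true = here refl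
  ∈-filterᵇ⁺ p (y ∷ xs) (there x∈) px with p y
  ... | true  = there (∈-filterᵇ⁺ p xs x∈ px)
  ... | false = ∈-filterᵇ⁺ p xs x∈ px

  filterᵇ-true : ∀ {p : A → Bool} xs → (∀ {x} → x ∈ xs → p x ≡ true) → filterᵇ p xs ≡ xs
  filterᵇ-true []       h = refl
  filterᵇ-true {p} (x ∷ xs) h with p x | h (here refl)
  ... | true | refl = cong (x ∷_) (filterᵇ-true xs (λ x∈ → h (there x∈)))

  filterᵇ-unique : ∀ (p : A → Bool) {xs} → Unique xs → Unique (filterᵇ p xs)
  filterᵇ-unique p = Uniqueₚ.filter⁺ _

  length-filterᵇ-not : ∀ (p : A → Bool) xs → length (filterᵇ p xs) ℕ.+ length (filterᵇ (λ x → not (p x)) xs) ≡ length xs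
  length-filterᵇ-not p []       = refl
  length-filterᵇ-not p (x ∷ xs) with p x
  ... | true  = cong suc (length-filterᵇ-not p xs)
  ... | false = trans (ℕₚ.+-suc _ _) (cong suc (length-filterᵇ-not p xs))

  all⁻ : ∀ (p : A → Bool) xs → all p xs ≡ true → ∀ {x} → x ∈ xs → p x ≡ true
  all⁻ p (y ∷ xs) h (here refl) = proj₁ (∧-true h)
  all⁻ p (y ∷ xs) h (there x∈)  = all⁻ p xs (proj₂ (∧-true h)) x∈

  all⁺ : ∀ (p : A → Bool) xs → (∀ {x} → x ∈ xs → p x ≡ true) → all p xs ≡ true
  all⁺ p []       h = refl
  all⁺ p (y ∷ xs) h = cong₂ _∧_ (h (here refl)) (all⁺ p xs (λ x∈ → h (there x∈)))

  all-cong : ∀ {p q : A → Bool} xs → (∀ {x} → x ∈ xs → p x ≡ q x) → all p xs ≡ all q xs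
  all-cong []       h = refl
  all-cong (y ∷ xs) h = cong₂ _∧_ (h (here refl)) (all-cong xs (λ x∈ → h (there x∈)))

  all-∧-not : ∀ (p q : A → Bool) xs → all (λ x → p x ∧ not (q x)) xs ≡ all p xs ∧ not (any q xs)
  all-∧-not p q []       = refl
  all-∧-not p q (x ∷ xs) = trans (cong ((p x ∧ not (q x)) ∧_) (all-∧-not p q xs)) (lem (p x) (q x) (all p xs) (any q xs))
    where
    lem : ∀ a b c d → (a ∧ not b) ∧ (c ∧ not d) ≡ (a ∧ c) ∧ not (b ∨ d)
    lem false b     c     d = refl
    lem true  true  true  d = refl
    lem true  true  false d = refl
    lem true  false c     d = refl

  ∑-++ : ∀ (xs ys : List A) f → ∑ (xs ++ ys) f ≡ ∑ xs f + ∑ ys f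
  ∑-++ []       ys f = sym (+-identityˡ (∑ ys f))
  ∑-++ (x ∷ xs) ys f = trans (cong (λ z → f x + z) (∑-++ xs ys f)) (sym (ℚₚ.+-assoc (f x) (∑ xs f) (∑ ys f)))

  ∑-map : ∀ {B : Set} (g : B → A) xs f → ∑ (map g xs) f ≡ ∑ xs (λ x → f (g x))
  ∑-map g []       f = refl
  ∑-map g (x ∷ xs) f = cong (λ z → f (g x) + z) (∑-map g xs f)

  any≤∑ : ∀ (p : A → Bool) xs → [ any p xs ] ≤ ∑ xs (λ x → [ p x ])
  any≤∑ p []       = ≤-refl
  any≤∑ p (x ∷ xs) with p x
  ... | true  = ≤-by (∑ xs (λ x → [ p x ])) (0≤∑ xs (λ {x} _ → 0≤[] (p x))) refl
  ... | false = ≤-trans (any≤∑ p xs) (≤-reflexive (sym (+-identityˡ _)))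

  any-false : ∀ (p : A → Bool) xs → any p xs ≡ false → ∑ xs (λ x → [ p x ]) ≡ 0ℚ
  any-false p []       h = refl
  any-false p (x ∷ xs) h with p x
  ... | false = trans (+-identityˡ _) (any-false p xs h)

  -- If some entry is marked, the inequality says (S - 1)² ≥ 0; otherwise S = 0.
  ∑≤any+∑²-∑ : ∀ (p : A → Bool) xs →
    ∑ xs (λ x → [ p x ]) ≤ [ any p xs ] + (∑ xs (λ x → [ p x ]) * ∑ xs (λ x → [ p x ]) - ∑ xs (λ x → [ p x ]))
  ∑≤any+∑²-∑ p xs with any p xs in eq
  ... | true  = ≤-by ((S - 1ℚ) * (S - 1ℚ)) (0≤x*x (S - 1ℚ)) (lem S)
    where
    S = ∑ xs (λ x → [ p x ])
    lem : ∀ S → S + (S - 1ℚ) * (S - 1ℚ) ≡ 1ℚ + (S * S - S)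
    lem = solve-∀ ℚ-ring
  ... | false = ≤-reflexive (cong (λ S → S) (trans (any-false p xs eq)
                  (sym (cong (λ S → 0ℚ + (S * S - S)) (any-false p xs eq)))))

ι-cancel-≤ : ∀ {m n} → ι m ≤ ι n → m ℕ.≤ n
ι-cancel-≤ {m} {n} le with m ℕₚ.≤? n
... | yes m≤n = m≤n
... | no m≰n = ⊥-elim (ℚₚ.<-irrefl refl (<-≤-trans ιn<1+ιn (≤-trans (ι-mono (ℕₚ.≰⇒> m≰n)) le)))
  where
  ιn<1+ιn : ι n < 1ℚ + ι n
  ιn<1+ιn = ℚₚ.≤-<-trans (≤-reflexive (sym (+-identityˡ (ι n)))) (ℚₚ.+-monoˡ-< (ι n) (ℚₚ.positive⁻¹ 1ℚ))

ι-injective : ∀ {m n} → ι m ≡ ι n → m ≡ n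
ι-injective eq = ℕₚ.≤-antisym (ι-cancel-≤ (≤-reflexive eq)) (ι-cancel-≤ (≤-reflexive (sym eq)))

-- The recursion is that of `combinations`, so that counts of sublists follow it clause by clause.
choose : ℕ → ℕ → ℕ
choose n       zero    = 1
choose zero    (suc k) = 0
choose (suc n) (suc k) = choose n k ℕ.+ choose n (suc k)

choose≤^ : ∀ n k → choose n k ℕ.≤ n ℕ.^ k
choose≤^ n       zero    = ℕₚ.≤-refl
choose≤^ zero    (suc k) = z≤n
choose≤^ (suc n) (suc k) = ℕₚ.≤-trans (ℕₚ.+-mono-≤ (choose≤^ n k) (choose≤^ n (suc k)))
  (ℕₚ.*-monoʳ-≤ (suc n) (ℕₚ.^-monoˡ-≤ k (ℕₚ.n≤1+n n)))

choose-mono : ∀ {m n} k → m ℕ.≤ n → choose m k ℕ.≤ choose n k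
choose-mono zero    m≤n = ℕₚ.≤-refl
choose-mono (suc k) z≤n = z≤n
choose-mono (suc k) (s≤s m≤n) = ℕₚ.+-mono-≤ (choose-mono k m≤n) (choose-mono (suc k) m≤n)

-- Pascal's rule is unrolled v times; each application contributes a summand that is at least
-- `choose n k`. Iterating this gives a lower bound of the right order without fractions.
v*choose≤choose : ∀ n k v → v ℕ.* choose n k ℕ.≤ choose (v ℕ.+ n) (suc k)
v*choose≤choose n k zero    = z≤n
v*choose≤choose n k (suc v) = ℕₚ.+-mono-≤ (choose-mono k (ℕₚ.m≤n+m n v)) (v*choose≤choose n k v)

v^k≤choose : ∀ k v → v ℕ.^ k ℕ.≤ choose (k ℕ.* v) k
v^k≤choose zero    v = ℕₚ.≤-refl
v^k≤choose (suc k) v = ℕₚ.≤-trans (ℕₚ.*-monoʳ-≤ v (v^k≤choose k v)) (v*choose≤choose (k ℕ.* v) k v)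

-- Sublists of a given length

[]⊆ : ∀ {A : Set} (xs : List A) → [] ⊆ xs
[]⊆ []       = []
[]⊆ (x ∷ xs) = x ∷ʳ []⊆ xs

⊆-∈ : ∀ {A : Set} {xs ys : List A} → xs ⊆ ys → ∀ {x} → x ∈ xs → x ∈ ys
⊆-∈ (y ∷ʳ τ)   x∈          = there (⊆-∈ τ x∈)
⊆-∈ (refl ∷ τ) (here refl) = here refl
⊆-∈ (refl ∷ τ) (there x∈)  = there (⊆-∈ τ x∈)

combinations-⊆ : ∀ {A : Set} k (xs : List A) {K} → K ∈ combinations k xs → K ⊆ xs
combinations-⊆ zero    xs       (here refl) = []⊆ xs
combinations-⊆ (suc k) (x ∷ xs) K∈ with ∈-++⁻ (map (x ∷_) (combinations k xs)) K∈
... | inj₂ K∈′ = x ∷ʳ combinations-⊆ (suc k) xs K∈′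
... | inj₁ K∈′ with ∈-map⁻ (x ∷_) K∈′
...   | _ , K∈″ , refl = refl ∷ combinations-⊆ k xs K∈″

combinations-length : ∀ {A : Set} k (xs : List A) {K} → K ∈ combinations k xs → length K ≡ k
combinations-length zero    xs       (here refl) = refl
combinations-length (suc k) (x ∷ xs) K∈ with ∈-++⁻ (map (x ∷_) (combinations k xs)) K∈
... | inj₂ K∈′ = combinations-length (suc k) xs K∈′
... | inj₁ K∈′ with ∈-map⁻ (x ∷_) K∈′
...   | _ , K∈″ , refl = cong suc (combinations-length k xs K∈″)

-- Opaque, since products of unfolded triangular numbers are expensive to compare.
opaque

  triangle : ℕ → ℕ
  triangle zero    = 0
  triangle (suc n) = n ℕ.+ triangle n

  triangle-suc : ∀ n → triangle (suc n) ≡ n ℕ.+ triangle n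
  triangle-suc n = refl

  2*triangle : ∀ n → 2 ℕ.* triangle n ≡ n ℕ.* (n ℕ.∸ 1)
  2*triangle zero          = refl
  2*triangle (suc zero)    = refl
  2*triangle (suc (suc m)) = trans (lem m (triangle (suc m)))
    (trans (cong (2 ℕ.* suc m ℕ.+_) (2*triangle (suc m))) (lem′ m))
    where
    lem : ∀ m t → 2 ℕ.* (suc m ℕ.+ t) ≡ 2 ℕ.* suc m ℕ.+ 2 ℕ.* t
    lem = ℕ-solve-∀
    lem′ : ∀ m → 2 ℕ.* suc m ℕ.+ suc m ℕ.* m ≡ suc (suc m) ℕ.* suc m
    lem′ = ℕ-solve-∀

  length-pairs : ∀ {A : Set} (xs : List A) → length (pairs xs) ≡ triangle (length xs)
  length-pairs []       = refl
  length-pairs (x ∷ xs) = trans (Listₚ.length-++ (map (x ,_) xs))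
    (cong₂ ℕ._+_ (Listₚ.length-map (x ,_) xs) (length-pairs xs))

-- With `p` the membership in a clique, this identifies the edges inside the clique with the pairs
-- of its vertices, as lists and in the same order.
filterᵇ-pairs : ∀ {A : Set} (p : A → Bool) xs →
  filterᵇ (λ e → p (proj₁ e) ∧ p (proj₂ e)) (pairs xs) ≡ pairs (filterᵇ p xs)
filterᵇ-pairs p []       = refl
filterᵇ-pairs p (x ∷ xs) = trans (filterᵇ-++ p₂ (map (x ,_) xs) (pairs xs))
  (trans (cong₂ _++_ (filterᵇ-map p₂ (x ,_) xs) (filterᵇ-pairs p xs)) head)
  where
  p₂ = λ e → p (proj₁ e) ∧ p (proj₂ e)
  none : ∀ {B : Set} (ys : List B) → filterᵇ (λ _ → false) ys ≡ []
  none []       = refl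
  none (y ∷ ys) = none ys
  head : map (x ,_) (filterᵇ (λ y → p x ∧ p y) xs) ++ pairs (filterᵇ p xs) ≡ pairs (filterᵇ p (x ∷ xs))
  head with p x
  ... | true  = refl
  ... | false = cong (λ ys → map (x ,_) ys ++ pairs (filterᵇ p xs)) (none xs)

pairs-AllPairs : ∀ {A : Set} {R : A → A → Set} {xs} → AllPairs R xs → ∀ {e} → e ∈ pairs xs → R (proj₁ e) (proj₂ e)
pairs-AllPairs {xs = x ∷ xs} (Rx ∷ Rxs) e∈ with ∈-++⁻ (map (x ,_) xs) e∈
... | inj₂ e∈′ = pairs-AllPairs Rxs e∈′
... | inj₁ e∈′ with ∈-map⁻ (x ,_) e∈′
...   | _ , y∈ , refl = All.lookup Rx y∈

pairs-∈ : ∀ {A : Set} (xs : List A) {e} → e ∈ pairs xs → proj₁ e ∈ xs × proj₂ e ∈ xs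
pairs-∈ (x ∷ xs) e∈ with ∈-++⁻ (map (x ,_) xs) e∈
... | inj₂ e∈′ = let a , b = pairs-∈ xs e∈′ in there a , there b
... | inj₁ e∈′ with ∈-map⁻ (x ,_) e∈′
...   | _ , y∈ , refl = here refl , there y∈

pairs-unique : ∀ {A : Set} {xs : List A} → Unique xs → Unique (pairs xs)
pairs-unique {xs = []}     []       = []
pairs-unique {xs = x ∷ xs} (x∉ ∷ u) = Uniqueₚ.++⁺ (Uniqueₚ.map⁺ (λ { refl → refl }) (u)) (pairs-unique u) disjoint
  where
  disjoint : ∀ {e} → (e ∈ map (x ,_) xs) × (e ∈ pairs xs) → ⊥
  disjoint (e∈₁ , e∈₂) with ∈-map⁻ (x ,_) e∈₁
  ... | _ , _ , refl = All.lookup x∉ (proj₁ (pairs-∈ xs e∈₂)) refl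

-- Counting the vertex sets that contain given vertices

module _ {n : ℕ} where

  ⌊≟⌋-refl : ∀ (i : Fin n) → ⌊ i Fin.≟ i ⌋ ≡ true
  ⌊≟⌋-refl i with i Fin.≟ i
  ... | yes _ = refl
  ... | no ≢  = ⊥-elim (≢ refl)

  ⌊≟⌋-≢ : ∀ (i j : Fin n) → i ≢ j → ⌊ i Fin.≟ j ⌋ ≡ false
  ⌊≟⌋-≢ i j i≢j with i Fin.≟ j
  ... | yes eq = ⊥-elim (i≢j eq)
  ... | no _   = refl

  ∈⇒memᵇ : ∀ {i : Fin n} {S} → i ∈ S → memᵇ i S ≡ true
  ∈⇒memᵇ {i} {s ∷ S} (here refl) = cong (_∨ memᵇ i S) (⌊≟⌋-refl i)
  ∈⇒memᵇ {i} {s ∷ S} (there i∈) with ⌊ i Fin.≟ s ⌋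
  ... | true  = refl
  ... | false = ∈⇒memᵇ i∈

  memᵇ⇒∈ : ∀ {i : Fin n} S → memᵇ i S ≡ true → i ∈ S
  memᵇ⇒∈ {i} (s ∷ S) h with i Fin.≟ s
  ... | yes refl = here refl
  ... | no _     = there (memᵇ⇒∈ S h)

  ∉⇒memᵇ : ∀ {i : Fin n} S → i ∉ S → memᵇ i S ≡ false
  ∉⇒memᵇ {i} S i∉ with memᵇ i S in eq
  ... | true  = ⊥-elim (i∉ (memᵇ⇒∈ S eq))
  ... | false = refl

  unique-∉ : ∀ {x : Fin n} {xs} → Unique (x ∷ xs) → x ∉ xs
  unique-∉ (x∉ ∷ _) x∈ = All.lookup x∉ x∈ refl

  -- A sublist keeps the order of `xs`, and `xs` has no repetition, so membership alone recovers `K`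
  -- as a list.
  filterᵇ-memᵇ : ∀ {K xs : List (Fin n)} → Unique xs → K ⊆ xs → filterᵇ (λ v → memᵇ v K) xs ≡ K
  filterᵇ-memᵇ {xs = []} u [] = refl
  filterᵇ-memᵇ {K} {x ∷ xs} u@(_ ∷ u′) (.x ∷ʳ τ) with memᵇ x K in eq
  ... | true  = ⊥-elim (unique-∉ u (⊆-∈ τ (memᵇ⇒∈ K eq)))
  ... | false = filterᵇ-memᵇ u′ τ
  filterᵇ-memᵇ {x ∷ K} {.x ∷ xs} u@(_ ∷ u′) (refl ∷ τ) with memᵇ x (x ∷ K) in eq
  ... | true  = cong (x ∷_) (trans (filterᵇ-cong xs (λ {v} v∈ →
          cong (_∨ memᵇ v K) (⌊≟⌋-≢ v x (λ { refl → unique-∉ u v∈ })))) (filterᵇ-memᵇ u′ τ))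
  ... | false = ⊥-elim (case-⊥ (trans (sym (∈⇒memᵇ {S = x ∷ K} (here refl))) eq))
    where
    case-⊥ : true ≡ false → ⊥
    case-⊥ ()

  ∑-≟ : ∀ {xs : List (Fin n)} → Unique xs → ∀ {t} → t ∈ xs → ∑ xs (λ v → [ ⌊ v Fin.≟ t ⌋ ]) ≡ 1ℚ
  ∑-≟ {x ∷ xs} u@(_ ∷ u′) (here refl) = trans (cong₂ _+_ (cong [_] (⌊≟⌋-refl x))
      (trans (∑-cong xs (λ {v} v∈ → cong [_] (⌊≟⌋-≢ v x (λ { refl → unique-∉ u v∈ })))) (∑-0 xs))) (+-identityʳ 1ℚ)
  ∑-≟ {x ∷ xs} u@(_ ∷ u′) {t} (there t∈) = trans (cong₂ _+_ (cong [_] (⌊≟⌋-≢ x t (λ { refl → unique-∉ u t∈ }))) (∑-≟ u′ t∈))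
    (+-identityˡ 1ℚ)

  length-filterᵇ-memᵇ : ∀ {xs : List (Fin n)} → Unique xs → ∀ {T} → Unique T → (∀ {t} → t ∈ T → t ∈ xs) →
    length (filterᵇ (λ v → memᵇ v T) xs) ≡ length T
  length-filterᵇ-memᵇ {xs} u {T₀} uT T⊆ = ι-injective (trans (ι-length-filterᵇ (λ v → memᵇ v T₀) xs) (go uT T⊆))
    where
    disjoint-∨ : ∀ {t T} → t ∉ T → ∀ v → [ ⌊ v Fin.≟ t ⌋ ∨ memᵇ v T ] ≡ [ ⌊ v Fin.≟ t ⌋ ] + [ memᵇ v T ]
    disjoint-∨ {t} {T} t∉ v with v Fin.≟ t
    ... | yes refl = sym (trans (cong (λ b → 1ℚ + [ b ]) (∉⇒memᵇ T t∉)) (+-identityʳ 1ℚ))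
    ... | no _     = sym (+-identityˡ [ memᵇ v T ])
    go : ∀ {T} → Unique T → (∀ {t} → t ∈ T → t ∈ xs) → ∑ xs (λ v → [ memᵇ v T ]) ≡ ι (length T)
    go {[]}    uT T⊆ = ∑-0 xs
    go {t ∷ T} uT@(_ ∷ uT′) T⊆ = trans (∑-cong xs (λ {v} _ → disjoint-∨ (unique-∉ uT) v))
      (trans (∑-+ xs (λ v → [ ⌊ v Fin.≟ t ⌋ ]) (λ v → [ memᵇ v T ]))
        (cong₂ _+_ (∑-≟ u (T⊆ (here refl))) (go uT′ (λ t∈ → T⊆ (there t∈)))))

  -- K contains every element of xs marked by p.
  covers : (Fin n → Bool) → List (Fin n) → List (Fin n) → Bool
  covers p xs K = all (λ v → not (p v) ∨ memᵇ v K) xs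

  module _ (p : Fin n → Bool) where

    private
      count : ℕ → List (Fin n) → ℚ
      count k xs = ∑ (combinations k xs) (λ K → [ covers p xs K ])

      marked unmarked : List (Fin n) → ℕ
      marked   xs = length (filterᵇ p xs)
      unmarked xs = length (filterᵇ (λ v → not (p v)) xs)

      covers-∷ : ∀ {x xs} → x ∉ xs → ∀ K → covers p (x ∷ xs) (x ∷ K) ≡ covers p xs K
      covers-∷ {x} {xs} x∉ K = cong₂ _∧_ (trans (cong (not (p x) ∨_) (∈⇒memᵇ {S = x ∷ K} (here refl))) (∨-true (not (p x))))
        (all-cong xs (λ {v} v∈ → cong (not (p v) ∨_) (cong (_∨ memᵇ v K) (⌊≟⌋-≢ v x (λ { refl → x∉ v∈ })))))
        where
        ∨-true : ∀ b → b ∨ true ≡ true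
        ∨-true true  = refl
        ∨-true false = refl

      covers-skip : ∀ {x xs} → x ∉ xs → ∀ {K} → K ⊆ xs → covers p (x ∷ xs) K ≡ not (p x) ∧ covers p xs K
      covers-skip {x} {xs} x∉ {K} τ = cong (_∧ covers p xs K)
        (trans (cong (not (p x) ∨_) (∉⇒memᵇ K (λ x∈ → x∉ (⊆-∈ τ x∈)))) (∨-false (not (p x))))
        where
        ∨-false : ∀ b → b ∨ false ≡ b
        ∨-false true  = refl
        ∨-false false = refl

      count-step : ∀ {x xs} k → x ∉ xs →
        count (suc k) (x ∷ xs) ≡ count k xs + ∑ (combinations (suc k) xs) (λ K → [ not (p x) ∧ covers p xs K ])
      count-step {x} {xs} k x∉ = trans (∑-++ (map (x ∷_) (combinations k xs)) (combinations (suc k) xs) (λ K → [ covers p (x ∷ xs) K ]))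
        (cong₂ _+_ (trans (∑-map (x ∷_) (combinations k xs) (λ K → [ covers p (x ∷ xs) K ]))
            (∑-cong (combinations k xs) (λ {K} _ → cong [_] (covers-∷ x∉ K))))
          (∑-cong (combinations (suc k) xs) (λ {K} K∈ → cong [_] (covers-skip x∉ (combinations-⊆ (suc k) xs K∈)))))

      filterᵇ-head : ∀ (q : Fin n → Bool) {x b} xs → q x ≡ b →
        length (filterᵇ q (x ∷ xs)) ≡ (if b then suc (length (filterᵇ q xs)) else length (filterᵇ q xs))
      filterᵇ-head q {x} xs refl with q x
      ... | true  = refl
      ... | false = refl

      count-marked : ∀ {x xs} k → p x ≡ true → x ∉ xs → count (suc k) (x ∷ xs) ≡ count k xs
      count-marked {x} {xs} k eq x∉ = trans (count-step k x∉) (trans (cong (λ z → count k xs + z)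
        (trans (∑-cong (combinations (suc k) xs) (λ {K} _ → cong (λ b → [ not b ∧ covers p xs K ]) eq)) (∑-0 (combinations (suc k) xs))))
        (+-identityʳ (count k xs)))

      count-unmarked : ∀ {x xs} k → p x ≡ false → x ∉ xs → count (suc k) (x ∷ xs) ≡ count k xs + count (suc k) xs
      count-unmarked {x} {xs} k eq x∉ = trans (count-step k x∉) (cong (λ z → count k xs + z)
        (∑-cong (combinations (suc k) xs) (λ {K} _ → cong (λ b → [ not b ∧ covers p xs K ]) eq)))

      count-0 : ∀ x xs {b} → p x ≡ b → count 0 (x ∷ xs) ≡ (if b then 0ℚ else count 0 xs)
      count-0 x xs {true}  eq = cong (λ b → [ (not b ∨ false) ∧ covers p xs [] ] + 0ℚ) eq
      count-0 x xs {false} eq = cong (λ b → [ (not b ∨ false) ∧ covers p xs [] ] + 0ℚ) eq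

    count-zero : ∀ k {xs} → Unique xs → k ℕ.< marked xs → count k xs ≡ 0ℚ
    count-zero k {x ∷ xs} u@(_ ∷ u′) k< = go k (p x) refl k<
      where
      go : ∀ k b → p x ≡ b → k ℕ.< marked (x ∷ xs) → count k (x ∷ xs) ≡ 0ℚ
      go zero    true  eq k< = count-0 x xs eq
      go (suc k) true  eq k< = trans (count-marked k eq (unique-∉ u))
        (count-zero k u′ (ℕₚ.≤-pred (subst (suc k ℕ.<_) (filterᵇ-head p xs eq) k<)))
      go zero    false eq k< = trans (count-0 x xs eq) (count-zero zero u′ (subst (0 ℕ.<_) (filterᵇ-head p xs eq) k<))
      go (suc k) false eq k< = trans (count-unmarked k eq (unique-∉ u))
        (cong₂ _+_ (count-zero k u′ (ℕₚ.<-trans (ℕₚ.n<1+n k) k<′)) (count-zero (suc k) u′ k<′))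
        where
        k<′ : suc k ℕ.< marked xs
        k<′ = subst (suc k ℕ.<_) (filterᵇ-head p xs eq) k<

    -- Stated for an arbitrary marking so that the induction on the list goes through: a marked head
    -- has to be chosen, while an unmarked head splits the count by Pascal's rule.
    count≡choose : ∀ l {xs} → Unique xs → count (marked xs ℕ.+ l) xs ≡ ι (choose (unmarked xs) l)
    count≡choose zero    {[]}     u = refl
    count≡choose (suc l) {[]}     u = refl
    count≡choose l       {x ∷ xs} u@(_ ∷ u′) = go l (p x) refl
      where
      x∉ = unique-∉ u
      from-unmarked : ∀ {b} → p x ≡ b → unmarked (x ∷ xs) ≡ (if not b then suc (unmarked xs) else unmarked xs)
      from-unmarked eq = filterᵇ-head (λ v → not (p v)) xs (cong not eq)
      -- Without free places an unmarked head cannot be chosen: too few places would remain for the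
      -- marked entries, so that count is zero.
      base : ∀ m → m ≡ marked xs → p x ≡ false → count (m ℕ.+ 0) (x ∷ xs) ≡ count (m ℕ.+ 0) xs
      base zero    eq′ eq = count-0 x xs eq
      base (suc m) eq′ eq = trans (count-unmarked (m ℕ.+ 0) eq x∉)
        (trans (cong (_+ count (suc m ℕ.+ 0) xs) (count-zero (m ℕ.+ 0) u′
          (ℕₚ.≤-reflexive (trans (cong suc (ℕₚ.+-identityʳ m)) eq′)))) (+-identityˡ _))
      go : ∀ l b → p x ≡ b → count (marked (x ∷ xs) ℕ.+ l) (x ∷ xs) ≡ ι (choose (unmarked (x ∷ xs)) l)
      go l true eq = trans (cong (λ m → count (m ℕ.+ l) (x ∷ xs)) (filterᵇ-head p xs eq))
        (trans (count-marked (marked xs ℕ.+ l) eq x∉) (trans (count≡choose l u′)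
          (cong (λ m → ι (choose m l)) (sym (from-unmarked eq)))))
      go zero false eq = trans (cong (λ m → count (m ℕ.+ 0) (x ∷ xs)) (filterᵇ-head p xs eq))
        (trans (base (marked xs) refl eq) (count≡choose zero u′))
      go (suc l) false eq = trans (cong (λ m → count (m ℕ.+ suc l) (x ∷ xs)) (filterᵇ-head p xs eq))
        (trans (cong (λ k → count k (x ∷ xs)) (ℕₚ.+-suc (marked xs) l))
        (trans (count-unmarked (marked xs ℕ.+ l) eq x∉)
        (trans (cong₂ _+_ (count≡choose l u′)
          (trans (cong (λ k → count k xs) (sym (ℕₚ.+-suc (marked xs) l))) (count≡choose (suc l) u′)))
        (trans (sym (ι-+ (choose (unmarked xs) l) (choose (unmarked xs) (suc l))))
          (cong (λ m → ι (choose m (suc l))) (sym (from-unmarked eq)))))))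

  covers-memᵇ : ∀ {xs T : List (Fin n)} → (∀ {t} → t ∈ T → t ∈ xs) → ∀ K →
    covers (λ v → memᵇ v T) xs K ≡ all (λ t → memᵇ t K) T
  covers-memᵇ {xs} {T} T⊆ K = ≡true⇒≡
    (λ h → all⁺ _ T (λ {t} t∈ → subst (λ b → not b ∨ memᵇ t K ≡ true) (∈⇒memᵇ t∈) (all⁻ _ xs h (T⊆ t∈))))
    (λ h → all⁺ _ xs (λ {v} _ → back h v))
    where
    back : all (λ t → memᵇ t K) T ≡ true → ∀ v → not (memᵇ v T) ∨ memᵇ v K ≡ true
    back h v with memᵇ v T in eq
    ... | true  = all⁻ _ T h (memᵇ⇒∈ T eq)
    ... | false = refl

  -- Applied to three vertices for the codegrees and to two for the degrees in the complete graph.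
  ∑-combinations-⊇ : ∀ {xs T : List (Fin n)} → Unique xs → Unique T → (∀ {t} → t ∈ T → t ∈ xs) → ∀ l u →
    u ℕ.+ length T ≡ length xs →
    ∑ (combinations (length T ℕ.+ l) xs) (λ K → [ all (λ t → memᵇ t K) T ]) ≡ ι (choose u l)
  ∑-combinations-⊇ {xs} {T} ux uT T⊆ l u u+ = trans
    (∑-cong (combinations (length T ℕ.+ l) xs) (λ {K} _ → cong [_] (sym (covers-memᵇ T⊆ K))))
    (trans (cong (λ k → ∑ (combinations (k ℕ.+ l) xs) (λ K → [ covers p xs K ])) (sym |T|))
    (trans (count≡choose p l ux) (cong (λ z → ι (choose z l)) unmarked≡u)))
    where
    p = λ v → memᵇ v T
    |T| : length (filterᵇ p xs) ≡ length T
    |T| = length-filterᵇ-memᵇ ux uT T⊆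
    unmarked≡u : length (filterᵇ (λ v → not (p v)) xs) ≡ u
    unmarked≡u = ℕₚ.+-cancelˡ-≡ (length T) _ _ (trans (cong (ℕ._+ length (filterᵇ (λ v → not (p v)) xs)) (sym |T|))
      (trans (length-filterᵇ-not p xs) (trans (sym u+) (ℕₚ.+-comm u (length T)))))

[]*[]≤[] : ∀ a b c → (a ≡ true → b ≡ true → c ≡ true) → [ a ] * [ b ] ≤ [ c ]
[]*[]≤[] true  true  c h = ≤-reflexive (cong [_] (sym (h refl refl)))
[]*[]≤[] true  false c h = 0≤[] c
[]*[]≤[] false b     c h = ≤-trans (≤-reflexive (*-zeroˡ [ b ])) (0≤[] c)

∧-intro : ∀ {a b} → a ≡ true → b ≡ true → a ∧ b ≡ true
∧-intro refl refl = refl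

dichotomy : ∀ {A : Set} (f : A → ℚ) c xs → (∀ {x} → x ∈ xs → f x ≤ c) ⊎ Σ A λ x → x ∈ xs × c ≤ f x
dichotomy f c []       = inj₁ λ ()
dichotomy f c (x ∷ xs) with ℚₚ.≤-total (f x) c | dichotomy f c xs
... | inj₂ c≤fx | _ = inj₂ (x , here refl , c≤fx)
... | inj₁ _    | inj₂ (y , y∈ , c≤fy) = inj₂ (y , there y∈ , c≤fy)
... | inj₁ fx≤c | inj₁ h = inj₁ λ { (here refl) → fx≤c ; (there x∈) → h x∈ }

nonempty? : ∀ {A : Set} (xs : List A) → xs ≡ [] ⊎ 0 ℕ.< length xs
nonempty? []       = inj₁ refl
nonempty? (x ∷ xs) = inj₂ (s≤s z≤n)

-- Recursion for the final probability

module _ {n : ℕ} (k : ℕ) (P : Graph n → Bool) where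

  final : Graph n → ℚ
  final G = if P G then 1ℚ else 0ℚ

  probFinal-stuck : ∀ fuel G → cliques k G ≡ [] → probFinal k fuel G P ≡ final G
  probFinal-stuck zero       G eq = refl
  probFinal-stuck (suc fuel) G eq with cliques k G
  ... | [] = refl

  -- The averaging over cliques cleared of its denominator, the form in which it is compared with
  -- sums of `Ψ`.
  length*probFinal : ∀ fuel G → 0 ℕ.< length (cliques k G) →
    ι (length (cliques k G)) * probFinal k (suc fuel) G P ≡ ∑ (cliques k G) (λ S → probFinal k fuel (removeClique G S) P)
  length*probFinal fuel G 0< with cliques k G
  ... | c ∷ cs = trans (sym (*-assoc (ι (suc (length cs))) (+ 1 / suc (length cs)) _))
    (trans (cong (_* ∑ (c ∷ cs) (λ S → probFinal k fuel (removeClique G S) P)) (ι[1+n]*1/[1+n]≡1 (length cs))) (*-identityˡ _))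

  0≤final : ∀ G → 0ℚ ≤ final G
  0≤final G with P G
  ... | true  = 0≤1
  ... | false = ≤-refl

  0≤probFinal : ∀ fuel G → 0ℚ ≤ probFinal k fuel G P
  0≤probFinal zero       G = 0≤final G
  0≤probFinal (suc fuel) G with nonempty? (cliques k G)
  ... | inj₁ eq = ≤-trans (0≤final G) (≤-reflexive (sym (probFinal-stuck (suc fuel) G eq)))
  ... | inj₂ 0< = *-cancelˡ (0<ι 0<) (≤-trans (≤-reflexive (*-zeroʳ (ι (length (cliques k G)))))
    (≤-trans (0≤∑ (cliques k G) (λ {S} _ → 0≤probFinal fuel (removeClique G S))) (≤-reflexive (sym (length*probFinal fuel G 0<)))))

  1≤probFinal : (∀ G S → P G ≡ true → P (removeClique G S) ≡ true) →
    ∀ fuel G → P G ≡ true → 1ℚ ≤ probFinal k fuel G P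
  1≤probFinal mono fuel G PG with nonempty? (cliques k G)
  ... | inj₁ eq = ≤-reflexive (sym (trans (probFinal-stuck fuel G eq) (cong (λ b → if b then 1ℚ else 0ℚ) PG)))
  1≤probFinal mono zero       G PG | inj₂ 0< = ≤-reflexive (sym (cong (λ b → if b then 1ℚ else 0ℚ) PG))
  1≤probFinal mono (suc fuel) G PG | inj₂ 0< = *-cancelˡ (0<ι 0<)
    (≤-trans (≤-reflexive (sym (∑-const (cliques k G) 1ℚ)))
    (≤-trans (∑-mono (cliques k G) (λ {S} _ → 1≤probFinal mono fuel (removeClique G S) (mono G S PG)))
      (≤-reflexive (sym (length*probFinal fuel G 0<)))))

-- The hypergraph of edges and cliques

module Cliques (n l : ℕ) where

  Edge : Set
  Edge = Fin n × Fin n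

  vertices-unique : Unique (allVertices n)
  vertices-unique = Uniqueₚ.allFin⁺ n

  vertices-ordered : AllPairs Fin._<_ (allVertices n)
  vertices-ordered = AllPairsₚ.tabulate⁺-< (λ i<j → i<j)

  length-vertices : length (allVertices n) ≡ n
  length-vertices = Listₚ.length-tabulate (λ i → i)

  possible-edges : List Edge
  possible-edges = pairs (allVertices n)

  edge-< : ∀ {e} → e ∈ possible-edges → proj₁ e Fin.< proj₂ e
  edge-< = pairs-AllPairs vertices-ordered

  edge-≢ : ∀ {e} → e ∈ possible-edges → proj₁ e ≢ proj₂ e
  edge-≢ e∈ eq = Finₚ.<-irrefl eq (edge-< e∈)

  inc : Edge → List (Fin n) → Bool
  inc e K = memᵇ (proj₁ e) K ∧ memᵇ (proj₂ e) K

  eqᵇ : Edge → Edge → Bool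
  eqᵇ e f = ⌊ proj₁ e Fin.≟ proj₁ f ⌋ ∧ ⌊ proj₂ e Fin.≟ proj₂ f ⌋

  meet : List (Fin n) → List (Fin n) → Bool
  meet K′ K = any (λ e → inc e K) (pairs K′)

  eqᵇ-refl : ∀ e → eqᵇ e e ≡ true
  eqᵇ-refl (u , v) = ∧-intro (⌊≟⌋-refl u) (⌊≟⌋-refl v)

  eqᵇ-≢ : ∀ {e f} → e ≢ f → eqᵇ e f ≡ false
  eqᵇ-≢ {u , v} {u′ , v′} e≢f with u Fin.≟ u′ | v Fin.≟ v′
  ... | yes refl | yes refl = ⊥-elim (e≢f refl)
  ... | yes _    | no _     = refl
  ... | no _     | yes _    = refl
  ... | no _     | no _     = refl

  ∑-eqᵇ : ∀ {xs} → Unique xs → ∀ {e} → e ∈ xs → ∀ (φ : Edge → ℚ) → ∑ xs (λ f → [ eqᵇ e f ] * φ f) ≡ φ e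
  ∑-eqᵇ {x ∷ xs} (x∉ ∷ u) {e} (here refl) φ = trans (cong₂ _+_
      (trans (cong (λ b → [ b ] * φ x) (eqᵇ-refl x)) (*-identityˡ (φ x)))
      (trans (∑-cong xs (λ {f} f∈ → trans (cong (λ b → [ b ] * φ f) (eqᵇ-≢ {x} {f} (All.lookup x∉ f∈))) (*-zeroˡ (φ f)))) (∑-0 xs)))
    (+-identityʳ (φ x))
  ∑-eqᵇ {x ∷ xs} (x∉ ∷ u) {e} (there e∈) φ = trans (cong₂ _+_
      (trans (cong (λ b → [ b ] * φ x) (eqᵇ-≢ {e} {x} (λ { refl → All.lookup x∉ e∈ refl }))) (*-zeroˡ (φ x)))
      (∑-eqᵇ u e∈ φ))
    (+-identityˡ (φ e))

  -- With k = 3 + l, the bounds n^l for codegrees and n^(l+1) for degrees involve no truncated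
  -- subtraction; likewise `r′` is r - 1.
  k r : ℕ
  k = 3 ℕ.+ l
  r = triangle k

  r′ : ℕ
  r′ = (1 ℕ.+ l) ℕ.+ triangle (2 ℕ.+ l)

  r≡1+r′ : r ≡ suc r′
  r≡1+r′ = triangle-suc (2 ℕ.+ l)

  0<r : 0 ℕ.< r
  0<r = subst (0 ℕ.<_) (sym r≡1+r′) (s≤s z≤n)

  R L M : ℚ
  R = ι r
  L = ι (n ℕ.^ l)
  M = ι (n ℕ.^ suc l)

  possible-cliques : List (List (Fin n))
  possible-cliques = combinations k (allVertices n)

  edges : Graph n → List Edge
  edges G = filterᵇ (λ e → G (proj₁ e) (proj₂ e)) possible-edges

  hyperedges : Graph n → ℚ
  hyperedges G = ι (length (cliques k G))

  deg : Graph n → Edge → ℚ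
  deg G = Hypergraph.d (edges G) (cliques k G) inc eqᵇ meet

  deg-loss : Graph n → Edge → List (Fin n) → ℚ
  deg-loss G = Hypergraph.δ (edges G) (cliques k G) inc eqᵇ meet

  loss : Graph n → List (Fin n) → ℚ
  loss G = Hypergraph.Δ (edges G) (cliques k G) inc eqᵇ meet

  HasUniformCliques : Graph n → Set
  HasUniformCliques G = Hypergraph.IsUniformHypergraph (edges G) (cliques k G) inc eqᵇ meet R L

  clique-∈ : ∀ G {K} → K ∈ cliques k G → K ∈ possible-cliques × isClique G K ≡ true
  clique-∈ G = ∈-filterᵇ⁻ (isClique G) possible-cliques

  edges-∈ : ∀ G {e} → e ∈ edges G → e ∈ possible-edges
  edges-∈ G e∈ = proj₁ (∈-filterᵇ⁻ (λ e → G (proj₁ e) (proj₂ e)) possible-edges e∈)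

  edges-unique : ∀ G → Unique (edges G)
  edges-unique G = filterᵇ-unique _ (pairs-unique vertices-unique)

  edges-in-clique : ∀ {K} → K ∈ possible-cliques → filterᵇ (λ e → inc e K) possible-edges ≡ pairs K
  edges-in-clique {K} K∈ = trans (filterᵇ-pairs (λ v → memᵇ v K) (allVertices n))
    (cong pairs (filterᵇ-memᵇ vertices-unique (combinations-⊆ k (allVertices n) K∈)))

  clique-edge : ∀ G {K} → K ∈ cliques k G → ∀ {e} → e ∈ possible-edges → inc e K ≡ true → G (proj₁ e) (proj₂ e) ≡ true
  clique-edge G {K} K∈ e∈ inc≡ = let K∈′ , clique = clique-∈ G K∈ in
    all⁻ _ (pairs K) clique (subst (_ ∈_) (edges-in-clique K∈′) (∈-filterᵇ⁺ (λ e → inc e K) possible-edges e∈ inc≡))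

  ∑-edges-in-clique : ∀ G {K} → K ∈ cliques k G → ∀ φ → ∑ (edges G) (λ e → [ inc e K ] * φ e) ≡ ∑ (pairs K) φ
  ∑-edges-in-clique G {K} K∈ φ = trans (∑-filterᵇ (λ e → G (proj₁ e) (proj₂ e)) possible-edges (λ e → [ inc e K ] * φ e))
    (trans (∑-cong possible-edges present)
    (trans (sym (∑-filterᵇ (λ e → inc e K) possible-edges φ))
      (cong (λ xs → ∑ xs φ) (edges-in-clique (proj₁ (clique-∈ G K∈))))))
    where
    present : ∀ {e} → e ∈ possible-edges → [ G (proj₁ e) (proj₂ e) ] * ([ inc e K ] * φ e) ≡ [ inc e K ] * φ e
    present {e} e∈ with inc e K in eq
    ... | true  = trans (cong (λ b → [ b ] * (1ℚ * φ e)) (clique-edge G K∈ e∈ eq)) (*-identityˡ _)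
    ... | false = trans (cong ([ G (proj₁ e) (proj₂ e) ] *_) (*-zeroˡ (φ e)))
                    (trans (*-zeroʳ [ G (proj₁ e) (proj₂ e) ]) (sym (*-zeroˡ (φ e))))

  -- Two distinct edges span at least three vertices. Edges are listed with increasing endpoints,
  -- which rules out that `f` is `e` reversed.
  third-vertex : ∀ {e f} → e ∈ possible-edges → f ∈ possible-edges → e ≡ f ⊎
    Σ (Fin n) λ w → w ≢ proj₁ e × w ≢ proj₂ e × (∀ K → inc f K ≡ true → memᵇ w K ≡ true)
  third-vertex {u , v} {u′ , v′} e∈ f∈ with u′ Fin.≟ u | u′ Fin.≟ v
  ... | no u′≢u | no u′≢v = inj₂ (u′ , u′≢u , u′≢v , λ K h → proj₁ (∧-true h))
  ... | _ | yes refl = inj₂ (v′ , (λ { refl → Finₚ.<-asym (edge-< e∈) (edge-< f∈) }) ,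
                              (λ { refl → Finₚ.<-irrefl refl (edge-< f∈) }) , λ K h → proj₂ (∧-true h))
  ... | yes refl | no _ with v′ Fin.≟ v
  ...   | yes refl = inj₁ refl
  ...   | no v′≢v = inj₂ (v′ , (λ { refl → Finₚ.<-irrefl refl (edge-< f∈) }) , v′≢v , λ K h → proj₂ (∧-true h))

  ∑-cliques≤ : ∀ G {φ} → (∀ {K} → K ∈ possible-cliques → 0ℚ ≤ φ K) → ∑ (cliques k G) φ ≤ ∑ possible-cliques φ
  ∑-cliques≤ G {φ} 0≤φ = ≤-trans (≤-reflexive (∑-filterᵇ (isClique G) possible-cliques φ))
    (∑-mono possible-cliques (λ {K} K∈ → ≤-trans (*-monoʳ (0≤φ K∈) ([]≤1 (isClique G K))) (≤-reflexive (*-identityˡ (φ K)))))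

  -- A clique through both edges contains three fixed vertices, so at most n^l choices remain for
  -- its other l vertices.
  codegree≤L : ∀ G {e f} → e ∈ possible-edges → f ∈ possible-edges → e ≡ f ⊎ Hypergraph.cod (edges G) (cliques k G) inc eqᵇ meet e f ≤ L
  codegree≤L G {e@(u , v)} {f} e∈ f∈ with third-vertex e∈ f∈
  ... | inj₁ e≡f = inj₁ e≡f
  ... | inj₂ (w , w≢u , w≢v , w∈) = inj₂ (≤-trans
      (∑-cliques≤ G (λ {K} _ → 0≤* (0≤[] (inc e K)) (0≤[] (inc f K))))
      (≤-trans (∑-mono possible-cliques (λ {K} _ → []*[]≤[] (inc e K) (inc f K) _ (λ e≡ f≡ →
          ∧-intro (w∈ K f≡) (covered K e≡))))
      (≤-trans (≤-reflexive (∑-combinations-⊇ vertices-unique T-unique (λ {t} _ → ∈-allFin t) l (n ℕ.∸ 3) count))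
        (ι-mono (ℕₚ.≤-trans (choose≤^ (n ℕ.∸ 3) l) (ℕₚ.^-monoˡ-≤ l (ℕₚ.m∸n≤m n 3)))))))
    where
    T = w ∷ u ∷ v ∷ []
    covered : ∀ K → inc e K ≡ true → memᵇ u K ∧ memᵇ v K ∧ true ≡ true
    covered K h with memᵇ u K | memᵇ v K
    ... | true | true = refl
    T-unique : Unique T
    T-unique = (w≢u ∷ w≢v ∷ []) ∷ (edge-≢ e∈ ∷ []) ∷ [] ∷ []
    -- The three distinct vertices in `T` show that `n ∸ 3` is a true difference.
    3≤n : 3 ℕ.≤ n
    3≤n = subst₂ ℕ._≤_ (length-filterᵇ-memᵇ vertices-unique T-unique (λ {t} _ → ∈-allFin t)) length-vertices
      (Listₚ.length-filter _ (allVertices n))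
    count : n ℕ.∸ 3 ℕ.+ 3 ≡ length (allVertices n)
    count = trans (ℕₚ.m∸n+n≡m 3≤n) (sym length-vertices)

  uniform-cliques : ∀ G → HasUniformCliques G
  uniform-cliques G = record
    { uniform  = λ {K} K∈ → trans (∑-cong (edges G) (λ {e} _ → sym (*-identityʳ [ inc e K ])))
        (trans (∑-edges-in-clique G K∈ (λ _ → 1ℚ)) (trans (∑-1 (pairs K)) (cong ι (trans (length-pairs K)
          (cong triangle (combinations-length k (allVertices n) (proj₁ (clique-∈ G K∈))))))))
    ; codegree = λ e∈ f∈ → codegree≤L G (edges-∈ G e∈) (edges-∈ G f∈)
    ; eq-refl  = eqᵇ-refl
    ; eq-sum   = ∑-eqᵇ (edges-unique G)
    ; mt≤s     = λ {K′} {K} K′∈ K∈ → subst ([ meet K′ K ] ≤_) (sym (s≡ K K′∈)) (any≤∑ (λ e → inc e K) (pairs K′))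
    ; s≤mt+σ   = λ {K′} {K} K′∈ K∈ → subst (λ s → s ≤ [ meet K′ K ] + (s * s - s)) (sym (s≡ K K′∈))
        (∑≤any+∑²-∑ (λ e → inc e K) (pairs K′))
    ; 0≤L      = 0≤ι (n ℕ.^ l)
    }
    where
    s≡ : ∀ K {K′} → K′ ∈ cliques k G → Hypergraph.s (edges G) (cliques k G) inc eqᵇ meet K′ K ≡ ∑ (pairs K′) (λ e → [ inc e K ])
    s≡ K K′∈ = ∑-edges-in-clique G K′∈ (λ e → [ inc e K ])

  -- One step of the process

  edges-removeClique : ∀ G S → edges (removeClique G S) ≡ filterᵇ (λ e → not (inc e S)) (edges G)
  edges-removeClique G S = filterᵇ-∧ (λ e → G (proj₁ e) (proj₂ e)) (λ e → not (inc e S)) possible-edges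

  cliques-removeClique : ∀ G S → cliques k (removeClique G S) ≡ filterᵇ (λ K → not (meet K S)) (cliques k G)
  cliques-removeClique G S = trans
    (filterᵇ-cong possible-cliques (λ {K} _ → all-∧-not (λ e → G (proj₁ e) (proj₂ e)) (λ e → inc e S) (pairs K)))
    (filterᵇ-∧ (isClique G) (λ K → not (meet K S)) possible-cliques)

  d-removeClique : ∀ G S e → deg (removeClique G S) e ≡ deg G e - deg-loss G e S
  d-removeClique G S e = trans (cong (λ xs → ∑ xs (λ K → [ inc e K ])) (cliques-removeClique G S))
    (trans (∑-filterᵇ (λ K → not (meet K S)) (cliques k G) (λ K → [ inc e K ]))
    (trans (∑-cong (cliques k G) (λ {K} _ → trans (cong (_* [ inc e K ]) ([not] (meet K S))) (lem [ meet K S ] [ inc e K ])))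
      (∑-- (cliques k G) (λ K → [ inc e K ]) (λ K → [ inc e K ] * [ meet K S ]))))
    where
    lem : ∀ a b → (1ℚ - a) * b ≡ b - b * a
    lem = solve-∀ ℚ-ring

  Q-removeClique : ∀ G S → hyperedges (removeClique G S) ≡ hyperedges G - loss G S
  Q-removeClique G S = trans (cong (λ xs → ι (length xs)) (cliques-removeClique G S))
    (trans (ι-length-filterᵇ (λ K → not (meet K S)) (cliques k G))
    (trans (∑-cong (cliques k G) (λ {K} _ → [not] (meet K S)))
    (trans (∑-- (cliques k G) (λ _ → 1ℚ) (λ K → [ meet K S ])) (cong (_- loss G S) (∑-1 (cliques k G))))))

  A-removeClique : ∀ G {S} → S ∈ cliques k G → ι (edgeCount (removeClique G S)) ≡ ι (edgeCount G) - R
  A-removeClique G {S} S∈ = trans (cong (λ xs → ι (length xs)) (edges-removeClique G S))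
    (trans (ι-length-filterᵇ (λ e → not (inc e S)) (edges G))
    (trans (∑-cong (edges G) (λ {e} _ → [not] (inc e S)))
    (trans (∑-- (edges G) (λ _ → 1ℚ) (λ e → [ inc e S ]))
      (cong₂ _-_ (∑-1 (edges G)) (Hypergraph.IsUniformHypergraph.uniform (uniform-cliques G) S∈)))))

  edgeCount-removeClique : ∀ G {S} → S ∈ cliques k G → edgeCount (removeClique G S) ℕ.+ r ≡ edgeCount G
  edgeCount-removeClique G {S} S∈ = ι-injective (trans (ι-+ (edgeCount (removeClique G S)) r)
    (trans (cong (_+ R) (A-removeClique G S∈)) (lem (ι (edgeCount G)) R)))
    where
    lem : ∀ A R → A - R + R ≡ A
    lem = solve-∀ ℚ-ring

  ∑-edges-removeClique : ∀ G S φ → ∑ (edges (removeClique G S)) φ ≡ ∑ (edges G) (λ e → (1ℚ - [ inc e S ]) * φ e)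
  ∑-edges-removeClique G S φ = trans (cong (λ xs → ∑ xs φ) (edges-removeClique G S))
    (trans (∑-filterᵇ (λ e → not (inc e S)) (edges G) φ)
      (∑-cong (edges G) (λ {e} _ → cong (_* φ e) ([not] (inc e S)))))

  -- The complete graph

  edges-complete : edges (completeGraph n) ≡ possible-edges
  edges-complete = filterᵇ-true possible-edges (λ {e} e∈ → cong not (⌊≟⌋-≢ (proj₁ e) (proj₂ e) (edge-≢ e∈)))

  cliques-complete : cliques k (completeGraph n) ≡ possible-cliques
  cliques-complete = filterᵇ-true possible-cliques (λ {K} K∈ → all⁺ _ (pairs K) (λ {e} e∈ →
    cong not (⌊≟⌋-≢ (proj₁ e) (proj₂ e)
      (edge-≢ (proj₁ (∈-filterᵇ⁻ (λ e → inc e K) possible-edges (subst (e ∈_) (sym (edges-in-clique K∈)) e∈)))))))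

  edgeCount-complete : edgeCount (completeGraph n) ≡ triangle n
  edgeCount-complete = trans (cong length edges-complete) (trans (length-pairs (allVertices n)) (cong triangle length-vertices))

  d-complete : ∀ u → u ℕ.+ 2 ≡ n → ∀ {e} → e ∈ possible-edges → deg (completeGraph n) e ≡ ι (choose u (suc l))
  d-complete u u+2≡n {e@(v , w)} e∈ = trans (cong (λ xs → ∑ xs (λ K → [ inc e K ])) cliques-complete)
    (trans (∑-cong possible-cliques (λ {K} _ → cong [_] (cong (memᵇ v K ∧_) (sym (∧-identityʳ (memᵇ w K))))))
      (∑-combinations-⊇ vertices-unique ((edge-≢ e∈ ∷ []) ∷ [] ∷ []) (λ {t} _ → ∈-allFin t) (suc l) u
        (trans u+2≡n (sym length-vertices))))
    where
    ∧-identityʳ : ∀ b → b ∧ true ≡ b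
    ∧-identityʳ true  = refl
    ∧-identityʳ false = refl

  d≤M : ∀ G {e} → e ∈ possible-edges → deg G e ≤ M
  d≤M G {e} e∈ = ≤-trans (∑-cliques≤ G (λ {K} _ → 0≤[] (inc e K)))
    (≤-trans (≤-reflexive (trans (cong (λ xs → ∑ xs (λ K → [ inc e K ])) (sym cliques-complete))
        (d-complete (n ℕ.∸ 2) (ℕₚ.m∸n+n≡m 2≤n) e∈)))
      (ι-mono (ℕₚ.≤-trans (choose≤^ (n ℕ.∸ 2) (suc l)) (ℕₚ.^-monoˡ-≤ (suc l) (ℕₚ.m∸n≤m n 2)))))
    where
    2≤n : 2 ℕ.≤ n
    2≤n = subst₂ ℕ._≤_ (length-filterᵇ-memᵇ vertices-unique {proj₁ e ∷ proj₂ e ∷ []} ((edge-≢ e∈ ∷ []) ∷ [] ∷ []) (λ {t} _ → ∈-allFin t))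
      length-vertices (Listₚ.length-filter _ (allVertices n))

  -- The stopped supermartingale

  module Process (j : ℕ) (P : Graph n → Bool) (η κ₀ B Th : ℚ) where

    q e₀ : ℕ
    q  = 2 ℕ.+ (j ℕ.+ j)
    e₀ = suc (r′ ℕ.* q)

    av : Graph n → ℚ
    av G = R * hyperedges G * 1/ι (edgeCount G)

    -- The number of edges never exceeds `triangle n`, so the noise R · `noise` of one step is at
    -- most R/A times `S₀`. Thus the additive noise is absorbed by letting Φ + S₀ grow by the same
    -- factor as Φ.
    noise S₀ : ℚ
    noise = step-constant j R * (L * M) ^ (1 ℕ.+ j)
    S₀    = noise * ι (triangle n)

    Φ Ψ : Graph n → ℚ
    Φ G = ∑ (edges G) (λ e → even-power j (deg G e - av G))
    Ψ G = ι (edgeCount G) * (Φ G + S₀)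

    -- The lower bound (κ₀ / B) A^e₀ for the q-th power of the average degree, cleared of its
    -- denominator.
    Dense : Graph n → Set
    Dense G = κ₀ * ι (edgeCount G) ^ e₀ ≤ av G ^ q * B

    -- `P` is the desired event, and its failure supplies lower bounds on the number of edges.
    -- `large-n` yields a m ≤ L through M = n L, `large-r` makes R/A small, and `large-A` converts
    -- `Dense` into Th ≤ (η m)^q.
    record Parameters : Set where
      field
        0<n     : 0 ℕ.< n
        0≤η     : 0ℚ ≤ η
        η≤1     : η ≤ 1ℚ
        η-small : (+ 6 / 1) * ι q * R * η ≤ 1ℚ
        0<κ₀    : 0ℚ < κ₀
        0<B     : 0ℚ < B
        0≤Th    : 0ℚ ≤ Th
        P-mono  : ∀ G S → P G ≡ true → P (removeClique G S) ≡ true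
        large-n : ∀ G → P G ≡ false → n ℕ.≤ edgeCount G
        large-r : ∀ G → P G ≡ false → 2 ℕ.* (q ℕ.* (r ℕ.* (r ℕ.* r)) ℕ.+ r ℕ.* r) ℕ.≤ edgeCount G
        large-A : ∀ G → P G ≡ false → Th * B ≤ η ^ q * (κ₀ * ι (edgeCount G) ^ e₀)

    module _ (params : Parameters) where

      open Parameters params
      open ℚₚ.≤-Reasoning

      0≤L : 0ℚ ≤ L
      0≤L = 0≤ι (n ℕ.^ l)

      0≤R : 0ℚ ≤ R
      0≤R = 0≤ι r

      1≤R : 1ℚ ≤ R
      1≤R = ≤-trans (≤-reflexive (sym (+-identityʳ 1ℚ))) (ι-mono 0<r)

      0≤noise : 0ℚ ≤ noise
      0≤noise = 0≤* (0≤step-constant j 0≤R) (0≤^ (1 ℕ.+ j) (0≤* 0≤L (0≤ι (n ℕ.^ suc l))))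

      0≤S₀ : 0ℚ ≤ S₀
      0≤S₀ = 0≤* 0≤noise (0≤ι (triangle n))

      0≤Φ : ∀ G → 0ℚ ≤ Φ G
      0≤Φ G = 0≤∑ (edges G) (λ {e} _ → 0≤even-power j (deg G e - av G))

      0≤Ψ : ∀ G → 0ℚ ≤ Ψ G
      0≤Ψ G = 0≤* (0≤ι (edgeCount G)) (0≤+ (0≤Φ G) 0≤S₀)

      0≤av : ∀ G → 0ℚ ≤ av G
      0≤av G = 0≤* (0≤* 0≤R (0≤ι (length (cliques k G)))) (0≤1/ι (edgeCount G))

      module Running (G : Graph n) (PG : P G ≡ false) (dense : Dense G) where

        m : ℕ
        m = edgeCount G

        A a μ Q : ℚ
        A = ι m
        a = 1/ι m
        μ = av G
        Q = hyperedges G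

        0<m : 0 ℕ.< m
        0<m = ℕₚ.<-≤-trans 0<n (large-n G PG)

        0≤A : 0ℚ ≤ A
        0≤A = 0≤ι m

        0≤a : 0ℚ ≤ a
        0≤a = 0≤1/ι m

        0≤Q : 0ℚ ≤ Q
        0≤Q = 0≤ι (length (cliques k G))

        1≤A : 1ℚ ≤ A
        1≤A = ≤-trans (≤-reflexive (sym (+-identityʳ 1ℚ))) (ι-mono 0<m)

        Aa≡1 : A * a ≡ 1ℚ
        Aa≡1 = ι*1/ι≡1 0<m

        Aμ≡RQ : A * μ ≡ R * Q
        Aμ≡RQ = trans (lem A R Q a) (trans (cong (R * Q *_) Aa≡1) (*-identityʳ (R * Q)))
          where
          lem : ∀ A R Q a → A * (R * Q * a) ≡ R * Q * (A * a)
          lem = solve-∀ ℚ-ring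

        Th≤[ημ]^q : Th ≤ (η * μ) ^ q
        Th≤[ημ]^q = *-cancelˡ 0<B (begin
          B * Th                          ≡⟨ *-comm B Th ⟩
          Th * B                          ≤⟨ large-A G PG ⟩
          η ^ q * (κ₀ * A ^ e₀)           ≤⟨ *-monoˡ (0≤^ q 0≤η) dense ⟩
          η ^ q * (μ ^ q * B)             ≡⟨ lem (η ^ q) (μ ^ q) B ⟩
          B * (η ^ q * μ ^ q)             ≡⟨ cong (B *_) (^-*-distrib η μ q) ⟨
          B * (η * μ) ^ q                 ∎)
          where
          lem : ∀ u v B → u * (v * B) ≡ B * (u * v)
          lem = solve-∀ ℚ-ring

        -- The summand of a single bad edge already reaches the threshold.
        bad : ∀ {e} → e ∈ edges G → η * μ ≤ ∣ deg G e - μ ∣ → Th ≤ Ψ G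
        bad {e} e∈ le = begin
          Th                                ≤⟨ Th≤[ημ]^q ⟩
          (η * μ) ^ q                       ≤⟨ ^-mono q (0≤* 0≤η (0≤av G)) le ⟩
          ∣ x ∣ ^ q                          ≡⟨ trans (even-power≡^ j ∣ x ∣) (cong (λ z → z * z ^ j) (∣p∣*∣p∣≡p*p x)) ⟩
          even-power j x                    ≤⟨ ∑-single-≤ (edges G) (λ {f} _ → 0≤even-power j (deg G f - μ)) e∈ ⟩
          Φ G                               ≤⟨ ≤-by S₀ 0≤S₀ refl ⟩
          Φ G + S₀                          ≡⟨ *-identityˡ (Φ G + S₀) ⟨
          1ℚ * (Φ G + S₀)                   ≤⟨ *-monoʳ (0≤+ (0≤Φ G) 0≤S₀) 1≤A ⟩
          Ψ G                               ∎
          where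
          x = deg G e - μ

        -- Without cliques the average degree would be 0, against `Dense`; so the process cannot
        -- stop while `P` fails and `Dense` holds.
        0<cliques : 0 ℕ.< length (cliques k G)
        0<cliques = ℕₚ.n≢0⇒n>0 λ eq → ℚₚ.<-irrefl refl (<-≤-trans 0<κA (≤-trans dense (≤-reflexive (begin-equality
            μ ^ q * B                     ≡⟨ cong (λ z → z ^ q * B) (μ≡0 eq) ⟩
            0ℚ * 0ℚ ^ suc (j ℕ.+ j) * B   ≡⟨ cong (_* B) (*-zeroˡ (0ℚ ^ suc (j ℕ.+ j))) ⟩
            0ℚ * B                        ≡⟨ *-zeroˡ B ⟩
            0ℚ                            ∎))))
          where
          0<κA : 0ℚ < κ₀ * A ^ e₀
          0<κA = 0<* 0<κ₀ (0<^ e₀ (<-≤-trans (ℚₚ.positive⁻¹ 1ℚ) 1≤A))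
          μ≡0 : length (cliques k G) ≡ 0 → μ ≡ 0ℚ
          μ≡0 eq = trans (cong (λ z → R * ι z * a) eq) (trans (cong (_* a) (*-zeroʳ R)) (*-zeroˡ a))

        m′ : ℕ
        m′ = m ℕ.∸ r

        -- The coefficient of `a` in `small` once `τ` is eliminated. `large-r` bounds its product
        -- with `a` by 1/2, and `η-small` bounds the rest by 1/6.
        cubic : ℕ
        cubic = q ℕ.* (r ℕ.* (r ℕ.* r)) ℕ.+ r ℕ.* r

        r≤cubic : r ℕ.≤ cubic
        r≤cubic = ℕₚ.≤-trans (ℕₚ.m≤m*n r r {{ℕ.>-nonZero 0<r}}) (ℕₚ.m≤n+m (r ℕ.* r) (q ℕ.* (r ℕ.* (r ℕ.* r))))

        r+r≤m : r ℕ.+ r ℕ.≤ m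
        r+r≤m = ℕₚ.≤-trans (ℕₚ.+-mono-≤ r≤cubic (ℕₚ.≤-trans r≤cubic (ℕₚ.≤-reflexive (sym (ℕₚ.+-identityʳ cubic))))) (large-r G PG)

        r≤m : r ℕ.≤ m
        r≤m = ℕₚ.≤-trans (ℕₚ.m≤m+n r r) r+r≤m

        r≤m′ : r ℕ.≤ m′
        r≤m′ = ℕₚ.≤-trans (ℕₚ.≤-reflexive (sym (ℕₚ.m+n∸n≡m r r))) (ℕₚ.∸-monoˡ-≤ r r+r≤m)

        a′ : ℚ
        a′ = 1/ι m′

        0≤a′ : 0ℚ ≤ a′
        0≤a′ = 0≤1/ι m′

        A≡ : A ≡ ι m′ + R
        A≡ = trans (cong ι (sym (ℕₚ.m∸n+n≡m r≤m))) (ι-+ m′ r)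

        A′a′≡1 : ι m′ * a′ ≡ 1ℚ
        A′a′≡1 = ι*1/ι≡1 (ℕₚ.<-≤-trans 0<r r≤m′)

        Aa′≡ : A * a′ ≡ 1ℚ + R * a′
        Aa′≡ = trans (cong (_* a′) A≡) (trans (ℚₚ.*-distribʳ-+ a′ (ι m′) R) (cong (_+ R * a′) A′a′≡1))

        a′≤2a : a′ ≤ 2ℚ * a
        a′≤2a = begin
          a′                      ≡⟨ *-identityˡ a′ ⟨
          1ℚ * a′                 ≡⟨ cong (_* a′) Aa≡1 ⟨
          A * a * a′              ≡⟨ lem A a a′ ⟩
          a * (A * a′)            ≡⟨ cong (a *_) Aa′≡ ⟩
          a * (1ℚ + R * a′)       ≤⟨ *-monoˡ 0≤a (+-monoʳ-≤ 1ℚ (≤-trans (*-monoʳ 0≤a′ (ι-mono r≤m′)) (≤-reflexive A′a′≡1))) ⟩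
          a * 2ℚ                  ≡⟨ *-comm a 2ℚ ⟩
          2ℚ * a                  ∎
          where
          lem : ∀ A a b → A * a * b ≡ a * (A * b)
          lem = solve-∀ ℚ-ring

        μ≤M : μ ≤ M
        μ≤M = begin
          R * Q * a                   ≡⟨ cong (_* a) (Hypergraph.Counting.∑d≡R*Q (edges G) (cliques k G) inc eqᵇ meet (uniform-cliques G)) ⟨
          ∑ (edges G) (deg G) * a     ≤⟨ *-monoʳ 0≤a (≤-trans (∑-mono (edges G) (λ e∈ → d≤M G (edges-∈ G e∈))) (≤-reflexive (∑-const (edges G) M))) ⟩
          A * M * a                   ≡⟨ lem A M a ⟩
          A * a * M                   ≡⟨ cong (_* M) Aa≡1 ⟩
          1ℚ * M                      ≡⟨ *-identityˡ M ⟩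
          M                           ∎
          where
          lem : ∀ A M a → A * M * a ≡ A * a * M
          lem = solve-∀ ℚ-ring

        aμ≤L : a * μ ≤ L
        aμ≤L = begin
          a * μ               ≤⟨ *-monoˡ 0≤a μ≤M ⟩
          a * M               ≡⟨ cong (a *_) (ι-* n (n ℕ.^ l)) ⟩
          a * (ι n * L)       ≤⟨ *-monoˡ 0≤a (*-monoʳ 0≤L (ι-mono (large-n G PG))) ⟩
          a * (A * L)         ≡⟨ lem a A L ⟩
          A * a * L           ≡⟨ cong (_* L) Aa≡1 ⟩
          1ℚ * L              ≡⟨ *-identityˡ L ⟩
          L                   ∎
          where
          lem : ∀ a A L → a * (A * L) ≡ A * a * L
          lem = solve-∀ ℚ-ring

        L≤M : L ≤ M
        L≤M = ι-mono (ℕₚ.≤-trans (ℕₚ.≤-reflexive (sym (ℕₚ.*-identityˡ (n ℕ.^ l)))) (ℕₚ.*-monoˡ-≤ (n ℕ.^ l) 0<n))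

        ec-removeClique : ∀ {S} → S ∈ cliques k G → edgeCount (removeClique G S) ≡ m′
        ec-removeClique {S} S∈ = trans (sym (ℕₚ.m+n∸n≡m (edgeCount (removeClique G S)) r))
          (cong (ℕ._∸ r) (edgeCount-removeClique G S∈))

        module Good (good : ∀ {e} → e ∈ edges G → ∣ deg G e - μ ∣ ≤ η * μ) where

          balanced : Hypergraph.Counting.IsBalanced (edges G) (cliques k G) inc eqᵇ meet (uniform-cliques G) M a a′ μ η j
          balanced = record
            { 1≤R = 1≤R ; 0≤a = 0≤a ; 0≤a′ = 0≤a′ ; 0≤m = 0≤av G ; Aa≡1 = Aa≡1 ; Am≡RQ = Aμ≡RQ ; Aa′≡ = Aa′≡
            ; a′≤2a = a′≤2a ; am≤L = aμ≤L ; L≤M = L≤M ; m≤M = μ≤M ; 0≤η = 0≤η ; η≤1 = η≤1 ; η-small = η-small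
            ; good = good }

          x′ : Edge → List (Fin n) → ℚ
          x′ e S = deg G e - deg-loss G e S - R * (Q - loss G S) * a′

          av-removeClique : ∀ {S} → S ∈ cliques k G → av (removeClique G S) ≡ R * (Q - loss G S) * a′
          av-removeClique {S} S∈ = cong₂ (λ u v → R * u * 1/ι v) (Q-removeClique G S) (ec-removeClique S∈)

          Φ-removeClique : ∀ {S} → S ∈ cliques k G →
            Φ (removeClique G S) ≡ ∑ (edges G) (λ e → (1ℚ - [ inc e S ]) * even-power j (x′ e S))
          Φ-removeClique {S} S∈ = trans (∑-edges-removeClique G S (λ e → even-power j (deg (removeClique G S) e - av (removeClique G S))))
            (∑-cong (edges G) (λ {e} _ → cong (λ z → (1ℚ - [ inc e S ]) * even-power j z)
              (cong₂ _-_ (d-removeClique G S e) (av-removeClique S∈))))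

          ∑Φ≤ : ∑ (cliques k G) (λ S → Φ (removeClique G S)) ≤ Q * Φ G + μ * (Φ G + A * noise)
          ∑Φ≤ = ≤-trans (≤-reflexive (∑-cong (cliques k G) Φ-removeClique)) (Hypergraph.Counting.OneStep.one-step (edges G) (cliques k G) inc eqᵇ meet (uniform-cliques G) balanced)

          m≤triangle : m ℕ.≤ triangle n
          m≤triangle = ℕₚ.≤-trans (Listₚ.length-filter _ possible-edges)
            (ℕₚ.≤-reflexive (trans (length-pairs (allVertices n)) (cong triangle length-vertices)))

          -- On average Φ + S₀ grows by at most the factor 1 + R/A, while the number of edges passes
          -- from A to A - R, and (A - R)(1 + R/A) ≤ A.
          supermartingale : ∑ (cliques k G) (λ S → Ψ (removeClique G S)) ≤ Q * Ψ G
          supermartingale = begin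
            ∑ (cliques k G) (λ S → Ψ (removeClique G S))
              ≡⟨ ∑-cong (cliques k G) (λ {S} S∈ → cong (λ z → ι z * (Φ (removeClique G S) + S₀)) (ec-removeClique S∈)) ⟩
            ∑ (cliques k G) (λ S → ι m′ * (Φ (removeClique G S) + S₀))
              ≡⟨ trans (∑-*ˡ (cliques k G) (ι m′) (λ S → Φ (removeClique G S) + S₀)) (cong (ι m′ *_)
                   (trans (∑-+ (cliques k G) (λ S → Φ (removeClique G S)) (λ _ → S₀)) (cong (λ z → ∑ (cliques k G) (λ S → Φ (removeClique G S)) + z) (∑-const (cliques k G) S₀)))) ⟩
            ι m′ * (∑ (cliques k G) (λ S → Φ (removeClique G S)) + Q * S₀)
              ≤⟨ *-monoˡ (0≤ι m′) (+-monoˡ-≤ (Q * S₀) ∑Φ≤) ⟩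
            ι m′ * (Q * Φ G + R * Q * a * (Φ G + A * noise) + Q * S₀)
              ≡⟨ lem₁ (ι m′) Q (Φ G) R a A noise S₀ ⟩
            ι m′ * Q * (Φ G + R * a * Φ G + R * ((A * a) * noise) + S₀)
              ≤⟨ *-monoˡ (0≤* (0≤ι m′) 0≤Q) (+-monoˡ-≤ S₀ (+-monoʳ-≤ (Φ G + R * a * Φ G) (*-monoˡ 0≤R noise≤))) ⟩
            ι m′ * Q * (Φ G + R * a * Φ G + R * (a * S₀) + S₀)
              ≡⟨ lem₂ (ι m′) Q (Φ G) R a S₀ ⟩
            (Q * (Φ G + S₀)) * (ι m′ * (1ℚ + R * a))
              ≤⟨ *-monoˡ (0≤* 0≤Q (0≤+ (0≤Φ G) 0≤S₀)) A′[1+Ra]≤A ⟩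
            (Q * (Φ G + S₀)) * A
              ≡⟨ lem₃ Q (Φ G + S₀) A ⟩
            Q * Ψ G ∎
            where
            lem₁ : ∀ A′ Q F R a A E S → A′ * (Q * F + R * Q * a * (F + A * E) + Q * S)
              ≡ A′ * Q * (F + R * a * F + R * ((A * a) * E) + S)
            lem₁ = solve-∀ ℚ-ring
            lem₂ : ∀ A′ Q F R a S → A′ * Q * (F + R * a * F + R * (a * S) + S) ≡ (Q * (F + S)) * (A′ * (1ℚ + R * a))
            lem₂ = solve-∀ ℚ-ring
            lem₃ : ∀ Q F A → (Q * F) * A ≡ Q * (A * F)
            lem₃ = solve-∀ ℚ-ring
            lem₄ : ∀ A a E → A * a * E ≡ a * (E * A)
            lem₄ = solve-∀ ℚ-ring
            noise≤ : (A * a) * noise ≤ a * S₀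
            noise≤ = ≤-trans (≤-reflexive (lem₄ A a noise)) (*-monoˡ 0≤a (*-monoˡ 0≤noise (ι-mono m≤triangle)))
            lem₅ : ∀ A′ R a → A′ * (1ℚ + R * a) + R * R * a ≡ A′ + R * ((A′ + R) * a)
            lem₅ = solve-∀ ℚ-ring
            A′[1+Ra]≤A : ι m′ * (1ℚ + R * a) ≤ A
            A′[1+Ra]≤A = ≤-by (R * R * a) (0≤* (0≤* 0≤R 0≤R) 0≤a) (begin-equality
              ι m′ * (1ℚ + R * a) + R * R * a     ≡⟨ lem₅ (ι m′) R a ⟩
              ι m′ + R * ((ι m′ + R) * a)         ≡⟨ cong (λ z → ι m′ + R * (z * a)) A≡ ⟨
              ι m′ + R * (A * a)                  ≡⟨ cong (λ z → ι m′ + R * z) Aa≡1 ⟩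
              ι m′ + R * 1ℚ                       ≡⟨ cong (λ z → ι m′ + z) (*-identityʳ R) ⟩
              ι m′ + R                            ≡⟨ A≡ ⟨
              A                                   ∎)

          cubic*a≤½ : (ι q * (R * R * R) + R * R) * a ≤ ℚ.½
          cubic*a≤½ = *-cancelˡ (ℚₚ.positive⁻¹ 2ℚ) (begin
            2ℚ * ((ι q * (R * R * R) + R * R) * a)   ≡⟨ lem (ι q) R a ⟩
            2ℚ * (ι q * (R * (R * R)) + R * R) * a   ≡⟨ cong (λ z → 2ℚ * z * a) cubic≡ ⟨
            2ℚ * ι cubic * a                         ≡⟨ cong (_* a) (ι-* 2 cubic) ⟨
            ι (2 ℕ.* cubic) * a                      ≤⟨ *-monoʳ 0≤a (ι-mono (large-r G PG)) ⟩
            A * a                                    ≡⟨ Aa≡1 ⟩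
            1ℚ                                       ∎)
            where
            lem : ∀ q R a → 2ℚ * ((q * (R * R * R) + R * R) * a) ≡ 2ℚ * (q * (R * (R * R)) + R * R) * a
            lem = solve-∀ ℚ-ring
            cubic≡ : ι cubic ≡ ι q * (R * (R * R)) + R * R
            cubic≡ = trans (ι-+ (q ℕ.* (r ℕ.* (r ℕ.* r))) (r ℕ.* r)) (cong₂ _+_
              (trans (ι-* q (r ℕ.* (r ℕ.* r))) (cong (ι q *_) (trans (ι-* r (r ℕ.* r)) (cong (R *_) (ι-* r r))))) (ι-* r r))

          Ra≤½ : R * a ≤ ℚ.½
          Ra≤½ = ≤-trans (*-monoʳ 0≤a R≤) cubic*a≤½
            where
            R≤ : R ≤ ι q * (R * R * R) + R * R
            R≤ = ≤-trans (≤-reflexive (sym (*-identityˡ R))) (≤-trans (*-monoʳ 0≤R 1≤R)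
              (≤-by (ι q * (R * R * R)) (0≤* (0≤ι q) (0≤* (0≤* 0≤R 0≤R) 0≤R)) (+-comm (R * R) (ι q * (R * R * R)))))

          -- The t of the Bernoulli estimates, for z = R a.
          τ : ℚ
          τ = R * a * 1/ι q

          0≤τ : 0ℚ ≤ τ
          0≤τ = 0≤* (0≤* 0≤R 0≤a) (0≤1/ι q)

          qτ≡Ra : ι q * τ ≡ R * a
          qτ≡Ra = trans (lem (ι q) (R * a) (1/ι q)) (trans (cong (R * a *_) (ι*1/ι≡1 {q} (s≤s z≤n))) (*-identityʳ (R * a)))
            where
            lem : ∀ q u v → q * (u * v) ≡ u * (q * v)
            lem = solve-∀ ℚ-ring

          τ≤1 : τ ≤ 1ℚ
          τ≤1 = begin
            τ          ≡⟨ *-identityˡ τ ⟨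
            1ℚ * τ     ≤⟨ *-monoʳ 0≤τ (≤-trans (≤-reflexive (sym (+-identityʳ 1ℚ))) (ι-mono {1} {q} (s≤s z≤n))) ⟩
            ι q * τ    ≡⟨ qτ≡Ra ⟩
            R * a      ≤⟨ Ra≤½ ⟩
            ℚ.½        ≤⟨ from-yes (ℚ.½ ℚₚ.≤? 1ℚ) ⟩
            1ℚ         ∎

          0<1-Ra : 0ℚ < 1ℚ - R * a
          0<1-Ra = <-≤-trans (ℚₚ.positive⁻¹ ℚ.½) (+-monoʳ-≤ 1ℚ (neg-antimono-≤ Ra≤½))

          small : ι q * (R * R * (R * a) + R * τ + R * η) ≤ 1ℚ
          small = begin
            ι q * (R * R * (R * a) + R * τ + R * η)                              ≡⟨ lem (ι q) R a τ η ⟩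
            ι q * (R * R * R) * a + R * (ι q * τ) + ℚ⅙ * ((+ 6 / 1) * ι q * R * η) ≡⟨ cong (λ z → ι q * (R * R * R) * a + R * z + ℚ⅙ * ((+ 6 / 1) * ι q * R * η)) qτ≡Ra ⟩
            ι q * (R * R * R) * a + R * (R * a) + ℚ⅙ * ((+ 6 / 1) * ι q * R * η)   ≡⟨ lem′ (ι q) R a ((+ 6 / 1) * ι q * R * η) ⟩
            (ι q * (R * R * R) + R * R) * a + ℚ⅙ * ((+ 6 / 1) * ι q * R * η)       ≤⟨ +-mono-≤ cubic*a≤½ (*-monoˡ (0≤lit ℚ⅙) η-small) ⟩
            ℚ.½ + ℚ⅙ * 1ℚ                                                        ≤⟨ from-yes (ℚ.½ + ℚ⅙ * 1ℚ ℚₚ.≤? 1ℚ) ⟩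
            1ℚ                                                                   ∎
            where
            ℚ⅙ = + 1 / 6
            lem : ∀ q R a τ η → q * (R * R * (R * a) + R * τ + R * η) ≡ q * (R * R * R) * a + R * (q * τ) + ℚ⅙ * ((+ 6 / 1) * q * R * η)
            lem = solve-∀ ℚ-ring
            lem′ : ∀ q R a u → q * (R * R * R) * a + R * (R * a) + ℚ⅙ * u ≡ (q * (R * R * R) + R * R) * a + ℚ⅙ * u
            lem′ = solve-∀ ℚ-ring

          -- The number of edges is multiplied by exactly 1 - R a, and `average-after` allows the
          -- q-th power of the average degree to lose no more than the power e₀ of this factor.
          dense-removeClique : ∀ {S} → S ∈ cliques k G → Dense (removeClique G S)
          dense-removeClique {S} S∈ = begin
            κ₀ * ι (edgeCount (removeClique G S)) ^ e₀      ≡⟨ cong (λ z → κ₀ * ι z ^ e₀) (ec-removeClique S∈) ⟩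
            κ₀ * ι m′ ^ e₀                                  ≡⟨ cong (λ z → κ₀ * z ^ e₀) A′≡ ⟩
            κ₀ * (A * (1ℚ - R * a)) ^ e₀                    ≡⟨ cong (κ₀ *_) (^-*-distrib A (1ℚ - R * a) e₀) ⟩
            κ₀ * (A ^ e₀ * (1ℚ - R * a) ^ e₀)               ≡⟨ *-assoc κ₀ (A ^ e₀) ((1ℚ - R * a) ^ e₀) ⟨
            κ₀ * A ^ e₀ * (1ℚ - R * a) ^ e₀                 ≤⟨ *-monoʳ (0≤^ e₀ (<⇒≤ 0<1-Ra)) dense ⟩
            μ ^ q * B * (1ℚ - R * a) ^ e₀                   ≡⟨ lem (μ ^ q) B ((1ℚ - R * a) ^ e₀) ⟩
            μ ^ q * (1ℚ - R * a) ^ e₀ * B                   ≤⟨ *-monoʳ (<⇒≤ 0<B) (Hypergraph.Counting.OneStep.average-after (edges G) (cliques k G) inc eqᵇ meet (uniform-cliques G) balanced r′ (cong ι r≡1+r′) 0≤τ τ≤1 0<1-Ra qτ≡Ra small S∈) ⟩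
            (R * (Q - loss G S) * a′) ^ q * B                ≡⟨ cong (λ z → z ^ q * B) (av-removeClique S∈) ⟨
            av (removeClique G S) ^ q * B                   ∎
            where
            lem : ∀ u B v → u * B * v ≡ u * v * B
            lem = solve-∀ ℚ-ring
            lem′ : ∀ A′ R A a → A′ + R - R * (A * a) ≡ A′ + R * (1ℚ - A * a)
            lem′ = solve-∀ ℚ-ring
            lem″ : ∀ A R a → A * (1ℚ - R * a) ≡ A - R * (A * a)
            lem″ = solve-∀ ℚ-ring
            lem‴ : ∀ A′ R → A′ + R - R * 1ℚ ≡ A′
            lem‴ = solve-∀ ℚ-ring
            A′≡ : ι m′ ≡ A * (1ℚ - R * a)
            A′≡ = sym (trans (lem″ A R a) (trans (cong₂ (λ u v → u - R * v) A≡ Aa≡1) (lem‴ (ι m′) R)))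

          next : ∀ fuel → (∀ {S} → S ∈ cliques k G → Th ≤ Ψ (removeClique G S) + Th * probFinal k fuel (removeClique G S) P) →
            Th ≤ Ψ G + Th * probFinal k (suc fuel) G P
          next fuel ih = *-cancelˡ (0<ι 0<cliques) (begin
            Q * Th
              ≡⟨ ∑-const (cliques k G) Th ⟨
            ∑ (cliques k G) (λ _ → Th)
              ≤⟨ ∑-mono (cliques k G) ih ⟩
            ∑ (cliques k G) (λ S → Ψ (removeClique G S) + Th * probFinal k fuel (removeClique G S) P)
              ≡⟨ trans (∑-+ (cliques k G) (λ S → Ψ (removeClique G S)) (λ S → Th * probFinal k fuel (removeClique G S) P))
                   (cong (λ z → ∑ (cliques k G) (λ S → Ψ (removeClique G S)) + z)
                     (trans (∑-*ˡ (cliques k G) Th (λ S → probFinal k fuel (removeClique G S) P))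
                       (cong (Th *_) (sym (length*probFinal k P fuel G 0<cliques))))) ⟩
            ∑ (cliques k G) (λ S → Ψ (removeClique G S)) + Th * (Q * probFinal k (suc fuel) G P)
              ≤⟨ +-monoˡ-≤ (Th * (Q * probFinal k (suc fuel) G P)) supermartingale ⟩
            Q * Ψ G + Th * (Q * probFinal k (suc fuel) G P)
              ≡⟨ lem Q (Ψ G) Th (probFinal k (suc fuel) G P) ⟩
            Q * (Ψ G + Th * probFinal k (suc fuel) G P) ∎)
            where
            lem : ∀ Q F T p → Q * F + T * (Q * p) ≡ Q * (F + T * p)
            lem = solve-∀ ℚ-ring

      -- Markov's inequality for the stopped supermartingale, in the form Th · (failure probability)
      -- ≤ Ψ. Once `P` holds it persists and the probability is 1; at a bad edge Ψ alone reaches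
      -- `Th`; otherwise the inequality for the successors is averaged.
      process : ∀ fuel G → edgeCount G ℕ.≤ fuel → Dense G → Th ≤ Ψ G + Th * probFinal k fuel G P
      process fuel G ≤fuel dense = go (P G) refl fuel ≤fuel
        where
        go : ∀ b → P G ≡ b → ∀ fuel → edgeCount G ℕ.≤ fuel → Th ≤ Ψ G + Th * probFinal k fuel G P
        go true PG fuel _ = begin
          Th                                 ≡⟨ lem Th ⟩
          0ℚ + Th * 1ℚ                       ≤⟨ +-mono-≤ (0≤Ψ G) (*-monoˡ 0≤Th (1≤probFinal k P P-mono fuel G PG)) ⟩
          Ψ G + Th * probFinal k fuel G P    ∎
          where
          lem : ∀ t → t ≡ 0ℚ + t * 1ℚ
          lem = solve-∀ ℚ-ring
        -- The fuel bounds the number of edges and cannot be exhausted, since edges remain as long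
        -- as `P` fails.
        go false PG zero ≤0 = ⊥-elim (ℕₚ.<-irrefl refl (ℕₚ.<-≤-trans (Running.0<m G PG dense) ≤0))
        go false PG (suc fuel) ≤fuel with dichotomy (λ e → ∣ deg G e - av G ∣) (η * av G) (edges G)
        ... | inj₂ (e , e∈ , le) = ≤-trans (Running.bad G PG dense e∈ le)
                (≤-by (Th * probFinal k (suc fuel) G P) (0≤* 0≤Th (0≤probFinal k P (suc fuel) G)) refl)
        ... | inj₁ good = Running.Good.next G PG dense good fuel (λ {S} S∈ →
                process fuel (removeClique G S) (less S∈) (Running.Good.dense-removeClique G PG dense good S∈))
          where
          less : ∀ {S} → S ∈ cliques k G → edgeCount (removeClique G S) ℕ.≤ fuel
          less {S} S∈ = ℕₚ.≤-pred (ℕₚ.≤-trans (ℕₚ.m<m+n (edgeCount (removeClique G S)) 0<r)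
            (ℕₚ.≤-trans (ℕₚ.≤-reflexive (edgeCount-removeClique G S∈)) ≤fuel))

-- Archimedean property and growth of binomial coefficients

1≤p*ι : ∀ {p} → 0ℚ < p → Σ ℕ λ t → 1ℚ ≤ p * ι t
1≤p*ι {p} 0<p = t , subst (λ z → 1ℚ ≤ p * z) (sym (ι≡/1 t)) (ℚₚ.toℚᵘ-cancel-≤
  (ℚᵘₚ.≤-respʳ-≃ (ℚᵘₚ.≃-sym (ℚᵘₚ.≃-trans (ℚₚ.toℚᵘ-homo-* p (+ t / 1))
    (ℚᵘₚ.*-congˡ {ℚ.toℚᵘ p} (ℚₚ.toℚᵘ-fromℚᵘ (ℚᵘ.mkℚᵘ (+ t) 0))))) (bound p 0<p)))
  where
  -- A positive fraction times its denominator is its numerator, hence at least 1.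
  t = ℚ.↧ₙ p
  bound : ∀ p → 0ℚ < p → ℚ.toℚᵘ 1ℚ ℚᵘ.≤ ℚ.toℚᵘ p ℚᵘ.* ℚᵘ.mkℚᵘ (+ ℚ.↧ₙ p) 0
  bound p@(ℚ.mkℚ (+ suc s) d-1 _) _ = ℚᵘ.*≤* (subst₂ ℤ._≤_ (lem (+ suc d-1)) (lem′ (+ suc s) (+ suc d-1))
    (ℤₚ.*-monoʳ-≤-nonNeg (+ suc d-1) (ℤ.+≤+ (s≤s (z≤n {s})))))
    where
    lem : ∀ d → + 1 ℤ.* d ≡ + 1 ℤ.* (d ℤ.* + 1)
    lem d = cong (λ z → + 1 ℤ.* z) (sym (ℤₚ.*-identityʳ d))
    lem′ : ∀ s d → s ℤ.* d ≡ s ℤ.* d ℤ.* + 1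
    lem′ s d = sym (ℤₚ.*-identityʳ (s ℤ.* d))
  bound (ℚ.mkℚ (+ zero)   _ _) 0<p with ℚₚ.drop-*<* 0<p
  ... | ℤ.+<+ ()
  bound (ℚ.mkℚ ℤ.-[1+ _ ] _ _) 0<p with ℚₚ.drop-*<* 0<p
  ... | ()

archimedean : ∀ {θ Λ} → 0ℚ < θ → 0ℚ ≤ Λ → Σ ℕ λ t → Λ ≤ θ * ι t
archimedean {θ} {Λ} 0<θ 0≤Λ = let t , 1≤ = 1≤p*ι (0<* 0<θ 0<Λ⁻¹) in t , (begin
  Λ                        ≤⟨ ≤-by 1ℚ 0≤1 (+-comm Λ 1ℚ) ⟩
  Λ′                       ≡⟨ *-identityʳ Λ′ ⟨
  Λ′ * 1ℚ                  ≤⟨ *-monoˡ (<⇒≤ 0<Λ′) 1≤ ⟩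
  Λ′ * (θ * Λ⁻¹ * ι t)     ≡⟨ lem Λ′ θ Λ⁻¹ (ι t) ⟩
  Λ′ * Λ⁻¹ * (θ * ι t)     ≡⟨ cong (_* (θ * ι t)) (ℚₚ.*-inverseʳ Λ′ {{nz}}) ⟩
  1ℚ * (θ * ι t)           ≡⟨ *-identityˡ (θ * ι t) ⟩
  θ * ι t                  ∎)
  where
  open ℚₚ.≤-Reasoning
  Λ′ = 1ℚ + Λ
  0<Λ′ : 0ℚ < Λ′
  0<Λ′ = <-≤-trans (ℚₚ.positive⁻¹ 1ℚ) (≤-by Λ 0≤Λ refl)
  nz : ℚ.NonZero Λ′
  nz = ℚ.>-nonZero 0<Λ′
  Λ⁻¹ = ℚ.1/_ Λ′ {{nz}}
  0<Λ⁻¹ : 0ℚ < Λ⁻¹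
  0<Λ⁻¹ = ℚₚ.positive⁻¹ Λ⁻¹ {{ℚₚ.1/pos⇒pos Λ′ {{positive 0<Λ′}}}}
  lem : ∀ u θ v t → u * (θ * v * t) ≡ u * v * (θ * t)
  lem = solve-∀ ℚ-ring

triangle≤ : ∀ n → triangle n ℕ.≤ n ℕ.* n
triangle≤ n = ℕₚ.≤-trans (ℕₚ.m≤m+n (triangle n) (triangle n ℕ.+ 0))
  (ℕₚ.≤-trans (ℕₚ.≤-reflexive (2*triangle n)) (ℕₚ.*-monoʳ-≤ n (ℕₚ.m∸n≤m n 1)))

ℕ-^-distrib-* : ∀ n x y → (x ℕ.* y) ℕ.^ n ≡ x ℕ.^ n ℕ.* y ℕ.^ n
ℕ-^-distrib-* zero    x y = refl
ℕ-^-distrib-* (suc n) x y = trans (cong (x ℕ.* y ℕ.*_) (ℕ-^-distrib-* n x y)) (lem x y (x ℕ.^ n) (y ℕ.^ n))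
  where
  lem : ∀ a b c d → a ℕ.* b ℕ.* (c ℕ.* d) ≡ a ℕ.* c ℕ.* (b ℕ.* d)
  lem = ℕ-solve-∀

-- Let v be the integer part of (n - 2)/(s + 1). It is at least 1, so n < (s + 1) + v (s + 1) + 2 is
-- at most (2(s + 1) + 2) v, and v^(s+1) is bounded by `v^k≤choose`.
n^s≤ratio*choose : ∀ s n → suc s ℕ.+ 2 ℕ.≤ n →
  n ℕ.^ suc s ℕ.≤ (2 ℕ.* suc s ℕ.+ 2) ℕ.^ suc s ℕ.* choose (n ℕ.∸ 2) (suc s)
n^s≤ratio*choose s n s+2≤n = ℕₚ.≤-trans (ℕₚ.^-monoˡ-≤ (suc s) n≤cv)
  (ℕₚ.≤-trans (ℕₚ.≤-reflexive (ℕ-^-distrib-* (suc s) (2 ℕ.* suc s ℕ.+ 2) v))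
    (ℕₚ.*-monoʳ-≤ ((2 ℕ.* suc s ℕ.+ 2) ℕ.^ suc s)
      (ℕₚ.≤-trans (v^k≤choose (suc s) v) (choose-mono (suc s) sv≤u))))
  where
  u = n ℕ.∸ 2
  v = u ℕ./ suc s
  sv≤u : suc s ℕ.* v ℕ.≤ u
  sv≤u = ℕₚ.≤-trans (ℕₚ.≤-reflexive (ℕₚ.*-comm (suc s) v)) (m/n*n≤m u (suc s))
  s≤u : suc s ℕ.≤ u
  s≤u = ℕₚ.≤-trans (ℕₚ.≤-reflexive (sym (ℕₚ.m+n∸n≡m (suc s) 2))) (ℕₚ.∸-monoˡ-≤ 2 s+2≤n)
  u< : u ℕ.< suc s ℕ.+ v ℕ.* suc s
  u< = ℕₚ.≤-trans (ℕₚ.≤-reflexive (cong suc (m≡m%n+[m/n]*n u (suc s)))) (ℕₚ.+-monoˡ-≤ (v ℕ.* suc s) (m%n<n u (suc s)))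
  1≤v : 1 ℕ.≤ v
  1≤v = ℕₚ.n≢0⇒n>0 λ v≡0 → ℕₚ.<-irrefl refl (ℕₚ.<-≤-trans u<
    (ℕₚ.≤-trans (ℕₚ.≤-reflexive (trans (cong (λ z → suc s ℕ.+ z ℕ.* suc s) v≡0) (ℕₚ.+-identityʳ (suc s)))) s≤u))
  2≤n : 2 ℕ.≤ n
  2≤n = ℕₚ.≤-trans (ℕₚ.m≤n+m 2 (suc s)) s+2≤n
  n≤cv : n ℕ.≤ (2 ℕ.* suc s ℕ.+ 2) ℕ.* v
  n≤cv = ℕₚ.≤-trans (ℕₚ.≤-reflexive (sym (ℕₚ.m∸n+n≡m 2≤n)))
    (ℕₚ.≤-trans (ℕₚ.+-monoˡ-≤ 2 (ℕₚ.<⇒≤ u<))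
    (ℕₚ.≤-trans (ℕₚ.≤-reflexive (lem s v))
    (ℕₚ.≤-trans (ℕₚ.+-monoʳ-≤ (v ℕ.* suc s) (ℕₚ.≤-trans (ℕₚ.≤-reflexive (sym (ℕₚ.*-identityʳ (suc s ℕ.+ 2)))) (ℕₚ.*-monoʳ-≤ (suc s ℕ.+ 2) 1≤v)))
      (ℕₚ.≤-reflexive (lem′ s v)))))
    where
    lem : ∀ s v → suc s ℕ.+ v ℕ.* suc s ℕ.+ 2 ≡ v ℕ.* suc s ℕ.+ (suc s ℕ.+ 2)
    lem = ℕ-solve-∀
    lem′ : ∀ s v → v ℕ.* suc s ℕ.+ (suc s ℕ.+ 2) ℕ.* v ≡ (2 ℕ.* suc s ℕ.+ 2) ℕ.* v
    lem′ = ℕ-solve-∀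

opaque

  choose-ratio : ℕ → ℕ
  choose-ratio s = (2 ℕ.* suc s ℕ.+ 2) ℕ.^ suc s

  0<choose-ratio : ∀ s → 0 ℕ.< choose-ratio s
  0<choose-ratio s = ℕₚ.m^n>0 (2 ℕ.* suc s ℕ.+ 2) (suc s)

  n^s≤c*choose : ∀ s n → suc s ℕ.+ 2 ℕ.≤ n → n ℕ.^ suc s ℕ.≤ choose-ratio s ℕ.* choose (n ℕ.∸ 2) (suc s)
  n^s≤c*choose = n^s≤ratio*choose

-- Choice of the parameters and comparison of exponents

module Conclusion (l a j D : ℕ) (0<l : 0 ℕ.< l) (0<a : 0 ℕ.< a) (D≡ : D ≡ (3 ℕ.+ l) ℕ.* (2 ℕ.+ l) ℕ.∸ 2)
                  (δ : ℚ) (0<δ : 0ℚ < δ) where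

  k b r r′ q : ℕ
  k  = 3 ℕ.+ l
  b  = suc j
  r  = triangle k
  r′ = Cliques.r′ 0 l
  q  = 2 ℕ.+ (j ℕ.+ j)

  D≡2r′ : D ≡ 2 ℕ.* r′
  D≡2r′ = trans D≡ (trans (cong (ℕ._∸ 2) (sym (2*triangle k))) (trans (cong (ℕ._∸ 2) (trans (cong (2 ℕ.*_) (Cliques.r≡1+r′ 0 l)) (lem r′))) (ℕₚ.m+n∸m≡n 2 (2 ℕ.* r′))))
    where
    lem : ∀ r′ → 2 ℕ.* suc r′ ≡ 2 ℕ.+ 2 ℕ.* r′
    lem = ℕ-solve-∀

  -- For q = 2b the power of the edge count in the event `P` is (r - 1) q, just one below the
  -- exponent `e₀` of `Dense`.
  Db≡r′q : D ℕ.* b ≡ r′ ℕ.* q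
  Db≡r′q = trans (cong (ℕ._* b) D≡2r′) (lem r′ j)
    where
    lem : ∀ r j → 2 ℕ.* r ℕ.* suc j ≡ r ℕ.* (2 ℕ.+ (j ℕ.+ j))
    lem = ℕ-solve-∀

  5≤r′ : 5 ℕ.≤ r′
  5≤r′ = ℕₚ.+-mono-≤ {2} {1 ℕ.+ l} {3} {triangle (2 ℕ.+ l)} (s≤s 0<l)
    (ℕₚ.≤-trans (ℕₚ.+-mono-≤ {2} {1 ℕ.+ l} {1} {triangle (1 ℕ.+ l)} (s≤s 0<l)
        (ℕₚ.≤-trans 0<l (ℕₚ.≤-trans (ℕₚ.m≤m+n l (triangle l)) (ℕₚ.≤-reflexive (sym (triangle-suc l))))))
      (ℕₚ.≤-reflexive (sym (triangle-suc (1 ℕ.+ l)))))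

  -- The slack n^(aD) has to cover a loss of n^6 and a further factor n for the constants.
  8≤D : 8 ℕ.≤ D
  8≤D = ℕₚ.≤-trans (ℕₚ.≤-trans (ℕₚ.m≤m+n 8 2) (ℕₚ.*-monoʳ-≤ 2 5≤r′)) (ℕₚ.≤-reflexive (sym D≡2r′))

  X e₀ : ℕ
  X  = (2 ℕ.* D ℕ.∸ 1) ℕ.* b ℕ.+ a ℕ.* D
  e₀ = suc (r′ ℕ.* q)

  X≡ : X ℕ.+ b ≡ 2 ℕ.* D ℕ.* b ℕ.+ a ℕ.* D
  X≡ = trans (lem (2 ℕ.* D ℕ.∸ 1) b (a ℕ.* D)) (cong (λ z → z ℕ.* b ℕ.+ a ℕ.* D)
    (ℕₚ.m∸n+n≡m (ℕₚ.≤-trans (ℕₚ.≤-trans (s≤s z≤n) 8≤D) (ℕₚ.m≤m+n D (D ℕ.+ 0)))))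
    where
    lem : ∀ x b y → x ℕ.* b ℕ.+ y ℕ.+ b ≡ (x ℕ.+ 1) ℕ.* b ℕ.+ y
    lem = ℕ-solve-∀

  Db≤X : D ℕ.* b ℕ.≤ X
  Db≤X = ℕₚ.≤-trans (ℕₚ.*-monoˡ-≤ b D≤) (ℕₚ.m≤m+n ((2 ℕ.* D ℕ.∸ 1) ℕ.* b) (a ℕ.* D))
    where
    D≤ : D ℕ.≤ 2 ℕ.* D ℕ.∸ 1
    D≤ = ℕₚ.≤-trans (ℕₚ.≤-reflexive (sym (ℕₚ.m+n∸n≡m D 1))) (ℕₚ.∸-monoˡ-≤ 1 (ℕₚ.+-monoʳ-≤ D
      (ℕₚ.≤-trans (ℕₚ.≤-trans (s≤s z≤n) 8≤D) (ℕₚ.m≤m+n D 0))))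

  -- `η` is the largest value that `η-small` permits. `c₂` compares n^((l+1)q) with the q-th power
  -- of the initial degree.
  R η C c₂ : ℚ
  R  = ι r
  η  = 1/ι (6 ℕ.* q ℕ.* r)
  C  = step-constant j R
  c₂ = ι (choose-ratio l ℕ.^ q)

  0<6qr : 0 ℕ.< 6 ℕ.* q ℕ.* r
  0<6qr = ℕₚ.<-≤-trans (Cliques.0<r 0 l) (ℕₚ.m≤n*m r (6 ℕ.* q))

  0<η : 0ℚ < η
  0<η = 0<1/ι 0<6qr

  6qRη≡1 : (+ 6 / 1) * ι q * R * η ≡ 1ℚ
  6qRη≡1 = trans (cong (_* η) (sym (trans (ι-* (6 ℕ.* q) r) (cong (_* R) (ι-* 6 q))))) (ι*1/ι≡1 0<6qr)

  η≤1 : η ≤ 1ℚ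
  η≤1 = ≤-trans (≤-reflexive (sym (*-identityˡ η))) (≤-trans (*-monoʳ (<⇒≤ 0<η)
    (≤-trans (≤-reflexive (sym (+-identityʳ 1ℚ))) (ι-mono 0<6qr)))
    (≤-reflexive (ι*1/ι≡1 0<6qr)))

  -- From this t on, one factor n outweighs all constants, including 1/δ.
  threshold : Σ ℕ λ t → c₂ * C ≤ δ * η ^ q * ι t
  threshold = archimedean (0<* 0<δ (0<^ q 0<η)) (0≤* (0≤ι (choose-ratio l ℕ.^ q)) (0≤step-constant j (0≤ι r)))

  cubic N₀ : ℕ
  cubic = 2 ℕ.* (q ℕ.* (r ℕ.* (r ℕ.* r)) ℕ.+ r ℕ.* r)
  N₀    = proj₁ threshold ℕ.+ cubic ℕ.+ (suc l ℕ.+ 2)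

  module _ (n : ℕ) (N₀≤n : N₀ ℕ.≤ n) where

    open ℚₚ.≤-Reasoning

    t≤n : proj₁ threshold ℕ.≤ n
    t≤n = ℕₚ.≤-trans (ℕₚ.≤-trans (ℕₚ.m≤m+n _ cubic) (ℕₚ.m≤m+n _ (suc l ℕ.+ 2))) N₀≤n

    cubic≤n : cubic ℕ.≤ n
    cubic≤n = ℕₚ.≤-trans (ℕₚ.≤-trans (ℕₚ.m≤n+m cubic (proj₁ threshold)) (ℕₚ.m≤m+n _ (suc l ℕ.+ 2))) N₀≤n

    l+3≤n : suc l ℕ.+ 2 ℕ.≤ n
    l+3≤n = ℕₚ.≤-trans (ℕₚ.m≤n+m (suc l ℕ.+ 2) (proj₁ threshold ℕ.+ cubic)) N₀≤n

    0<n : 0 ℕ.< n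
    0<n = ℕₚ.≤-trans (s≤s z≤n) l+3≤n

    2≤n : 2 ℕ.≤ n
    2≤n = ℕₚ.≤-trans (ℕₚ.m≤n+m 2 (suc l)) l+3≤n

    instance
      n-nonZero : ℕ.NonZero n
      n-nonZero = ℕ.>-nonZero 0<n

    P : Graph n → Bool
    P G = (edgeCount G ℕ.^ (D ℕ.* b)) ℕ.≤ᵇ (n ℕ.^ X)

    edges : Graph n → List (Fin n × Fin n)
    edges = Cliques.edges n l

    edgeCount-complete : edgeCount (completeGraph n) ≡ triangle n
    edgeCount-complete = Cliques.edgeCount-complete n l

    L M : ℚ
    L = Cliques.L n l
    M = Cliques.M n l

    P-false : ∀ G → P G ≡ false → n ℕ.^ X ℕ.< edgeCount G ℕ.^ (D ℕ.* b)
    P-false G PG = ℕₚ.≰⇒> λ le → false≢T (subst Data.Bool.T PG (ℕₚ.≤⇒≤ᵇ le))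
      where
      false≢T : Data.Bool.T false → ⊥
      false≢T ()

    P-mono : ∀ G S → P G ≡ true → P (removeClique G S) ≡ true
    P-mono G S PG = T⇒≡ (ℕₚ.≤⇒≤ᵇ (ℕₚ.≤-trans (ℕₚ.^-monoˡ-≤ (D ℕ.* b) fewer) (ℕₚ.≤ᵇ⇒≤ _ _ (subst Data.Bool.T (sym PG) _))))
      where
      T⇒≡ : ∀ {c} → Data.Bool.T c → c ≡ true
      T⇒≡ {true} _ = refl
      fewer : edgeCount (removeClique G S) ℕ.≤ edgeCount G
      fewer = ℕₚ.≤-trans (ℕₚ.≤-reflexive (cong length (Cliques.edges-removeClique n l G S))) (Listₚ.length-filter _ (edges G))

    large-n : ∀ G → P G ≡ false → n ℕ.≤ edgeCount G
    large-n G PG = ℕₚ.≮⇒≥ λ m<n → ℕₚ.<-irrefl refl (ℕₚ.<-≤-trans (P-false G PG)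
      (ℕₚ.≤-trans (ℕₚ.^-monoˡ-≤ (D ℕ.* b) (ℕₚ.<⇒≤ m<n)) (ℕₚ.^-monoʳ-≤ n Db≤X)))

    ch T : ℕ
    ch = choose (n ℕ.∸ 2) (suc l)
    T  = triangle n

    0<ch : 0 ℕ.< ch
    0<ch = ℕₚ.n≢0⇒n>0 λ ch≡0 → ℕₚ.<-irrefl refl (ℕₚ.<-≤-trans (ℕₚ.^-monoˡ-< (suc l) 0<n)
      (ℕₚ.≤-trans (n^s≤c*choose l n l+3≤n) (ℕₚ.≤-reflexive (trans (cong (choose-ratio l ℕ.*_) ch≡0)
        (ℕₚ.*-zeroʳ (choose-ratio l))))))

    0<T : 0 ℕ.< T
    0<T = ℕₚ.n≢0⇒n>0 λ T≡0 → ℕₚ.<-irrefl refl (ℕₚ.<-≤-trans (ℕₚ.*-mono-≤ 0<n (ℕₚ.∸-monoˡ-≤ 1 2≤n))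
      (ℕₚ.≤-reflexive (trans (sym (2*triangle n)) (cong (2 ℕ.*_) T≡0))))

    -- `κ₀` and `B` are normalised so that `Dense` is an equality for the complete graph, with
    -- average degree `ch` and `T` edges. `Th` is then what `Dense` guarantees for (η m)^q when A^e₀
    -- is bounded below by n^X.
    κ₀ B Th : ℚ
    κ₀ = ι ch ^ q
    B  = ι (T ℕ.^ e₀)
    Th = η ^ q * (κ₀ * ι (n ℕ.^ X)) * 1/ι (T ℕ.^ e₀)

    0<T^e₀ : 0 ℕ.< T ℕ.^ e₀
    0<T^e₀ = ℕₚ.m^n>0 T {{ℕ.>-nonZero 0<T}} e₀

    ThB≡ : Th * B ≡ η ^ q * (κ₀ * ι (n ℕ.^ X))
    ThB≡ = trans (lem (η ^ q * (κ₀ * ι (n ℕ.^ X))) (1/ι (T ℕ.^ e₀)) B)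
      (trans (cong (η ^ q * (κ₀ * ι (n ℕ.^ X)) *_) (ι*1/ι≡1 0<T^e₀)) (*-identityʳ _))
      where
      lem : ∀ u v w → u * v * w ≡ u * (w * v)
      lem = solve-∀ ℚ-ring

    0<κ₀ : 0ℚ < κ₀
    0<κ₀ = 0<^ q (0<ι 0<ch)

    0<B : 0ℚ < B
    0<B = 0<ι 0<T^e₀

    0<Th : 0ℚ < Th
    0<Th = 0<* (0<* (0<^ q 0<η) (0<* 0<κ₀ (0<ι (ℕₚ.m^n>0 n X)))) (0<1/ι 0<T^e₀)

    large-A : ∀ G → P G ≡ false → Th * B ≤ η ^ q * (κ₀ * ι (edgeCount G) ^ e₀)
    large-A G PG = ≤-trans (≤-reflexive ThB≡) (*-monoˡ (0≤^ q (<⇒≤ 0<η)) (*-monoˡ (<⇒≤ 0<κ₀)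
      (≤-trans (ι-mono X≤) (≤-reflexive (ι-^ (edgeCount G) e₀)))))
      where
      m = edgeCount G
      -- Failure of `P` bounds the power r′ q = e₀ - 1 of m; the remaining factor m is at least 1.
      X≤ : n ℕ.^ X ℕ.≤ m ℕ.^ e₀
      X≤ = ℕₚ.≤-trans (ℕₚ.<⇒≤ (P-false G PG)) (ℕₚ.≤-trans (ℕₚ.≤-reflexive (cong (m ℕ.^_) Db≡r′q))
        (ℕₚ.m≤n*m (m ℕ.^ (r′ ℕ.* q)) m {{ℕ.>-nonZero (ℕₚ.<-≤-trans 0<n (large-n G PG))}}))

    params : Cliques.Process.Parameters n l j P η κ₀ B Th
    params = record
      { 0<n = 0<n ; 0≤η = <⇒≤ 0<η ; η≤1 = η≤1 ; η-small = ≤-reflexive 6qRη≡1 ; 0<κ₀ = 0<κ₀ ; 0<B = 0<B ; 0≤Th = <⇒≤ 0<Th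
      ; P-mono = P-mono ; large-n = large-n ; large-r = λ G PG → ℕₚ.≤-trans cubic≤n (large-n G PG) ; large-A = large-A }

    K : Graph n
    K = completeGraph n

    deg : Fin n × Fin n → ℚ
    deg = Cliques.deg n l K

    av Φ Ψ : ℚ
    av = Cliques.Process.av n l j P η κ₀ B Th K
    Φ  = Cliques.Process.Φ n l j P η κ₀ B Th K
    Ψ  = Cliques.Process.Ψ n l j P η κ₀ B Th K

    d≡ch : ∀ {e} → e ∈ edges K → deg e ≡ ι ch
    d≡ch {e} e∈ = Cliques.d-complete n l (n ℕ.∸ 2) (ℕₚ.m∸n+n≡m 2≤n) (subst (e ∈_) (Cliques.edges-complete n l) e∈)

    av≡ch : av ≡ ι ch
    av≡ch = begin-equality
      R * Cliques.hyperedges n l K * 1/ι (edgeCount K)                ≡⟨ cong (_* 1/ι (edgeCount K)) (Hypergraph.Counting.∑d≡R*Q (edges K) (cliques k K) (Cliques.inc n l) (Cliques.eqᵇ n l) (Cliques.meet n l) (Cliques.uniform-cliques n l K)) ⟨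
      ∑ (edges K) deg * 1/ι (edgeCount K)      ≡⟨ cong (_* 1/ι (edgeCount K)) (trans (∑-cong (edges K) d≡ch) (∑-const (edges K) (ι ch))) ⟩
      ι (edgeCount K) * ι ch * 1/ι (edgeCount K)   ≡⟨ lem (ι (edgeCount K)) (ι ch) (1/ι (edgeCount K)) ⟩
      ι (edgeCount K) * 1/ι (edgeCount K) * ι ch   ≡⟨ cong (_* ι ch) (ι*1/ι≡1 (subst (0 ℕ.<_) (sym edgeCount-complete) 0<T)) ⟩
      1ℚ * ι ch                                    ≡⟨ *-identityˡ (ι ch) ⟩
      ι ch                                         ∎
      where
      lem : ∀ u v w → u * v * w ≡ u * w * v
      lem = solve-∀ ℚ-ring

    dense : Cliques.Process.Dense n l j P η κ₀ B Th K
    dense = ≤-reflexive (cong₂ _*_ (cong (_^ q) (sym av≡ch))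
      (trans (cong (λ m → ι m ^ e₀) edgeCount-complete) (sym (ι-^ T e₀))))

    Φ≡0 : Φ ≡ 0ℚ
    Φ≡0 = trans (∑-cong (edges K) (λ {e} e∈ → trans (cong (even-power j) (trans (cong₂ _-_ (d≡ch e∈) av≡ch) (ℚₚ.+-inverseʳ (ι ch))))
      (*-zeroˡ ((0ℚ * 0ℚ) ^ j)))) (∑-0 (edges K))

    -- The exponent common to both sides: (L M)^b gives (2l + 1) b, and T^(Db) gives 2 D b.
    E : ℕ
    E = (2 ℕ.* l ℕ.+ 1) ℕ.* b ℕ.+ 2 ℕ.* (D ℕ.* b)

    -- The 6 counts three factors T ≤ n²: one from the edge count in `Ψ`, one from `S₀`, and the
    -- surplus one in T^e₀.
    upper : T ℕ.* T ℕ.* ((n ℕ.^ l ℕ.* n ℕ.^ suc l) ℕ.^ b) ℕ.* T ℕ.^ e₀ ℕ.≤ n ℕ.^ (6 ℕ.+ E)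
    upper = ℕₚ.≤-trans (ℕₚ.*-mono-≤ (ℕₚ.*-monoˡ-≤ _ (ℕₚ.*-mono-≤ T≤ T≤)) (ℕₚ.^-monoˡ-≤ e₀ T≤)) (ℕₚ.≤-reflexive (begin-≡))
      where
      T≤ : T ℕ.≤ n ℕ.^ 2
      T≤ = ℕₚ.≤-trans (triangle≤ n) (ℕₚ.≤-reflexive (cong (n ℕ.*_) (sym (ℕₚ.*-identityʳ n))))
      exponent : ∀ l b Db → 2 ℕ.+ 2 ℕ.+ (l ℕ.+ suc l) ℕ.* b ℕ.+ 2 ℕ.* suc Db ≡ 6 ℕ.+ ((2 ℕ.* l ℕ.+ 1) ℕ.* b ℕ.+ 2 ℕ.* Db)
      exponent = ℕ-solve-∀
      begin-≡ : n ℕ.^ 2 ℕ.* n ℕ.^ 2 ℕ.* ((n ℕ.^ l ℕ.* n ℕ.^ suc l) ℕ.^ b) ℕ.* (n ℕ.^ 2) ℕ.^ e₀ ≡ n ℕ.^ (6 ℕ.+ E)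
      begin-≡ = trans (cong₂ ℕ._*_ (cong₂ ℕ._*_ (sym (ℕₚ.^-distribˡ-+-* n 2 2))
            (trans (cong (ℕ._^ b) (sym (ℕₚ.^-distribˡ-+-* n l (suc l)))) (ℕₚ.^-*-assoc n (l ℕ.+ suc l) b))) (ℕₚ.^-*-assoc n 2 e₀))
        (trans (cong (ℕ._* n ℕ.^ (2 ℕ.* e₀)) (sym (ℕₚ.^-distribˡ-+-* n (2 ℕ.+ 2) ((l ℕ.+ suc l) ℕ.* b))))
        (trans (sym (ℕₚ.^-distribˡ-+-* n (2 ℕ.+ 2 ℕ.+ (l ℕ.+ suc l) ℕ.* b) (2 ℕ.* e₀)))
          (cong (n ℕ.^_) (trans (cong (λ z → 2 ℕ.+ 2 ℕ.+ (l ℕ.+ suc l) ℕ.* b ℕ.+ 2 ℕ.* suc z) (sym Db≡r′q)) (exponent l b (D ℕ.* b))))))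

    -- Here the exponent 1/D is decisive: it puts -b into X, so (l + 1) q + X = (2l + 2) b - b + 2 D
    -- b + a D, which is exactly E + a D.
    lower : n ℕ.^ (7 ℕ.+ E) ℕ.≤ choose-ratio l ℕ.^ q ℕ.* (ch ℕ.^ q ℕ.* n ℕ.^ X)
    lower = ℕₚ.≤-trans (ℕₚ.^-monoʳ-≤ n 7+E≤) (ℕₚ.≤-trans (ℕₚ.≤-reflexive (trans (ℕₚ.^-distribˡ-+-* n (suc l ℕ.* q) X)
        (cong (ℕ._* n ℕ.^ X) (sym (ℕₚ.^-*-assoc n (suc l) q)))))
      (ℕₚ.≤-trans (ℕₚ.*-monoˡ-≤ (n ℕ.^ X) (ℕₚ.≤-trans (ℕₚ.^-monoˡ-≤ q (n^s≤c*choose l n l+3≤n))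
          (ℕₚ.≤-reflexive (ℕ-^-distrib-* q c ch))))
        (ℕₚ.≤-reflexive (ℕₚ.*-assoc (c ℕ.^ q) (ch ℕ.^ q) (n ℕ.^ X)))))
      where
      c = choose-ratio l
      exponent : ∀ l j Db aD → suc l ℕ.* (2 ℕ.+ (j ℕ.+ j)) ℕ.+ (2 ℕ.* Db ℕ.+ aD)
        ≡ (2 ℕ.* l ℕ.+ 1) ℕ.* suc j ℕ.+ 2 ℕ.* Db ℕ.+ aD ℕ.+ suc j
      exponent = ℕ-solve-∀
      8≤aD : 8 ℕ.≤ a ℕ.* D
      8≤aD = ℕₚ.≤-trans 8≤D (ℕₚ.m≤n*m D a {{ℕ.>-nonZero 0<a}})
      total : suc l ℕ.* q ℕ.+ X ≡ E ℕ.+ a ℕ.* D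
      total = ℕₚ.+-cancelʳ-≡ b _ _ (trans (ℕₚ.+-assoc (suc l ℕ.* q) X b)
        (trans (cong (suc l ℕ.* q ℕ.+_) (trans X≡ (cong (ℕ._+ a ℕ.* D) (ℕₚ.*-assoc 2 D b)))) (exponent l j (D ℕ.* b) (a ℕ.* D))))
      7+E≤ : 7 ℕ.+ E ℕ.≤ suc l ℕ.* q ℕ.+ X
      7+E≤ = ℕₚ.≤-trans (ℕₚ.≤-reflexive (ℕₚ.+-comm 7 E)) (ℕₚ.≤-trans (ℕₚ.+-monoʳ-≤ E (ℕₚ.≤-trans (ℕₚ.n≤1+n 7) 8≤aD))
        (ℕₚ.≤-reflexive (sym total)))

    -- In the complete graph all degrees agree, so Φ = 0 and only T · S₀ remains. Multiplying by `B`
    -- and `c₂` turns the claim into a comparison of powers of n.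
    Ψ≤δTh : Ψ ≤ δ * Th
    Ψ≤δTh = *-cancelˡ 0<B (*-cancelˡ 0<c₂ (begin
      c₂ * (B * Ψ)                                   ≡⟨ cong (λ z → c₂ * (B * z)) Ψ≡ ⟩
      c₂ * (B * (ι T * (0ℚ + C * (L * M) ^ b * ι T)))  ≡⟨ lem₁ c₂ B (ι T) C ((L * M) ^ b) ⟩
      c₂ * C * (ι T * ι T * (L * M) ^ b * B)           ≡⟨ cong (c₂ * C *_) collect ⟩
      c₂ * C * ι (T ℕ.* T ℕ.* ((n ℕ.^ l ℕ.* n ℕ.^ suc l) ℕ.^ b) ℕ.* T ℕ.^ e₀)
                                                       ≤⟨ *-monoˡ (0≤* (<⇒≤ 0<c₂) (0≤step-constant j (0≤ι r))) (ι-mono upper) ⟩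
      c₂ * C * ι (n ℕ.^ (6 ℕ.+ E))                     ≤⟨ *-monoʳ (0≤ι (n ℕ.^ (6 ℕ.+ E))) (proj₂ threshold) ⟩
      δ * η ^ q * ι (proj₁ threshold) * ι (n ℕ.^ (6 ℕ.+ E))
                                                       ≤⟨ *-monoʳ (0≤ι (n ℕ.^ (6 ℕ.+ E))) (*-monoˡ 0≤δη (ι-mono t≤n)) ⟩
      δ * η ^ q * ι n * ι (n ℕ.^ (6 ℕ.+ E))            ≡⟨ trans (*-assoc (δ * η ^ q) (ι n) (ι (n ℕ.^ (6 ℕ.+ E))))
                                                            (cong (δ * η ^ q *_) (sym (ι-* n (n ℕ.^ (6 ℕ.+ E))))) ⟩
      δ * η ^ q * ι (n ℕ.^ (7 ℕ.+ E))                  ≤⟨ *-monoˡ 0≤δη (ι-mono lower) ⟩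
      δ * η ^ q * ι (choose-ratio l ℕ.^ q ℕ.* (ch ℕ.^ q ℕ.* n ℕ.^ X))
                                                       ≡⟨ cong (δ * η ^ q *_) (trans (ι-* (choose-ratio l ℕ.^ q) (ch ℕ.^ q ℕ.* n ℕ.^ X))
                                                            (cong (c₂ *_) (trans (ι-* (ch ℕ.^ q) (n ℕ.^ X)) (cong (_* ι (n ℕ.^ X)) (ι-^ ch q))))) ⟩
      δ * η ^ q * (c₂ * (κ₀ * ι (n ℕ.^ X)))            ≡⟨ lem₂ δ (η ^ q) c₂ (κ₀ * ι (n ℕ.^ X)) ⟩
      c₂ * (δ * (η ^ q * (κ₀ * ι (n ℕ.^ X))))          ≡⟨ cong (λ z → c₂ * (δ * z)) ThB≡ ⟨
      c₂ * (δ * (Th * B))                              ≡⟨ lem₃ c₂ δ Th B ⟩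
      c₂ * (B * (δ * Th))                              ∎))
      where
      0<c₂ : 0ℚ < c₂
      0<c₂ = 0<ι (ℕₚ.m^n>0 (choose-ratio l) {{ℕ.>-nonZero (0<choose-ratio l)}} q)
      0≤δη : 0ℚ ≤ δ * η ^ q
      0≤δη = 0≤* (<⇒≤ 0<δ) (0≤^ q (<⇒≤ 0<η))
      Ψ≡ : Ψ ≡ ι T * (0ℚ + C * (L * M) ^ b * ι T)
      Ψ≡ = cong₂ (λ m φ → ι m * (φ + Cliques.Process.S₀ n l j P η κ₀ B Th)) edgeCount-complete Φ≡0
      lem₁ : ∀ c B T C u → c * (B * (T * (0ℚ + C * u * T))) ≡ c * C * (T * T * u * B)
      lem₁ = solve-∀ ℚ-ring
      lem₂ : ∀ δ u c v → δ * u * (c * v) ≡ c * (δ * (u * v))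
      lem₂ = solve-∀ ℚ-ring
      lem₃ : ∀ c δ t B → c * (δ * (t * B)) ≡ c * (B * (δ * t))
      lem₃ = solve-∀ ℚ-ring
      collect : ι T * ι T * (L * M) ^ b * B ≡ ι (T ℕ.* T ℕ.* ((n ℕ.^ l ℕ.* n ℕ.^ suc l) ℕ.^ b) ℕ.* T ℕ.^ e₀)
      collect = sym (trans (ι-* (T ℕ.* T ℕ.* ((n ℕ.^ l ℕ.* n ℕ.^ suc l) ℕ.^ b)) (T ℕ.^ e₀)) (cong (_* B)
        (trans (ι-* (T ℕ.* T) ((n ℕ.^ l ℕ.* n ℕ.^ suc l) ℕ.^ b)) (cong₂ _*_ (ι-* T T)
          (trans (ι-^ (n ℕ.^ l ℕ.* n ℕ.^ suc l) b) (cong (_^ b) (ι-* (n ℕ.^ l) (n ℕ.^ suc l))))))))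

    conclusion : 1ℚ - δ ≤ probRemoval k n P
    conclusion = *-cancelˡ 0<Th (begin
      Th * (1ℚ - δ)                                        ≡⟨ lem Th δ ⟩
      Th - δ * Th                                          ≤⟨ +-monoˡ-≤ (- (δ * Th)) (Cliques.Process.process n l j P η κ₀ B Th params (n ℕ.* n) K
                                                                (ℕₚ.≤-trans (ℕₚ.≤-reflexive edgeCount-complete) (triangle≤ n)) dense) ⟩
      Ψ + Th * probRemoval k n P - δ * Th                ≤⟨ +-monoˡ-≤ (- (δ * Th)) (+-monoˡ-≤ (Th * probRemoval k n P) Ψ≤δTh) ⟩
      δ * Th + Th * probRemoval k n P - δ * Th             ≡⟨ lem′ (δ * Th) (Th * probRemoval k n P) ⟩
      Th * probRemoval k n P                               ∎)
      where
      lem : ∀ t δ → t * (1ℚ - δ) ≡ t - δ * t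
      lem = solve-∀ ℚ-ring
      lem′ : ∀ u v → u + v - u ≡ v
      lem′ = solve-∀ ℚ-ring

theorem1p1 : (k : ℕ) → 4 ℕ.≤ k →
    (a b : ℕ) → 0 ℕ.< a → 0 ℕ.< b →
    (δ : ℚ) → 0ℚ < δ →
    Σ ℕ (λ N → (n : ℕ) → N ℕ.≤ n →
    1ℚ - δ ≤ probRemoval k n (smallEdgeSet k n a b))
theorem1p1 (suc (suc (suc (suc l₀)))) (s≤s (s≤s (s≤s (s≤s z≤n)))) (suc a₀) (suc j) (s≤s z≤n) (s≤s z≤n) δ 0<δ =
  -- Here k = 3 + l with l = 1 + l₀, and b = 1 + j, so the moment has order q = 2 + 2 j = 2 b.
  Conclusion.N₀ (suc l₀) (suc a₀) j D (s≤s z≤n) (s≤s z≤n) refl δ 0<δ ,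
  Conclusion.conclusion (suc l₀) (suc a₀) j D (s≤s z≤n) (s≤s z≤n) refl δ 0<δ
  where
  D = (4 ℕ.+ l₀) ℕ.* (3 ℕ.+ l₀) ℕ.∸ 2
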